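{- For all $k\geq 2$, $$\sum_{n\geq0}I^e_{2134\cdots k;1}(n)\,x^n=(1-x^2)\sum_{j=3}^{k}\frac{x^{k+2-j}R^e_{j-1}(x^2)\prod_{i=j}^{k}R_i(-x^2)}{U_j\left(\frac{1}{2x}\right)}.$$
   Context: $2134\cdots k$ denotes the permutation $(2,1,3,4,\dots,k)$ (for $k=2$ it is $21$). For a pattern $\tau$ and $r\geq0$, $I^e_{\tau;r}(n)$ is the number of even involutions $\pi\in\mathfrak{S}_n$ (i.e. $\pi=\pi^{ -1}$ with an even number of inversions, an inversion being a pair $i<j$ with $\pi_i>\pi_j$) that avoid $132$ and contain $\tau$ exactly $r$ times (an occurrence of $\tau\in\mathfrak{S}_m$ is an index set $i_1<\dots<i_m$ with $\pi_{i_1}\cdots\pi_{i_m}$ order-isomorphic to $\tau$). $U_r$ is the Chebyshev polynomial of the second kind ($U_0=1$, $U_1(t)=2t$, $U_r(t)=2tU_{r-1}(t)-U_{r-2}(t)$). For $k\geq1$, $R_k(x)=\dfrac{U_{k-1}\left(\frac{1}{2\sqrt{x}}\right)}{\sqrt{x}\,U_k\left(\frac{1}{2\sqrt{x}}\right)}$ (rational in $x$; $R_1=1$, $R_k=1/(1-xR_{k-1})$), and $R^e_k(x)=\tfrac12(R_k(x)+R_k(-x))$. An empty sum is $0$. -}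

module Defs where

open import Data.Bool using (Bool; true; false; if_then_else_; _∧_; not)
open import Data.Nat as ℕ using (ℕ; zero; suc; _∸_; _<ᵇ_; _≡ᵇ_; _%_)
open import Data.Fin using (Fin; toℕ)
open import Data.Vec using (Vec; []; _∷_; lookup; toList; head)
open import Data.List as List using (List; []; _∷_; map; concatMap; allFin; filterᵇ; length; upTo; foldr; zipWith)
open import Data.Integer using (+_)
open import Data.Rational using (ℚ; 0ℚ; 1ℚ; ½; _+_; _*_; -_; _-_; _/_)

all : ∀ {A : Set} → (A → Bool) → List A → Bool
all p = foldr (λ x b → p x ∧ b) true

allVecs : (m n : ℕ) → List (Vec (Fin n) m)
allVecs zero    n = [] ∷ []
allVecs (suc m) n = concatMap (λ x → map (x ∷_) (allVecs m n)) (allFin n)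

_≡ᶠ_ : ∀ {n} → Fin n → Fin n → Bool
a ≡ᶠ b = toℕ a ≡ᵇ toℕ b

_<ᶠ_ : ∀ {n} → Fin n → Fin n → Bool
a <ᶠ b = toℕ a <ᵇ toℕ b

-- π is a permutation of [n] (injective self-map of a finite set).
isPerm : ∀ {n} → Vec (Fin n) n → Bool
isPerm {n} π = all (λ i → all (λ j → (i ≡ᶠ j) ∨' not (lookup π i ≡ᶠ lookup π j)) (allFin n)) (allFin n)
  where
  _∨'_ : Bool → Bool → Bool
  true ∨' _ = true
  false ∨' b = b

isInvolution : ∀ {n} → Vec (Fin n) n → Bool
isInvolution {n} π = all (λ i → lookup π (lookup π i) ≡ᶠ i) (allFin n)

inversions : ∀ {n} → Vec (Fin n) n → ℕ
inversions {n} π =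
  length (filterᵇ (λ p → (Pair.fst p <ᶠ Pair.snd p) ∧ (lookup π (Pair.snd p) <ᶠ lookup π (Pair.fst p)))
                  (concatMap (λ i → map (λ j → mkPair i j) (allFin n)) (allFin n)))
  where
  record Pair : Set where
    constructor mkPair
    field fst snd : Fin n

isEven : ℕ → Bool
isEven k = k % 2 ≡ᵇ 0

increasing : ∀ {m n} → Vec (Fin n) m → Bool
increasing {m} f = all (λ a → all (λ b → not (a <ᶠ b) ∨'' (lookup f a <ᶠ lookup f b)) (allFin m)) (allFin m)
  where
  _∨''_ : Bool → Bool → Bool
  true ∨'' _ = true
  false ∨'' b = b

-- A pattern τ ∈ 𝔖_m given by its values τ : Fin m → ℕ (one-line notation).
-- Number of occurrences of τ in π: index sets i_1 < ... < i_m such that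
-- π_{i_1} ... π_{i_m} is order-isomorphic to τ.
occurrences : ∀ {n m} → (Fin m → ℕ) → Vec (Fin n) n → ℕ
occurrences {n} {m} τ π =
  length (filterᵇ (λ f → increasing f ∧
            all (λ a → all (λ b → (lookup π (lookup f a) <ᶠ lookup π (lookup f b)) ≡ᵇᵇ (τ a <ᵇ τ b))
                               (allFin m)) (allFin m))
          (allVecs m n))
  where
  _≡ᵇᵇ_ : Bool → Bool → Bool
  true ≡ᵇᵇ b = b
  false ≡ᵇᵇ b = not b

p132 : Fin 3 → ℕ
p132 a = lookup (0 ∷ 2 ∷ 1 ∷ []) a

-- The pattern 2134⋯k (0-based values 1,0,2,3,…,k-1); for k = 2 it is 21.
p2134 : (k : ℕ) → Fin k → ℕ
p2134 k a with toℕ a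
... | zero = 1
... | suc zero = 0
... | suc (suc t) = suc (suc t)

Ie : ∀ {m} → (Fin m → ℕ) → ℕ → ℕ → ℕ
Ie τ r n = length (filterᵇ
  (λ π → isPerm π ∧ isInvolution π ∧ isEven (inversions π)
         ∧ (occurrences p132 π ≡ᵇ 0) ∧ (occurrences τ π ≡ᵇ r))
  (allVecs n n))

Series : Set
Series = ℕ → ℚ

ℕtoℚ : ℕ → ℚ
ℕtoℚ n = + n / 1

sumℚ : List ℚ → ℚ
sumℚ = foldr _+_ 0ℚ

zeroS oneS X : Series
zeroS _ = 0ℚ
oneS zero = 1ℚ
oneS (suc _) = 0ℚ
X (suc zero) = 1ℚ
X _ = 0ℚ

_⊕_ _⊖_ _⊛_ : Series → Series → Series
(a ⊕ b) n = a n + b n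
(a ⊖ b) n = a n - b n
(a ⊛ b) n = sumℚ (map (λ i → a i * b (n ∸ i)) (upTo (suc n)))

scale : ℚ → Series → Series
scale c a n = c * a n

shift : ℕ → Series → Series
shift m a n = if n <ᵇ m then 0ℚ else a (n ∸ m)

-- Multiplicative inverse of a series a with constant term a₀ = 1:
-- b₀ = 1, b_{n} = - Σ_{i=1}^{n} a_i b_{n-i}.
-- (Only ever applied to series with constant term 1.)
inv1 : Series → Series
inv1 a n = head (go n)
  where
  -- go n = [b_n, b_{n-1}, …, b_0]
  go : (n : ℕ) → Vec ℚ (suc n)
  go zero = 1ℚ ∷ []
  go (suc n) = (- sumℚ (zipWith (λ t bt → a (suc t) * bt) (upTo (suc n)) (toList (go n)))) ∷ go n

negX : Series → Series
negX a n = if isEven n then a n else - a n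

sqX : Series → Series
sqX a n = if isEven n then a (n ℕ./ 2) else 0ℚ

evenPart : Series → Series
evenPart a = scale ½ (a ⊕ negX a)

prodS : List Series → Series
prodS = foldr _⊛_ oneS

sumS : List Series → Series
sumS = foldr _⊕_ zeroS

range : ℕ → ℕ → List ℕ
range a b = List.applyUpTo (λ i → a ℕ.+ i) (suc b ∸ a)

-- R_1 = 1, R_k = 1/(1 - x R_{k-1}); R_0 unused (set to 0, never used below).
R : ℕ → Series
R zero = zeroS
R (suc zero) = oneS
R (suc (suc k)) = inv1 (oneS ⊖ (X ⊛ R (suc k)))

Re : ℕ → Series
Re k = evenPart (R k)

-- Chebyshev polynomials of the second kind, as coefficient sequences in t
-- (U r m = coefficient of t^m in U_r(t)).
U : ℕ → ℕ → ℚ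
U zero = oneS
U (suc zero) = scale (ℕtoℚ 2) X
U (suc (suc r)) = (scale (ℕtoℚ 2) (X ⊛ U (suc r))) ⊖ U r

_^ℚ_ : ℚ → ℕ → ℚ
q ^ℚ zero = 1ℚ
q ^ℚ suc m = q * (q ^ℚ m)

-- x^j · U_j(1/(2x)) as a polynomial in x: the coefficient of x^d is
-- [t^{j-d}]U_j · (1/2)^{j-d} for d ≤ j, and 0 for d > j.
-- (Its constant term is [t^j]U_j / 2^j = 1.)
homU : ℕ → Series
homU j d = if j <ᵇ d then 0ℚ else U j (j ∸ d) * (½ ^ℚ (j ∸ d))

-- 1 / U_j(1/(2x)) = x^j / (x^j U_j(1/(2x))) as a formal power series.
invUj : ℕ → Series
invUj j = shift j (inv1 (homU j))

rhs313 : ℕ → Series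
rhs313 k = (oneS ⊖ (X ⊛ X)) ⊛ sumS (map term (range 3 k))
  where
  term : ℕ → Series
  term j = shift ((k ℕ.+ 2) ∸ j)
             (sqX (Re (j ∸ 1)) ⊛ (prodS (map (λ i → sqX (negX (R i))) (range j k)) ⊛ invUj j))

module Submission where

-- A 132-avoiding permutation is empty or a skew sum (a ⊕ 1) ⊖ b, so it is a binary tree, or a plane forest
-- read along the right spine; the inverse permutation is the mirror image of the forest, and involutions are
-- the mirror-symmetric forests, built from the empty one by s ↦ s ⊕ 1 and s ↦ (a ⊕ 1) ⊖ s ⊖ (a⁻¹ ⊕ 1).
-- With oₖ the number of occurrences of 2134⋯k,
-- oₖ((a ⊕ 1) ⊖ b) = oₖ(a) + oₖ₋₁(a) + oₖ(b) for k ≥ 3, so the avoiders of 2134⋯k are counted by Rₖ.  In the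
-- wrapping step oₖ(a) + oₖ₋₁(a) is counted twice, hence has to vanish when there is exactly one occurrence,
-- and the sign changes by (-1)^(|a|+1).  Writing y = x², the generating functions Sₖ and Dₖ of the involutions
-- with one occurrence, unsigned and signed by parity, satisfy
--   Sₖ = x Sₖ₋₁ + y Rₖ₋₁(y) Sₖ  and  Dₖ = x Dₖ₋₁ - y Rₖ₋₁(-y) Dₖ,  with S₂ = y and D₂ = -y,
-- where for k = 2 only the permutation 21 is kept (one inversion and no 213).
-- The first gives Sₖ = (1 - y) / Uₖ(1/(2x)), and then Eₖ = (Sₖ + Dₖ)/2 satisfies
--   Eₖ = Rₖ(-y) (x Eₖ₋₁ + y Rᵉₖ₋₁(y) Sₖ),
-- which unfolds to the stated sum.

-- For k ≥ 3 the pattern 2134⋯k is not a skew sum, so each occurrence stays inside one block of a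
-- skew sum, and the new maximum of a ⊕ 1 can only play the last letter k. An occurrence of the
-- longer pattern contains one of the shorter, so s ⊕ 1 has exactly one occurrence just when s has
-- one of the shorter pattern and none of the longer. Both conditions are therefore carried along,
-- and this is why 213 is excluded at k = 2: it has one inversion, but 213 ⊕ 1 = 2134 contains 213
-- twice. In a wrapping both outer blocks have m = |a| + 1 letters. Apart from those inside s, the
-- inversions come in equal pairs, except for the m² between the outer blocks; m² has the parity of
-- m, which yields the sign and the argument -y. The factor 1 - y is x² U₂(1/(2x)), introduced by
-- the starting value S₂ = y. A single inversion is odd, so E₂ = 0, in agreement with the empty sum.

open import Defs
open import Data.Nat using (ℕ; _≥_)
open import Relation.Binary.PropositionalEquality using (_≡_)

-- Formal power series over the rationals: ring laws and inverses.

module PowerSeries where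
  open import Data.Nat as ℕ using (ℕ; zero; suc; _∸_)
  open import Data.List using (List; foldr; upTo; applyUpTo; zipWith)
  open import Data.List.Properties using (map-applyUpTo; map-cong)
  open import Data.Rational using (ℚ; 0ℚ; 1ℚ; _+_; _*_; -_; _-_)
  open import Data.Rational.Properties
  open import Data.Rational.Solver using (module +-*-Solver)
  open import Data.Vec using (Vec; []; _∷_; toList; head)
  open import Data.Product using (_,_)
  open import Algebra.Bundles using (CommutativeRing)
  open import Function using (_∘_)
  open import Level using (0ℓ)
  open import Relation.Binary.PropositionalEquality
  open +-*-Solver

  infix 4 _≈_
  _≈_ : Series → Series → Set
  a ≈ b = ∀ n → a n ≡ b n

  ⊝_ : Series → Series
  (⊝ a) n = - a n

  tailS : Series → Series
  tailS a n = a (suc n)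

  -- Turns convolution into a recursion on the coefficient index. The ring laws below are inductions
  -- on that index in which a factor is replaced by its tail.
  ⊛-suc : ∀ a b n → (a ⊛ b) (suc n) ≡ a 0 * b (suc n) + (tailS a ⊛ b) n
  ⊛-suc a b n = cong (λ l → a 0 * b (suc n) + sumℚ l)
    (trans (map-applyUpTo suc (λ i → a i * b (suc n ∸ i)) (suc n))
           (sym (map-applyUpTo (λ i → i) (λ i → tailS a i * b (n ∸ i)) (suc n))))

  ⊛-zero : ∀ a b → (a ⊛ b) 0 ≡ a 0 * b 0
  ⊛-zero a b = +-identityʳ _

  ⊛-cong : ∀ {a a′ b b′} → a ≈ a′ → b ≈ b′ → a ⊛ b ≈ a′ ⊛ b′
  ⊛-cong p q n = cong sumℚ (map-cong (λ i → cong₂ _*_ (p i) (q (n ∸ i))) (upTo (suc n)))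

  ⊛-congˡ : ∀ c {a a′} → a ≈ a′ → c ⊛ a ≈ c ⊛ a′
  ⊛-congˡ c {a} {a′} = ⊛-cong {c} {c} {a} {a′} (λ _ → refl)

  ⊛-congʳ : ∀ {a a′} c → a ≈ a′ → a ⊛ c ≈ a′ ⊛ c
  ⊛-congʳ {a} {a′} c p = ⊛-cong {a} {a′} {c} {c} p (λ _ → refl)

  -- The counterpart of `⊛-suc` at the other end of the convolution; commutativity is the comparison
  -- of the two.
  ⊛-last : ∀ a b n → (a ⊛ b) (suc n) ≡ a (suc n) * b 0 + (a ⊛ tailS b) n
  ⊛-last a b zero = begin
    (a ⊛ b) 1                              ≡⟨ ⊛-suc a b 0 ⟩
    a 0 * b 1 + (tailS a ⊛ b) 0            ≡⟨ cong₂ _+_ (sym (⊛-zero a (tailS b))) (⊛-zero (tailS a) b) ⟩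
    (a ⊛ tailS b) 0 + a 1 * b 0            ≡⟨ +-comm _ (a 1 * b 0) ⟩
    a 1 * b 0 + (a ⊛ tailS b) 0            ∎
    where open ≡-Reasoning
  ⊛-last a b (suc n) = begin
    (a ⊛ b) (suc (suc n))
      ≡⟨ ⊛-suc a b (suc n) ⟩
    a 0 * b (suc (suc n)) + (tailS a ⊛ b) (suc n)
      ≡⟨ cong (a 0 * b (suc (suc n)) +_) (⊛-last (tailS a) b n) ⟩
    a 0 * b (suc (suc n)) + (a (suc (suc n)) * b 0 + (tailS a ⊛ tailS b) n)
      ≡⟨ solve 3 (λ p q r → p :+ (q :+ r) := q :+ (p :+ r)) refl
           (a 0 * b (suc (suc n))) (a (suc (suc n)) * b 0) ((tailS a ⊛ tailS b) n) ⟩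
    a (suc (suc n)) * b 0 + (a 0 * b (suc (suc n)) + (tailS a ⊛ tailS b) n)
      ≡⟨ cong (a (suc (suc n)) * b 0 +_) (sym (⊛-suc a (tailS b) n)) ⟩
    a (suc (suc n)) * b 0 + (a ⊛ tailS b) (suc n) ∎
    where open ≡-Reasoning

  ⊛-comm : ∀ a b → a ⊛ b ≈ b ⊛ a
  ⊛-comm a b zero = trans (⊛-zero a b) (trans (*-comm (a 0) (b 0)) (sym (⊛-zero b a)))
  ⊛-comm a b (suc n) = begin
    (a ⊛ b) (suc n)                    ≡⟨ ⊛-suc a b n ⟩
    a 0 * b (suc n) + (tailS a ⊛ b) n  ≡⟨ cong₂ _+_ (*-comm (a 0) (b (suc n))) (⊛-comm (tailS a) b n) ⟩
    b (suc n) * a 0 + (b ⊛ tailS a) n  ≡⟨ sym (⊛-last b a n) ⟩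
    (b ⊛ a) (suc n)                    ∎
    where open ≡-Reasoning

  ⊛-distribʳ : ∀ c a b → (a ⊕ b) ⊛ c ≈ (a ⊛ c) ⊕ (b ⊛ c)
  ⊛-distribʳ c a b zero = begin
    ((a ⊕ b) ⊛ c) 0            ≡⟨ ⊛-zero (a ⊕ b) c ⟩
    (a 0 + b 0) * c 0          ≡⟨ *-distribʳ-+ (c 0) (a 0) (b 0) ⟩
    a 0 * c 0 + b 0 * c 0      ≡⟨ sym (cong₂ _+_ (⊛-zero a c) (⊛-zero b c)) ⟩
    (a ⊛ c) 0 + (b ⊛ c) 0      ∎
    where open ≡-Reasoning
  ⊛-distribʳ c a b (suc n) = begin
    ((a ⊕ b) ⊛ c) (suc n)
      ≡⟨ ⊛-suc (a ⊕ b) c n ⟩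
    (a 0 + b 0) * c (suc n) + ((tailS a ⊕ tailS b) ⊛ c) n
      ≡⟨ cong ((a 0 + b 0) * c (suc n) +_) (⊛-distribʳ c (tailS a) (tailS b) n) ⟩
    (a 0 + b 0) * c (suc n) + ((tailS a ⊛ c) n + (tailS b ⊛ c) n)
      ≡⟨ solve 5 (λ p q r s t → (p :+ q) :* r :+ (s :+ t) := (p :* r :+ s) :+ (q :* r :+ t)) refl
           (a 0) (b 0) (c (suc n)) ((tailS a ⊛ c) n) ((tailS b ⊛ c) n) ⟩
    (a 0 * c (suc n) + (tailS a ⊛ c) n) + (b 0 * c (suc n) + (tailS b ⊛ c) n)
      ≡⟨ sym (cong₂ _+_ (⊛-suc a c n) (⊛-suc b c n)) ⟩
    (a ⊛ c) (suc n) + (b ⊛ c) (suc n) ∎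
    where open ≡-Reasoning

  ⊛-scaleˡ : ∀ q a b → scale q a ⊛ b ≈ scale q (a ⊛ b)
  ⊛-scaleˡ q a b zero = trans (⊛-zero (scale q a) b) (trans (*-assoc q (a 0) (b 0)) (cong (q *_) (sym (⊛-zero a b))))
  ⊛-scaleˡ q a b (suc n) = begin
    (scale q a ⊛ b) (suc n)                              ≡⟨ ⊛-suc (scale q a) b n ⟩
    (q * a 0) * b (suc n) + (scale q (tailS a) ⊛ b) n    ≡⟨ cong ((q * a 0) * b (suc n) +_) (⊛-scaleˡ q (tailS a) b n) ⟩
    (q * a 0) * b (suc n) + q * (tailS a ⊛ b) n          ≡⟨ solve 4 (λ p r s t → (p :* r) :* s :+ p :* t := p :* (r :* s :+ t)) refl
                                                              q (a 0) (b (suc n)) ((tailS a ⊛ b) n) ⟩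
    q * (a 0 * b (suc n) + (tailS a ⊛ b) n)              ≡⟨ cong (q *_) (sym (⊛-suc a b n)) ⟩
    q * (a ⊛ b) (suc n)                                  ∎
    where open ≡-Reasoning

  tailS-⊛ : ∀ a b → tailS (a ⊛ b) ≈ scale (a 0) (tailS b) ⊕ (tailS a ⊛ b)
  tailS-⊛ = ⊛-suc

  ⊛-assoc : ∀ a b c → (a ⊛ b) ⊛ c ≈ a ⊛ (b ⊛ c)
  ⊛-assoc a b c zero = begin
    ((a ⊛ b) ⊛ c) 0     ≡⟨ ⊛-zero (a ⊛ b) c ⟩
    (a ⊛ b) 0 * c 0     ≡⟨ cong (_* c 0) (⊛-zero a b) ⟩
    a 0 * b 0 * c 0     ≡⟨ *-assoc (a 0) (b 0) (c 0) ⟩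
    a 0 * (b 0 * c 0)   ≡⟨ cong (a 0 *_) (sym (⊛-zero b c)) ⟩
    a 0 * (b ⊛ c) 0     ≡⟨ sym (⊛-zero a (b ⊛ c)) ⟩
    (a ⊛ (b ⊛ c)) 0     ∎
    where open ≡-Reasoning
  ⊛-assoc a b c (suc n) = begin
    ((a ⊛ b) ⊛ c) (suc n)
      ≡⟨ ⊛-suc (a ⊛ b) c n ⟩
    (a ⊛ b) 0 * c (suc n) + (tailS (a ⊛ b) ⊛ c) n
      ≡⟨ cong₂ _+_ (cong (_* c (suc n)) (⊛-zero a b)) (⊛-congʳ c (tailS-⊛ a b) n) ⟩
    a 0 * b 0 * c (suc n) + ((scale (a 0) (tailS b) ⊕ (tailS a ⊛ b)) ⊛ c) n
      ≡⟨ cong (a 0 * b 0 * c (suc n) +_) (⊛-distribʳ c (scale (a 0) (tailS b)) (tailS a ⊛ b) n) ⟩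
    a 0 * b 0 * c (suc n) + ((scale (a 0) (tailS b) ⊛ c) n + ((tailS a ⊛ b) ⊛ c) n)
      ≡⟨ cong₂ (λ u v → a 0 * b 0 * c (suc n) + (u + v)) (⊛-scaleˡ (a 0) (tailS b) c n) (⊛-assoc (tailS a) b c n) ⟩
    a 0 * b 0 * c (suc n) + (a 0 * (tailS b ⊛ c) n + (tailS a ⊛ (b ⊛ c)) n)
      ≡⟨ solve 5 (λ p q r s t → p :* q :* r :+ (p :* s :+ t) := p :* (q :* r :+ s) :+ t) refl
           (a 0) (b 0) (c (suc n)) ((tailS b ⊛ c) n) ((tailS a ⊛ (b ⊛ c)) n) ⟩
    a 0 * (b 0 * c (suc n) + (tailS b ⊛ c) n) + (tailS a ⊛ (b ⊛ c)) n
      ≡⟨ cong (λ u → a 0 * u + (tailS a ⊛ (b ⊛ c)) n) (sym (⊛-suc b c n)) ⟩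
    a 0 * (b ⊛ c) (suc n) + (tailS a ⊛ (b ⊛ c)) n
      ≡⟨ sym (⊛-suc a (b ⊛ c) n) ⟩
    (a ⊛ (b ⊛ c)) (suc n) ∎
    where open ≡-Reasoning

  ⊛-zeroˡ : ∀ a → zeroS ⊛ a ≈ zeroS
  ⊛-zeroˡ a zero = trans (⊛-zero zeroS a) (*-zeroˡ (a 0))
  ⊛-zeroˡ a (suc n) = trans (⊛-suc zeroS a n) (cong₂ _+_ (*-zeroˡ (a (suc n))) (⊛-zeroˡ a n))

  ⊛-identityˡ : ∀ a → oneS ⊛ a ≈ a
  ⊛-identityˡ a zero = trans (⊛-zero oneS a) (*-identityˡ (a 0))
  ⊛-identityˡ a (suc n) = begin
    (oneS ⊛ a) (suc n)                ≡⟨ ⊛-suc oneS a n ⟩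
    1ℚ * a (suc n) + (zeroS ⊛ a) n    ≡⟨ cong₂ _+_ (*-identityˡ (a (suc n))) (⊛-zeroˡ a n) ⟩
    a (suc n) + 0ℚ                    ≡⟨ +-identityʳ _ ⟩
    a (suc n)                         ∎
    where open ≡-Reasoning

  seriesRing : CommutativeRing 0ℓ 0ℓ
  seriesRing = record
    { Carrier = Series ; _≈_ = _≈_ ; _+_ = _⊕_ ; _*_ = _⊛_ ; -_ = ⊝_ ; 0# = zeroS ; 1# = oneS
    ; isCommutativeRing = record
      { isRing = record
        { +-isAbelianGroup = record
          { isGroup = record
            { isMonoid = record
              { isSemigroup = record
                { isMagma = record
                  { isEquivalence = record
                    { refl = λ _ → refl ; sym = λ p n → sym (p n) ; trans = λ p q n → trans (p n) (q n) }
                  ; ∙-cong = λ p q n → cong₂ _+_ (p n) (q n) }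
                ; assoc = λ a b c n → +-assoc (a n) (b n) (c n) }
              ; identity = (λ a n → +-identityˡ (a n)) , (λ a n → +-identityʳ (a n)) }
            ; inverse = (λ a n → +-inverseˡ (a n)) , (λ a n → +-inverseʳ (a n))
            ; ⁻¹-cong = λ p n → cong -_ (p n) }
          ; comm = λ a b n → +-comm (a n) (b n) }
        ; *-cong = λ {a} {a′} {b} {b′} → ⊛-cong {a} {a′} {b} {b′}
        ; *-assoc = ⊛-assoc
        ; *-identity = ⊛-identityˡ , (λ a n → trans (⊛-comm a oneS n) (⊛-identityˡ a n))
        ; distrib = (λ a b c n → trans (⊛-comm a (b ⊕ c) n)
                        (trans (⊛-distribʳ a b c n) (cong₂ _+_ (⊛-comm b a n) (⊛-comm c a n))))
                    , ⊛-distribʳ }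
      ; *-comm = ⊛-comm } }

  open CommutativeRing seriesRing public using (setoid)
    renaming (refl to ≈-refl; sym to ≈-sym; trans to ≈-trans; +-cong to ⊕-cong)

  X⊛-suc : ∀ a n → (X ⊛ a) (suc n) ≡ a n
  X⊛-suc a n = begin
    (X ⊛ a) (suc n)                   ≡⟨ ⊛-suc X a n ⟩
    0ℚ * a (suc n) + (tailS X ⊛ a) n  ≡⟨ cong₂ _+_ (*-zeroˡ (a (suc n)))
                                           (⊛-congʳ {tailS X} {oneS} a (λ { zero → refl ; (suc _) → refl }) n) ⟩
    0ℚ + (oneS ⊛ a) n                 ≡⟨ trans (+-identityˡ _) (⊛-identityˡ a n) ⟩
    a n                               ∎
    where open ≡-Reasoning

  X⊛-zero : ∀ a → (X ⊛ a) 0 ≡ 0ℚ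
  X⊛-zero a = trans (⊛-zero X a) (*-zeroˡ (a 0))

  shift-suc : ∀ m a → shift (suc m) a ≈ X ⊛ shift m a
  shift-suc m a zero    = sym (X⊛-zero (shift m a))
  shift-suc m a (suc n) = sym (X⊛-suc (shift m a) n)

  shift-⊛ : ∀ m a b → shift m a ⊛ b ≈ shift m (a ⊛ b)
  shift-⊛ zero    a b = λ _ → refl
  shift-⊛ (suc m) a b n = begin
    (shift (suc m) a ⊛ b) n    ≡⟨ ⊛-congʳ {shift (suc m) a} {X ⊛ shift m a} b (shift-suc m a) n ⟩
    ((X ⊛ shift m a) ⊛ b) n    ≡⟨ ⊛-assoc X (shift m a) b n ⟩
    (X ⊛ (shift m a ⊛ b)) n    ≡⟨ ⊛-congˡ X {shift m a ⊛ b} {shift m (a ⊛ b)} (shift-⊛ m a b) n ⟩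
    (X ⊛ shift m (a ⊛ b)) n    ≡⟨ sym (shift-suc m (a ⊛ b) n) ⟩
    shift (suc m) (a ⊛ b) n    ∎
    where open ≡-Reasoning

  -- A nameable copy of the table local to `inv1`, listing the coefficients from the highest index
  -- down.
  inverseTable : Series → ∀ n → Vec ℚ (suc n)
  inverseTable a zero    = 1ℚ ∷ []
  inverseTable a (suc n) =
    (- sumℚ (zipWith (λ t b → a (suc t) * b) (upTo (suc n)) (toList (inverseTable a n)))) ∷ inverseTable a n

  IsInverseTable : Series → (∀ n → Vec ℚ (suc n)) → Set
  IsInverseTable a g = ∀ n → g (suc n) ≡
    (- sumℚ (zipWith (λ t b → a (suc t) * b) (upTo (suc n)) (toList (g n)))) ∷ g n

  inverseTable-unique : ∀ a g → g 0 ≡ 1ℚ ∷ [] → IsInverseTable a g → ∀ n → g n ≡ inverseTable a n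
  inverseTable-unique a g g₀ step zero = g₀
  inverseTable-unique a g g₀ step (suc n) rewrite step n | inverseTable-unique a g g₀ step n = refl

  -- Both sides have the shape of a coefficient unfolded twice. Summation and zipping are the
  -- parameters `σ` and `ζ`, so that the statement matches the goal of `inv1≗inverseTable` once
  -- these functions are abstracted there.
  inverseTable-two-steps : ∀ a (g : ℕ → ∀ n → Vec ℚ (suc n)) → (∀ N → g N 0 ≡ 1ℚ ∷ []) → (∀ N → IsInverseTable a (g N)) →
    ∀ (σ : List ℚ → ℚ) (ζ : List ℕ → List ℚ → List ℚ) N n →
    - (a 1 * (- σ (ζ (upTo (suc n)) (toList (g N n)))) + σ (ζ (applyUpTo suc (suc n)) (toList (g N n))))
    ≡ - (a 1 * (- σ (ζ (upTo (suc n)) (toList (inverseTable a n)))) + σ (ζ (applyUpTo suc (suc n)) (toList (inverseTable a n))))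
  inverseTable-two-steps a g g₀ step σ ζ N n rewrite inverseTable-unique a (g N) (g₀ N) (step N) n = refl

  -- The table local to inv1 takes the index of inv1 as a hidden extra argument and cannot be named here.
  -- Abstracting that index (visible after two unfoldings) and the non-injective functions around
  -- the table lets unification recover it as the value of inv1Table.
  mutual
    inv1Table : Series → ℕ → ∀ n → Vec ℚ (suc n)
    inv1Table = _

    inv1≗inverseTable : ∀ a n → inv1 a n ≡ head (inverseTable a n)
    inv1≗inverseTable a zero = refl
    inv1≗inverseTable a (suc zero) = refl
    inv1≗inverseTable a (suc (suc n)) with suc (suc n) | foldr _+_ 0ℚ | zipWith (λ t b → a (suc t) * b)
    ... | N | σ | ζ = inverseTable-two-steps a (inv1Table a) (λ _ → refl) (λ _ _ → refl) σ ζ N n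

  inverseTable-suc : ∀ a n → head (inverseTable a (suc n)) ≡ - (tailS a ⊛ (λ m → head (inverseTable a m))) n
  inverseTable-suc a n = cong -_ (trans (row (λ i → i) n) (cong sumℚ (sym (map-applyUpTo (λ i → i) (λ i → a (suc i) * head (inverseTable a (n ∸ i))) (suc n)))))
    where
    -- `s` is general because the tail of `applyUpTo s` is an `applyUpTo (s ∘ suc)`.
    row : ∀ (s : ℕ → ℕ) n →
          sumℚ (zipWith (λ t b → a (suc t) * b) (applyUpTo s (suc n)) (toList (inverseTable a n)))
          ≡ sumℚ (applyUpTo (λ i → a (suc (s i)) * head (inverseTable a (n ∸ i))) (suc n))
    row s zero    = refl
    row s (suc n) = cong (a (suc (s 0)) * head (inverseTable a (suc n)) +_) (row (s ∘ suc) n)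

  inv1-suc : ∀ a n → inv1 a (suc n) ≡ - (tailS a ⊛ inv1 a) n
  inv1-suc a n = trans (inv1≗inverseTable a (suc n)) (trans (inverseTable-suc a n)
    (cong -_ (⊛-congˡ (tailS a) {λ m → head (inverseTable a m)} {inv1 a} (λ m → sym (inv1≗inverseTable a m)) n)))

  inv1-inverse : ∀ a → a 0 ≡ 1ℚ → a ⊛ inv1 a ≈ oneS
  inv1-inverse a a₀≡1 zero = trans (⊛-zero a (inv1 a)) (cong (_* 1ℚ) a₀≡1)
  inv1-inverse a a₀≡1 (suc n) = begin
    (a ⊛ inv1 a) (suc n)                              ≡⟨ ⊛-suc a (inv1 a) n ⟩
    a 0 * inv1 a (suc n) + (tailS a ⊛ inv1 a) n       ≡⟨ cong₂ (λ u v → u * v + (tailS a ⊛ inv1 a) n) a₀≡1 (inv1-suc a n) ⟩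
    1ℚ * (- (tailS a ⊛ inv1 a) n) + (tailS a ⊛ inv1 a) n ≡⟨ solve 1 (λ p → con 1ℚ :* (:- p) :+ p := con 0ℚ) refl ((tailS a ⊛ inv1 a) n) ⟩
    0ℚ                                                ∎
    where open ≡-Reasoning

-- Three identities in an arbitrary commutative ring.

module RingIdentities where
  open import Algebra.Bundles using (CommutativeRing)

  module _ {c ℓ} (𝓡 : CommutativeRing c ℓ) where
    open CommutativeRing 𝓡
    open import Algebra.Solver.Ring.NaturalCoefficients.Default commutativeSemiring
    open import Algebra.Properties.Group +-group using () renaming (∙-cancelʳ to +-cancelʳ)
    open import Relation.Binary.Reasoning.Setoid setoid

    -- In the applications `p`, `q`, `r` are consecutive normalised Chebyshev polynomials and A =
    -- p/q. Multiplying B (1 - yA) = u by `q` turns q (1 - yA) into `r`. With u = 1 this is the step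
    -- for `R⁺`, with u = x S the step for the series S.
    continuant-step : ∀ {y A B u p q r} → r + y * p ≈ q → A * q ≈ p → B ≈ u + y * A * B → B * r ≈ u * q
    continuant-step {y} {A} {B} {u} {p} {q} {r} r+yp≈q Aq≈p B≈ = +-cancelʳ (y * A * B * q) _ _ (begin
      B * r + y * A * B * q      ≈⟨ solve 5 (λ y A B q r → B :* r :+ y :* A :* B :* q := B :* (r :+ y :* (A :* q))) refl y A B q r ⟩
      B * (r + y * (A * q))      ≈⟨ *-congˡ (trans (+-congˡ (*-congˡ Aq≈p)) r+yp≈q) ⟩
      B * q                      ≈⟨ *-congʳ B≈ ⟩
      (u + y * A * B) * q        ≈⟨ distribʳ q u (y * A * B) ⟩
      u * q + y * A * B * q      ∎)

    -- `B` inverts 1 + y A⁻, the factor that multiplies `d′`. Inserting B (1 + y A⁻) = 1 leaves `s′`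
    -- multiplied by A⁺ + A⁻, half of which is the even part of R.
    half-sum-step : ∀ {h x y A⁺ A⁻ B s d s′ d′} →
      B + y * A⁻ * B ≈ 1# → s′ ≈ x * s + y * A⁺ * s′ → d′ + y * A⁻ * d′ ≈ x * d →
      h * (s′ + d′) ≈ B * (x * (h * (s + d)) + y * (h * (A⁺ + A⁻)) * s′)
    half-sum-step {h} {x} {y} {A⁺} {A⁻} {B} {s} {d} {s′} {d′} inverse s-step d-step = begin
      h * (s′ + d′)
        ≈⟨ sym (*-identityʳ _) ⟩
      h * (s′ + d′) * 1#
        ≈⟨ *-congˡ (sym inverse) ⟩
      h * (s′ + d′) * (B + y * A⁻ * B)
        ≈⟨ solve 6 (λ h s d B y A → h :* (s :+ d) :* (B :+ y :* A :* B) := B :* (h :* (s :+ y :* A :* s :+ (d :+ y :* A :* d)))) refl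
             h s′ d′ B y A⁻ ⟩
      B * (h * (s′ + y * A⁻ * s′ + (d′ + y * A⁻ * d′)))
        ≈⟨ *-congˡ (*-congˡ (+-cong (+-congʳ s-step) d-step)) ⟩
      B * (h * (x * s + y * A⁺ * s′ + y * A⁻ * s′ + x * d))
        ≈⟨ solve 9 (λ h x y P M B s d t → B :* (h :* (x :* s :+ y :* P :* t :+ y :* M :* t :+ x :* d))
                      := B :* (x :* (h :* (s :+ d)) :+ y :* (h :* (P :+ M)) :* t)) refl
             h x y A⁺ A⁻ B s d s′ ⟩
      B * (x * (h * (s + d)) + y * (h * (A⁺ + A⁻)) * s′) ∎

    divide-right : ∀ {a b p q} → p * q ≈ 1# → a * p ≈ b → a ≈ b * q
    divide-right {a} {b} {p} {q} pq≈1 ap≈b = begin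
      a              ≈⟨ sym (*-identityʳ a) ⟩
      a * 1#         ≈⟨ *-congˡ (sym pq≈1) ⟩
      a * (p * q)    ≈⟨ sym (*-assoc a p q) ⟩
      a * p * q      ≈⟨ *-congʳ ap≈b ⟩
      b * q          ∎

-- Parity of natural numbers and the sign (-1)^n.

module Parity where
  open import Algebra.Properties.Group using (⁻¹-involutive)
  open import Data.Bool using (not)
  open import Data.Bool.Properties using (not-involutive)
  open import Data.Nat as ℕ using (ℕ; zero; suc)
  open import Data.Rational using (ℚ; 1ℚ; _*_; -_)
  open import Data.Rational.Properties
  open import Relation.Binary.PropositionalEquality

  isEven-suc : ∀ n → isEven (suc n) ≡ not (isEven n)
  isEven-suc zero = refl
  isEven-suc (suc n) = sym (trans (cong not (isEven-suc n)) (not-involutive (isEven n)))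

  sgn : ℕ → ℚ
  sgn zero = 1ℚ
  sgn (suc n) = - sgn n

  sgn-+ : ∀ m n → sgn (m ℕ.+ n) ≡ sgn m * sgn n
  sgn-+ zero n = sym (*-identityˡ (sgn n))
  sgn-+ (suc m) n = trans (cong -_ (sgn-+ m n)) (neg-distribˡ-* (sgn m) (sgn n))

  sgn-square : ∀ n → sgn n * sgn n ≡ 1ℚ
  sgn-square zero = refl
  sgn-square (suc n) = trans (sym (neg-distribˡ-* (sgn n) (- sgn n)))
    (trans (cong -_ (sym (neg-distribʳ-* (sgn n) (sgn n)))) (trans (⁻¹-involutive +-0-group _) (sgn-square n)))

-- The substitutions x ↦ -x and x ↦ x², the series `R`, and the Chebyshev polynomials.

module ChebyshevSeries where
  open PowerSeries
  open Parity
  open import Algebra.Bundles using (CommutativeRing)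
  open CommutativeRing seriesRing using (ring)
  open import Algebra.Properties.Group using (⁻¹-involutive)
  open import Algebra.Properties.Ring ring using (-‿distribˡ-*)
  open import Data.Bool using (true; false; if_then_else_; T)
  open import Data.Empty using (⊥-elim)
  open import Data.Product using (_,_)
  open import Relation.Binary.Definitions using (Tri; tri<; tri≈; tri>)
  open import Data.Nat as ℕ using (ℕ; zero; suc)
  import Data.Nat.Properties as ℕ
  open import Data.Nat.DivMod using (+-distrib-/-∣ˡ)
  open import Data.Nat.Divisibility using (∣-refl)
  open import Data.Rational using (0ℚ; 1ℚ; ½; _+_; _*_; -_; _-_)
  open import Data.Rational.Properties
  open import Data.Rational.Solver using (module +-*-Solver)
  open +-*-Solver
  open import Relation.Binary.PropositionalEquality

  negX-suc : ∀ a n → negX a (suc n) ≡ - negX (tailS a) n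
  negX-suc a n rewrite isEven-suc n with isEven n
  ... | true  = refl
  ... | false = sym (⁻¹-involutive +-0-group (a (suc n)))

  negX-sgn : ∀ a n → negX a n ≡ sgn n * a n
  negX-sgn a zero = sym (*-identityˡ (a 0))
  negX-sgn a (suc n) = trans (negX-suc a n) (trans (cong -_ (negX-sgn (tailS a) n)) (neg-distribˡ-* (sgn n) (a (suc n))))

  negX-cong : ∀ {a b} → a ≈ b → negX a ≈ negX b
  negX-cong p n with isEven n
  ... | true  = p n
  ... | false = cong -_ (p n)

  negX-⊛ : ∀ a b → negX (a ⊛ b) ≈ negX a ⊛ negX b
  negX-⊛ a b zero = trans (⊛-zero a b) (sym (⊛-zero (negX a) (negX b)))
  negX-⊛ a b (suc n) = begin
    negX (a ⊛ b) (suc n)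
      ≡⟨ negX-sgn (a ⊛ b) (suc n) ⟩
    (- sgn n) * (a ⊛ b) (suc n)
      ≡⟨ cong ((- sgn n) *_) (⊛-suc a b n) ⟩
    (- sgn n) * (a 0 * b (suc n) + (tailS a ⊛ b) n)
      ≡⟨ solve 4 (λ s p q r → (:- s) :* (p :* q :+ r) := p :* ((:- s) :* q) :+ (:- (s :* r))) refl
           (sgn n) (a 0) (b (suc n)) ((tailS a ⊛ b) n) ⟩
    a 0 * ((- sgn n) * b (suc n)) + (- (sgn n * (tailS a ⊛ b) n))
      ≡⟨ cong₂ (λ u v → a 0 * u + v) (sym (negX-sgn b (suc n)))
           (cong -_ (trans (sym (negX-sgn (tailS a ⊛ b) n)) (negX-⊛ (tailS a) b n))) ⟩
    a 0 * negX b (suc n) + (- (negX (tailS a) ⊛ negX b) n)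
      ≡⟨ cong (a 0 * negX b (suc n) +_) (-‿distribˡ-* (negX (tailS a)) (negX b) n) ⟩
    a 0 * negX b (suc n) + ((⊝ negX (tailS a)) ⊛ negX b) n
      ≡⟨ cong (a 0 * negX b (suc n) +_) (⊛-congʳ {⊝ negX (tailS a)} {tailS (negX a)} (negX b) (λ m → sym (negX-suc a m)) n) ⟩
    a 0 * negX b (suc n) + (tailS (negX a) ⊛ negX b) n
      ≡⟨ sym (⊛-suc (negX a) (negX b) n) ⟩
    (negX a ⊛ negX b) (suc n) ∎
    where open ≡-Reasoning

  sqX-suc² : ∀ a n → sqX a (suc (suc n)) ≡ sqX (tailS a) n
  sqX-suc² a n rewrite +-distrib-/-∣ˡ {2} n {2} ∣-refl = refl

  sqX-cong : ∀ {a b} → a ≈ b → sqX a ≈ sqX b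
  sqX-cong p n with isEven n
  ... | true  = p (n ℕ./ 2)
  ... | false = refl

  sqX-⊕ : ∀ a b → sqX (a ⊕ b) ≈ sqX a ⊕ sqX b
  sqX-⊕ a b n with isEven n
  ... | true  = refl
  ... | false = refl

  sqX-scale : ∀ q a → sqX (scale q a) ≈ scale q (sqX a)
  sqX-scale q a n with isEven n
  ... | true  = refl
  ... | false = sym (*-zeroʳ q)

  sqX-one : sqX oneS ≈ oneS
  sqX-one zero = refl
  sqX-one (suc zero) = refl
  sqX-one (suc (suc n)) = trans (sqX-suc² oneS n) (if-eta (isEven n))
    where
    if-eta : ∀ c → (if c then 0ℚ else 0ℚ) ≡ 0ℚ
    if-eta true = refl
    if-eta false = refl

  -- Induction in steps of two: shifting `sqX a` by two indices shifts `a` by one, and the odd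
  -- coefficients vanish.
  sqX-⊛ : ∀ a b → sqX (a ⊛ b) ≈ sqX a ⊛ sqX b
  sqX-⊛ a b zero = trans (⊛-zero a b) (sym (⊛-zero (sqX a) (sqX b)))
  sqX-⊛ a b (suc zero) = sym (begin
    (sqX a ⊛ sqX b) 1                          ≡⟨ ⊛-suc (sqX a) (sqX b) 0 ⟩
    a 0 * 0ℚ + (tailS (sqX a) ⊛ sqX b) 0       ≡⟨ cong₂ _+_ (*-zeroʳ (a 0)) (trans (⊛-zero (tailS (sqX a)) (sqX b)) (*-zeroˡ (b 0))) ⟩
    0ℚ                                         ∎)
    where open ≡-Reasoning
  sqX-⊛ a b (suc (suc n)) = begin
    sqX (a ⊛ b) (suc (suc n))
      ≡⟨ sqX-suc² (a ⊛ b) n ⟩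
    sqX (tailS (a ⊛ b)) n
      ≡⟨ sqX-cong {tailS (a ⊛ b)} {scale (a 0) (tailS b) ⊕ (tailS a ⊛ b)} (tailS-⊛ a b) n ⟩
    sqX (scale (a 0) (tailS b) ⊕ (tailS a ⊛ b)) n
      ≡⟨ sqX-⊕ (scale (a 0) (tailS b)) (tailS a ⊛ b) n ⟩
    sqX (scale (a 0) (tailS b)) n + sqX (tailS a ⊛ b) n
      ≡⟨ cong₂ _+_ (trans (sqX-scale (a 0) (tailS b) n) (cong (a 0 *_) (sym (sqX-suc² b n)))) (sqX-⊛ (tailS a) b n) ⟩
    a 0 * sqX b (suc (suc n)) + (sqX (tailS a) ⊛ sqX b) n
      ≡⟨ cong (a 0 * sqX b (suc (suc n)) +_) (trans (⊛-congʳ {sqX (tailS a)} {tailS (tailS (sqX a))} (sqX b) (λ m → sym (sqX-suc² a m)) n)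
           (sym (trans (⊛-suc (tailS (sqX a)) (sqX b) n) (trans (cong (_+ (tailS (tailS (sqX a)) ⊛ sqX b) n) (*-zeroˡ (sqX b (suc n)))) (+-identityˡ _))))) ⟩
    a 0 * sqX b (suc (suc n)) + (tailS (sqX a) ⊛ sqX b) (suc n)
      ≡⟨ sym (⊛-suc (sqX a) (sqX b) (suc n)) ⟩
    (sqX a ⊛ sqX b) (suc (suc n)) ∎
    where open ≡-Reasoning

  sqX-X : sqX X ≈ X ⊛ X
  sqX-X zero = refl
  sqX-X (suc zero) = sym (X⊛-suc X 0)
  sqX-X (suc (suc n)) = trans (sqX-suc² X n) (trans (sqX-cong {tailS X} {oneS} (λ { zero → refl ; (suc _) → refl }) n)
    (trans (sqX-one n) (trans (lemma n) (sym (X⊛-suc X (suc n))))))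
    where
    lemma : ∀ n → oneS n ≡ X (suc n)
    lemma zero = refl
    lemma (suc n) = refl

  y : Series
  y = X ⊛ X

  -- The defining inverse multiplied out. Free of subtraction, the identity can be sent through
  -- `sqX` and `negX`, and it has the form of the recurrences that come from counting.
  R-suc : ∀ k → R (suc (suc k)) ≈ oneS ⊕ ((X ⊛ R (suc k)) ⊛ R (suc (suc k)))
  R-suc k n = begin
    B n                                   ≡⟨ sym (⊛-identityˡ B n) ⟩
    (oneS ⊛ B) n                          ≡⟨ ⊛-congʳ {oneS} {(oneS ⊖ xA) ⊕ xA} B (λ m → solve 2 (λ p q → p := (p :- q) :+ q) refl (oneS m) (xA m)) n ⟩
    (((oneS ⊖ xA) ⊕ xA) ⊛ B) n            ≡⟨ ⊛-distribʳ B (oneS ⊖ xA) xA n ⟩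
    ((oneS ⊖ xA) ⊛ B) n + (xA ⊛ B) n      ≡⟨ cong (_+ (xA ⊛ B) n) (inv1-inverse (oneS ⊖ xA) (cong (λ u → 1ℚ - u) (X⊛-zero (R (suc k)))) n) ⟩
    oneS n + (xA ⊛ B) n                   ∎
    where
    open ≡-Reasoning
    B xA : Series
    B  = R (suc (suc k))
    xA = X ⊛ R (suc k)

  R⁺ R⁻ : ℕ → Series
  R⁺ k = sqX (R k)
  R⁻ k = sqX (negX (R k))

  sqX-X⊛ : ∀ a b → sqX ((X ⊛ a) ⊛ b) ≈ (y ⊛ sqX a) ⊛ sqX b
  sqX-X⊛ a b n = trans (sqX-⊛ (X ⊛ a) b n) (⊛-congʳ {sqX (X ⊛ a)} {y ⊛ sqX a} (sqX b)
    (λ m → trans (sqX-⊛ X a m) (⊛-congʳ {sqX X} {y} (sqX a) sqX-X m)) n)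

  R⁺-suc : ∀ k → R⁺ (suc (suc k)) ≈ oneS ⊕ ((y ⊛ R⁺ (suc k)) ⊛ R⁺ (suc (suc k)))
  R⁺-suc k n = begin
    sqX B n                                 ≡⟨ sqX-cong {B} {oneS ⊕ ((X ⊛ A) ⊛ B)} (R-suc k) n ⟩
    sqX (oneS ⊕ ((X ⊛ A) ⊛ B)) n            ≡⟨ sqX-⊕ oneS ((X ⊛ A) ⊛ B) n ⟩
    sqX oneS n + sqX ((X ⊛ A) ⊛ B) n        ≡⟨ cong₂ _+_ (sqX-one n) (sqX-X⊛ A B n) ⟩
    oneS n + ((y ⊛ sqX A) ⊛ sqX B) n        ∎
    where
    open ≡-Reasoning
    A B : Series
    A = R (suc k)
    B = R (suc (suc k))

  negX-X⊛ : ∀ a → negX (X ⊛ a) ≈ ⊝ (X ⊛ negX a)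
  negX-X⊛ a n = begin
    negX (X ⊛ a) n        ≡⟨ negX-⊛ X a n ⟩
    (negX X ⊛ negX a) n   ≡⟨ ⊛-congʳ {negX X} {⊝ X} (negX a) negX-X n ⟩
    ((⊝ X) ⊛ negX a) n    ≡⟨ sym (-‿distribˡ-* X (negX a) n) ⟩
    (⊝ (X ⊛ negX a)) n    ∎
    where
    open ≡-Reasoning
    negX-X : negX X ≈ ⊝ X
    negX-X zero = refl
    negX-X (suc zero) = refl
    negX-X (suc (suc n)) with isEven n
    ... | true  = refl
    ... | false = refl

  -- Replacing x by -y in 1 - x R turns it into 1 + y R(-y), which is what `R⁻ (suc (suc k))`
  -- inverts.
  R⁻-inverse : ∀ k → R⁻ (suc (suc k)) ⊕ ((y ⊛ R⁻ (suc k)) ⊛ R⁻ (suc (suc k))) ≈ oneS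
  R⁻-inverse k n = begin
    sqX (negX B) n + ((y ⊛ sqX (negX A)) ⊛ sqX (negX B)) n
      ≡⟨ cong (sqX (negX B) n +_) (sym (sqX-X⊛ (negX A) (negX B) n)) ⟩
    sqX (negX B) n + sqX ((X ⊛ negX A) ⊛ negX B) n
      ≡⟨ sym (sqX-⊕ (negX B) ((X ⊛ negX A) ⊛ negX B) n) ⟩
    sqX (negX B ⊕ ((X ⊛ negX A) ⊛ negX B)) n
      ≡⟨ sqX-cong {negX B ⊕ ((X ⊛ negX A) ⊛ negX B)} {oneS} negated n ⟩
    sqX oneS n
      ≡⟨ sqX-one n ⟩
    oneS n ∎
    where
    open ≡-Reasoning
    A B : Series
    A = R (suc k)
    B = R (suc (suc k))
    negX-⊕ : ∀ a b → negX (a ⊕ b) ≈ negX a ⊕ negX b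
    negX-⊕ a b n with isEven n
    ... | true  = refl
    ... | false = neg-distrib-+ (a n) (b n)
    negX-one : negX oneS ≈ oneS
    negX-one zero = refl
    negX-one (suc n) with isEven (suc n)
    ... | true  = refl
    ... | false = refl
    negX-B : ∀ n → negX B n ≡ oneS n - ((X ⊛ negX A) ⊛ negX B) n
    negX-B n = begin
      negX B n
        ≡⟨ negX-cong {B} {oneS ⊕ ((X ⊛ A) ⊛ B)} (R-suc k) n ⟩
      negX (oneS ⊕ ((X ⊛ A) ⊛ B)) n
        ≡⟨ negX-⊕ oneS ((X ⊛ A) ⊛ B) n ⟩
      negX oneS n + negX ((X ⊛ A) ⊛ B) n
        ≡⟨ cong₂ _+_ (negX-one n) (negX-⊛ (X ⊛ A) B n) ⟩
      oneS n + (negX (X ⊛ A) ⊛ negX B) n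
        ≡⟨ cong (oneS n +_) (⊛-congʳ {negX (X ⊛ A)} {⊝ (X ⊛ negX A)} (negX B) (negX-X⊛ A) n) ⟩
      oneS n + ((⊝ (X ⊛ negX A)) ⊛ negX B) n
        ≡⟨ cong (oneS n +_) (sym (-‿distribˡ-* (X ⊛ negX A) (negX B) n)) ⟩
      oneS n - ((X ⊛ negX A) ⊛ negX B) n ∎
    negated : negX B ⊕ ((X ⊛ negX A) ⊛ negX B) ≈ oneS
    negated n = trans (cong (_+ ((X ⊛ negX A) ⊛ negX B) n) (negX-B n))
      (solve 2 (λ p q → (p :- q) :+ q := p) refl (oneS n) (((X ⊛ negX A) ⊛ negX B) n))

  U-degree : ∀ r m → r ℕ.< m → U r m ≡ 0ℚ
  U-degree zero (suc m) _ = refl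
  U-degree (suc zero) (suc zero) (ℕ.s≤s ())
  U-degree (suc zero) (suc (suc m)) _ = refl
  U-degree (suc (suc r)) (suc m) (ℕ.s≤s r<m) = begin
    ℕtoℚ 2 * (X ⊛ U (suc r)) (suc m) - U r (suc m)  ≡⟨ cong₂ (λ u v → ℕtoℚ 2 * u - v) (trans (X⊛-suc (U (suc r)) m) (U-degree (suc r) m r<m))
                                                         (U-degree r (suc m) (ℕ.m≤n⇒m≤1+n (ℕ.<⇒≤ r<m))) ⟩
    0ℚ ∎
    where open ≡-Reasoning

  -- Indexing by the exponent `m` of t, with m + d = j, removes the truncated subtraction from
  -- `homU`.
  homU-coefficient : ∀ j m d → m ℕ.+ d ≡ j → homU j d ≡ U j m * (½ ^ℚ m)
  homU-coefficient j m d refl with m ℕ.+ d ℕ.<ᵇ d in eq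
  ... | true  = ⊥-elim (ℕ.<⇒≱ (ℕ.<ᵇ⇒< (m ℕ.+ d) d (subst T (sym eq) _)) (ℕ.m≤n+m d m))
  ... | false rewrite ℕ.m+n∸n≡m m d = refl

  homU-degree : ∀ j d → j ℕ.< d → homU j d ≡ 0ℚ
  homU-degree j d j<d with j ℕ.<ᵇ d in eq
  ... | true  = refl
  ... | false = ⊥-elim (subst T eq (ℕ.<⇒<ᵇ j<d))

  -- The recurrence U_{j+2} = 2t U_{j+1} - U_j at t = 1/(2x), multiplied by x^{j+2}; the factor 2tx
  -- is 1. In degrees 0 and 1 the summand with y has no coefficient.
  homU-suc² : ∀ j → homU (suc (suc j)) ⊕ (y ⊛ homU j) ≈ homU (suc j)
  homU-suc² j zero = begin
    homU (suc (suc j)) 0 + (y ⊛ homU j) 0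
      ≡⟨ cong₂ _+_ (homU-coefficient (suc (suc j)) (suc (suc j)) 0 (ℕ.+-identityʳ _)) (trans (⊛-assoc X X (homU j) 0) (X⊛-zero (X ⊛ homU j))) ⟩
    (ℕtoℚ 2 * (X ⊛ U (suc j)) (suc (suc j)) - U j (suc (suc j))) * (½ * (½ ^ℚ suc j)) + 0ℚ
      ≡⟨ cong₂ (λ u v → (ℕtoℚ 2 * u - v) * (½ * (½ ^ℚ suc j)) + 0ℚ) (X⊛-suc (U (suc j)) (suc j)) (U-degree j (suc (suc j)) (ℕ.m≤n⇒m≤1+n ℕ.≤-refl)) ⟩
    (ℕtoℚ 2 * U (suc j) (suc j) - 0ℚ) * (½ * (½ ^ℚ suc j)) + 0ℚ
      ≡⟨ solve 2 (λ u h → (con (ℕtoℚ 2) :* u :- con 0ℚ) :* (con ½ :* h) :+ con 0ℚ := u :* h) refl (U (suc j) (suc j)) (½ ^ℚ suc j) ⟩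
    U (suc j) (suc j) * (½ ^ℚ suc j)
      ≡⟨ sym (homU-coefficient (suc j) (suc j) 0 (ℕ.+-identityʳ _)) ⟩
    homU (suc j) 0 ∎
    where open ≡-Reasoning
  homU-suc² j (suc zero) = begin
    homU (suc (suc j)) 1 + (y ⊛ homU j) 1
      ≡⟨ cong₂ _+_ (homU-coefficient (suc (suc j)) (suc j) 1 (ℕ.+-comm _ 1)) (trans (⊛-assoc X X (homU j) 1) (trans (X⊛-suc (X ⊛ homU j) 0) (X⊛-zero (homU j)))) ⟩
    (ℕtoℚ 2 * (X ⊛ U (suc j)) (suc j) - U j (suc j)) * (½ * (½ ^ℚ j)) + 0ℚ
      ≡⟨ cong₂ (λ u v → (ℕtoℚ 2 * u - v) * (½ * (½ ^ℚ j)) + 0ℚ) (X⊛-suc (U (suc j)) j) (U-degree j (suc j) ℕ.≤-refl) ⟩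
    (ℕtoℚ 2 * U (suc j) j - 0ℚ) * (½ * (½ ^ℚ j)) + 0ℚ
      ≡⟨ solve 2 (λ u h → (con (ℕtoℚ 2) :* u :- con 0ℚ) :* (con ½ :* h) :+ con 0ℚ := u :* h) refl (U (suc j) j) (½ ^ℚ j) ⟩
    U (suc j) j * (½ ^ℚ j)
      ≡⟨ sym (homU-coefficient (suc j) j 1 (ℕ.+-comm _ 1)) ⟩
    homU (suc j) 1 ∎
    where open ≡-Reasoning
  homU-suc² j (suc (suc d)) = trans (cong (homU (suc (suc j)) (suc (suc d)) +_)
    (trans (⊛-assoc X X (homU j) (suc (suc d))) (trans (X⊛-suc (X ⊛ homU j) (suc d)) (X⊛-suc (homU j) d)))) (cases (ℕ.<-cmp d j))
    where
    open ≡-Reasoning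
    cases : Tri (d ℕ.< j) (d ≡ j) (j ℕ.< d) → homU (suc (suc j)) (suc (suc d)) + homU j d ≡ homU (suc j) (suc (suc d))
    cases (tri> _ _ j<d) rewrite homU-degree (suc (suc j)) (suc (suc d)) (ℕ.s≤s (ℕ.s≤s j<d)) | homU-degree j d j<d
      | homU-degree (suc j) (suc (suc d)) (ℕ.s≤s (ℕ.m≤n⇒m≤1+n j<d)) = refl
    -- In degree j + 2 only the constant coefficients in t matter: 2t U_{j+1} has none, so that of
    -- U_{j+2} is minus that of U_j.
    cases (tri≈ _ refl _) rewrite homU-coefficient (suc (suc j)) 0 (suc (suc j)) refl | homU-coefficient j 0 j refl
      | homU-degree (suc j) (suc (suc j)) ℕ.≤-refl | X⊛-zero (U (suc j)) =
      solve 1 (λ u → (con (ℕtoℚ 2) :* con 0ℚ :- u) :* con 1ℚ :+ u :* con 1ℚ := con 0ℚ) refl (U j 0)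
    cases (tri< d<j _ _) with ℕ.m≤n⇒∃[o]m+o≡n d<j
    ... | o , refl = begin
      homU (suc (suc j)) (suc (suc d)) + homU j d
        ≡⟨ cong₂ _+_ (homU-coefficient (suc (suc j)) (suc o) (suc (suc d)) (trans (cong suc (ℕ.+-suc o (suc d))) (cong (λ u → suc (suc u)) (trans (ℕ.+-suc o d) (cong suc (ℕ.+-comm o d))))))
                     (homU-coefficient j (suc o) d (cong suc (ℕ.+-comm o d))) ⟩
      (ℕtoℚ 2 * (X ⊛ U (suc j)) (suc o) - U j (suc o)) * (½ * (½ ^ℚ o)) + U j (suc o) * (½ * (½ ^ℚ o))
        ≡⟨ cong (λ u → (ℕtoℚ 2 * u - U j (suc o)) * (½ * (½ ^ℚ o)) + U j (suc o) * (½ * (½ ^ℚ o))) (X⊛-suc (U (suc j)) o) ⟩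
      (ℕtoℚ 2 * U (suc j) o - U j (suc o)) * (½ * (½ ^ℚ o)) + U j (suc o) * (½ * (½ ^ℚ o))
        ≡⟨ solve 3 (λ u v h → (con (ℕtoℚ 2) :* u :- v) :* (con ½ :* h) :+ v :* (con ½ :* h) := u :* h) refl (U (suc j) o) (U j (suc o)) (½ ^ℚ o) ⟩
      U (suc j) o * (½ ^ℚ o)
        ≡⟨ sym (homU-coefficient (suc j) o (suc (suc d)) (trans (ℕ.+-suc o (suc d)) (cong suc (trans (ℕ.+-suc o d) (cong suc (ℕ.+-comm o d)))))) ⟩
      homU (suc j) (suc (suc d)) ∎

-- Solving the recurrences and comparing with the stated sum.

module Solution where
  open PowerSeries
  open RingIdentities
  open ChebyshevSeries
  open import Algebra.Bundles using (CommutativeRing)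
  open CommutativeRing seriesRing using (*-identityʳ; zeroʳ; distribˡ; commutativeSemiring)
  open import Algebra.Solver.Ring.NaturalCoefficients.Default commutativeSemiring
  open import Relation.Binary.Reasoning.Setoid setoid
  open import Data.List using (List; []; _∷_; _∷ʳ_; map; applyUpTo)
  open import Data.List.Properties using (applyUpTo-∷ʳ; map-++)
  open import Data.Nat as ℕ using (ℕ; zero; suc; _∸_)
  import Data.Nat.Properties as ℕ
  open import Data.Rational using (1ℚ; ½; _+_; _*_; _-_)
  import Data.Rational.Properties as ℚ
  open import Data.Bool using (true; false)
  open import Function using (_∘_)
  open import Relation.Binary.PropositionalEquality as ≡ using (_≡_; refl; cong; cong₂)

  homU-0 : homU 0 ≈ oneS
  homU-0 zero = refl
  homU-0 (suc n) = refl

  homU-1 : homU 1 ≈ oneS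
  homU-1 zero = refl
  homU-1 (suc zero) = refl
  homU-1 (suc (suc n)) = refl

  -- This constant term is the leading coefficient of U_j divided by 2^j; that it is 1 makes
  -- `inv1 (homU j)` a true inverse.
  homU-constant : ∀ j → homU j 0 ≡ 1ℚ
  homU-constant zero = refl
  homU-constant (suc zero) = refl
  homU-constant (suc (suc j)) = ≡.trans (≡.sym (ℚ.+-identityʳ _))
    (≡.trans (cong (homU (suc (suc j)) 0 +_) (≡.sym (≡.trans (⊛-assoc X X (homU j) 0) (X⊛-zero (X ⊛ homU j)))))
      (≡.trans (homU-suc² j 0) (homU-constant (suc j))))

  -- The quotient of Chebyshev polynomials that describes R, taken at x² and cleared of
  -- denominators: it ties the continued fraction to U.
  R⁺-homU : ∀ k → R⁺ (suc k) ⊛ homU (suc k) ≈ homU k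
  R⁺-homU zero = begin
    R⁺ 1 ⊛ homU 1    ≈⟨ ⊛-cong {R⁺ 1} {oneS} {homU 1} {oneS} sqX-one homU-1 ⟩
    oneS ⊛ oneS      ≈⟨ ⊛-identityˡ oneS ⟩
    oneS             ≈⟨ ≈-sym {homU 0} {oneS} homU-0 ⟩
    homU 0           ∎
  R⁺-homU (suc k) = begin
    R⁺ (suc (suc k)) ⊛ homU (suc (suc k))
      ≈⟨ continuant-step seriesRing {y} {R⁺ (suc k)} {R⁺ (suc (suc k))} {oneS} {homU k} {homU (suc k)} {homU (suc (suc k))}
           (homU-suc² k) (R⁺-homU k) (R⁺-suc k) ⟩
    oneS ⊛ homU (suc k)
      ≈⟨ ⊛-identityˡ (homU (suc k)) ⟩
    homU (suc k) ∎

  1-y : Series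
  1-y = oneS ⊖ y

  homU-2 : homU 2 ≈ 1-y
  homU-2 n = ≡.trans (S.solve 2 (λ p q → p S.:= (p S.:+ q) S.:- q) refl (homU 2 n) ((y ⊛ homU 0) n))
    (cong₂ _-_ (≡.trans (homU-suc² 0 n) (homU-1 n)) (≡.trans (⊛-congˡ y {homU 0} {oneS} homU-0 n) (*-identityʳ y n)))
    where
    open import Data.Rational.Solver
    module S = +-*-Solver

  -- The constant ½ as a series, which makes halving a product to which `half-sum-step` applies.
  half : Series
  half = scale ½ oneS

  half-⊛ : ∀ a → half ⊛ a ≈ scale ½ a
  half-⊛ a n = ≡.trans (⊛-scaleˡ ½ oneS a n) (cong (½ *_) (⊛-identityˡ a n))

  shift-cong : ∀ m {a b} → a ≈ b → shift m a ≈ shift m b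
  shift-cong m eq n with n ℕ.<ᵇ m
  ... | true  = refl
  ... | false = eq (n ∸ m)

  term : ℕ → ℕ → Series
  term k j = shift ((k ℕ.+ 2) ∸ j)
    (sqX (Re (j ∸ 1)) ⊛ (prodS (map (λ i → sqX (negX (R i))) (range j k)) ⊛ invUj j))

  -- `range 3 (2 + l)` reduces to this `applyUpTo`, so `1-y ⊛ termSum l` is `rhs313 (2 + l)` by
  -- computation.
  termSum : ℕ → Series
  termSum l = sumS (map (term (2 ℕ.+ l)) (applyUpTo (3 ℕ.+_) l))

  sumS-∷ʳ : ∀ xs a → sumS (xs ∷ʳ a) ≈ sumS xs ⊕ a
  sumS-∷ʳ []       a n = ≡.trans (ℚ.+-identityʳ (a n)) (≡.sym (ℚ.+-identityˡ (a n)))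
  sumS-∷ʳ (x ∷ xs) a n = ≡.trans (cong (x n +_) (sumS-∷ʳ xs a n)) (≡.sym (ℚ.+-assoc (x n) (sumS xs n) (a n)))

  prodS-∷ʳ : ∀ xs a → prodS (xs ∷ʳ a) ≈ a ⊛ prodS xs
  prodS-∷ʳ []       a = λ _ → refl
  prodS-∷ʳ (x ∷ xs) a = begin
    x ⊛ prodS (xs ∷ʳ a)     ≈⟨ ⊛-congˡ x {prodS (xs ∷ʳ a)} {a ⊛ prodS xs} (prodS-∷ʳ xs a) ⟩
    x ⊛ (a ⊛ prodS xs)      ≈⟨ solve 3 (λ x a p → x :* (a :* p) := a :* (x :* p)) (λ _ → refl) x a (prodS xs) ⟩
    a ⊛ (x ⊛ prodS xs)      ∎

  sumS-applyUpTo-⊛ : ∀ c (t t′ : ℕ → Series) f n → (∀ i → i ℕ.< n → t (f i) ≈ c ⊛ t′ (f i)) →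
                     sumS (map t (applyUpTo f n)) ≈ c ⊛ sumS (map t′ (applyUpTo f n))
  sumS-applyUpTo-⊛ c t t′ f zero    eq = ≈-sym {c ⊛ zeroS} {zeroS} (zeroʳ c)
  sumS-applyUpTo-⊛ c t t′ f (suc n) eq = begin
    t (f 0) ⊕ rest                ≈⟨ ⊕-cong {t (f 0)} {c ⊛ t′ (f 0)} {rest} {c ⊛ rest′} (eq 0 (ℕ.s≤s ℕ.z≤n))
                                       (sumS-applyUpTo-⊛ c t t′ (f ∘ suc) n (λ i i<n → eq (suc i) (ℕ.s≤s i<n))) ⟩
    (c ⊛ t′ (f 0)) ⊕ (c ⊛ rest′)  ≈⟨ ≈-sym {c ⊛ (t′ (f 0) ⊕ rest′)} {(c ⊛ t′ (f 0)) ⊕ (c ⊛ rest′)} (distribˡ c (t′ (f 0)) rest′) ⟩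
    c ⊛ (t′ (f 0) ⊕ rest′)        ∎
    where
    rest rest′ : Series
    rest  = sumS (map t (applyUpTo (f ∘ suc) n))
    rest′ = sumS (map t′ (applyUpTo (f ∘ suc) n))

  ≡⇒≈ : ∀ {a b : Series} → a ≡ b → a ≈ b
  ≡⇒≈ eq n = cong (λ f → f n) eq

  range-suc : ∀ j k → j ℕ.≤ suc k → range j (suc k) ≡ range j k ∷ʳ suc k
  range-suc j k j≤1+k = ≡.trans (cong (applyUpTo (j ℕ.+_)) (ℕ.+-∸-assoc 1 j≤1+k))
    (≡.trans (≡.sym (applyUpTo-∷ʳ (j ℕ.+_) (suc k ∸ j))) (cong (range j k ∷ʳ_) (ℕ.m+[n∸m]≡n j≤1+k)))

  map-range-suc : ∀ (t : ℕ → Series) j k → j ℕ.≤ suc k → map t (range j (suc k)) ≡ map t (range j k) ∷ʳ t (suc k)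
  map-range-suc t j k j≤1+k = ≡.trans (cong (map t) (range-suc j k j≤1+k)) (map-++ t (range j k) (suc k ∷ []))

  prodS-range-suc : ∀ j k → j ℕ.≤ suc k → prodS (map R⁻ (range j (suc k))) ≈ R⁻ (suc k) ⊛ prodS (map R⁻ (range j k))
  prodS-range-suc j k j≤1+k = begin
    prodS (map R⁻ (range j (suc k)))             ≈⟨ ≡⇒≈ (cong prodS (map-range-suc R⁻ j k j≤1+k)) ⟩
    prodS (map R⁻ (range j k) ∷ʳ R⁻ (suc k))     ≈⟨ prodS-∷ʳ (map R⁻ (range j k)) (R⁻ (suc k)) ⟩
    R⁻ (suc k) ⊛ prodS (map R⁻ (range j k))      ∎

  -- Raising k by one raises the exponent of x by one and appends one factor to the product over
  -- `range j k`.
  term-suc : ∀ k j → j ℕ.≤ suc k → term (suc k) j ≈ (R⁻ (suc k) ⊛ X) ⊛ term k j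
  term-suc k j j≤1+k = begin
    term (suc k) j
      ≈⟨ ≡⇒≈ (cong (λ e → shift e (a ⊛ (prodS (map R⁻ (range j (suc k))) ⊛ u))) (ℕ.+-∸-assoc 1 {k ℕ.+ 2} {j} j≤k+2)) ⟩
    shift (suc d) (a ⊛ (prodS (map R⁻ (range j (suc k))) ⊛ u))
      ≈⟨ shift-cong (suc d) (⊛-congˡ a {prodS (map R⁻ (range j (suc k))) ⊛ u} {(b ⊛ p) ⊛ u}
           (⊛-congʳ {prodS (map R⁻ (range j (suc k)))} {b ⊛ p} u (prodS-range-suc j k j≤1+k))) ⟩
    shift (suc d) (a ⊛ ((b ⊛ p) ⊛ u))
      ≈⟨ shift-cong (suc d) (solve 4 (λ a b p u → a :* ((b :* p) :* u) := (a :* (p :* u)) :* b) (λ _ → refl) a b p u) ⟩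
    shift (suc d) ((a ⊛ (p ⊛ u)) ⊛ b)
      ≈⟨ ≈-sym {shift (suc d) (a ⊛ (p ⊛ u)) ⊛ b} {shift (suc d) ((a ⊛ (p ⊛ u)) ⊛ b)} (shift-⊛ (suc d) (a ⊛ (p ⊛ u)) b) ⟩
    shift (suc d) (a ⊛ (p ⊛ u)) ⊛ b
      ≈⟨ ⊛-congʳ {shift (suc d) (a ⊛ (p ⊛ u))} {X ⊛ shift d (a ⊛ (p ⊛ u))} b (shift-suc d (a ⊛ (p ⊛ u))) ⟩
    (X ⊛ shift d (a ⊛ (p ⊛ u))) ⊛ b
      ≈⟨ solve 3 (λ x s b → (x :* s) :* b := (b :* x) :* s) (λ _ → refl) X (shift d (a ⊛ (p ⊛ u))) b ⟩
    (b ⊛ X) ⊛ shift d (a ⊛ (p ⊛ u)) ∎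
    where
    j≤k+2 : j ℕ.≤ k ℕ.+ 2
    j≤k+2 = ℕ.≤-trans j≤1+k (ℕ.≤-trans (ℕ.n≤1+n _) (ℕ.≤-reflexive (ℕ.+-comm 2 k)))
    d : ℕ
    d = (k ℕ.+ 2) ∸ j
    a b p u : Series
    a = sqX (Re (j ∸ 1))
    b = R⁻ (suc k)
    p = prodS (map R⁻ (range j k))
    u = invUj j

  shift-y : ∀ m a → shift (2 ℕ.+ m) a ≈ y ⊛ shift m a
  shift-y m a = begin
    shift (2 ℕ.+ m) a        ≈⟨ shift-suc (suc m) a ⟩
    X ⊛ shift (suc m) a      ≈⟨ ⊛-congˡ X {shift (suc m) a} {X ⊛ shift m a} (shift-suc m a) ⟩
    X ⊛ (X ⊛ shift m a)      ≈⟨ ≈-sym {y ⊛ shift m a} {X ⊛ (X ⊛ shift m a)} (⊛-assoc X X (shift m a)) ⟩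
    y ⊛ shift m a            ∎

  -- The exponent (k + 1) + 2 - (k + 1) is 2, hence the y, and the product consists of one factor.
  last-term : ∀ k → term (suc k) (suc k) ≈ R⁻ (suc k) ⊛ ((y ⊛ sqX (Re k)) ⊛ invUj (suc k))
  last-term k = begin
    term (suc k) (suc k)             ≈⟨ ≡⇒≈ (cong₂ (λ e is → shift e (a ⊛ (prodS (map R⁻ is) ⊛ u))) (ℕ.m+n∸m≡n (suc k) 2) singleton) ⟩
    shift 2 (a ⊛ ((b ⊛ oneS) ⊛ u))   ≈⟨ shift-y 0 (a ⊛ ((b ⊛ oneS) ⊛ u)) ⟩
    y ⊛ (a ⊛ ((b ⊛ oneS) ⊛ u))       ≈⟨ solve 4 (λ y a b u → y :* (a :* ((b :* con 1) :* u)) := b :* ((y :* a) :* u)) (λ _ → refl) y a b u ⟩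
    b ⊛ ((y ⊛ a) ⊛ u)                ∎
    where
    a b u : Series
    a = sqX (Re k)
    b = R⁻ (suc k)
    u = invUj (suc k)
    singleton : range (suc k) (suc k) ≡ suc k ∷ []
    singleton = ≡.trans (range-suc (suc k) k ℕ.≤-refl) (cong (λ d → applyUpTo (suc k ℕ.+_) d ∷ʳ suc k) (ℕ.n∸n≡0 k))

  -- The old summands share the factor of `term-suc`, and the new one contributes `last-term`. The
  -- result is the recurrence of `half-sum-step` with the common factor 1 - y removed.
  termSum-suc : ∀ l → termSum (suc l) ≈
    R⁻ (3 ℕ.+ l) ⊛ ((X ⊛ termSum l) ⊕ ((y ⊛ sqX (Re (2 ℕ.+ l))) ⊛ invUj (3 ℕ.+ l)))
  termSum-suc l = begin
    termSum (suc l)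
      ≈⟨ ≡⇒≈ (cong sumS (map-range-suc (term (3 ℕ.+ l)) 3 (2 ℕ.+ l) (ℕ.m≤m+n 3 l))) ⟩
    sumS (terms ∷ʳ term (3 ℕ.+ l) (3 ℕ.+ l))
      ≈⟨ sumS-∷ʳ terms (term (3 ℕ.+ l) (3 ℕ.+ l)) ⟩
    sumS terms ⊕ term (3 ℕ.+ l) (3 ℕ.+ l)
      ≈⟨ ⊕-cong {sumS terms} {(b ⊛ X) ⊛ termSum l} {term (3 ℕ.+ l) (3 ℕ.+ l)} {b ⊛ new}
           (sumS-applyUpTo-⊛ (b ⊛ X) (term (3 ℕ.+ l)) (term (2 ℕ.+ l)) (3 ℕ.+_) l
             (λ i i<l → term-suc (2 ℕ.+ l) (3 ℕ.+ i) (ℕ.+-monoʳ-≤ 3 (ℕ.<⇒≤ i<l))))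
           (last-term (2 ℕ.+ l)) ⟩
    ((b ⊛ X) ⊛ termSum l) ⊕ (b ⊛ new)
      ≈⟨ solve 4 (λ b x t n → ((b :* x) :* t) :+ (b :* n) := b :* ((x :* t) :+ n)) (λ _ → refl) b X (termSum l) new ⟩
    b ⊛ ((X ⊛ termSum l) ⊕ new) ∎
    where
    terms : List Series
    terms = map (term (3 ℕ.+ l)) (applyUpTo (3 ℕ.+_) l)
    b new : Series
    b = R⁻ (3 ℕ.+ l)
    new = (y ⊛ sqX (Re (2 ℕ.+ l))) ⊛ invUj (3 ℕ.+ l)

  module _ (S D : ℕ → Series)
    (S-zero : S 0 ≈ y)
    (SD-zero : S 0 ⊕ D 0 ≈ zeroS)
    (S-suc : ∀ l → S (suc l) ≈ (X ⊛ S l) ⊕ ((y ⊛ R⁺ (2 ℕ.+ l)) ⊛ S (suc l)))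
    (D-suc : ∀ l → D (suc l) ⊕ ((y ⊛ R⁻ (2 ℕ.+ l)) ⊛ D (suc l)) ≈ X ⊛ D l)
    where

    -- By `continuant-step` the product of S with its polynomial is multiplied by x in each step, so
    -- it telescopes down to the starting value y (1 - y).
    S-homU : ∀ l → S l ⊛ homU (2 ℕ.+ l) ≈ 1-y ⊛ shift (2 ℕ.+ l) oneS
    S-homU zero = begin
      S 0 ⊛ homU 2        ≈⟨ ⊛-cong {S 0} {y} {homU 2} {1-y} S-zero homU-2 ⟩
      y ⊛ 1-y             ≈⟨ solve 2 (λ y c → y :* c := c :* (y :* con 1)) (λ _ → refl) y 1-y ⟩
      1-y ⊛ (y ⊛ oneS)    ≈⟨ ⊛-congˡ 1-y {y ⊛ oneS} {shift 2 oneS} (≈-sym {shift 2 oneS} {y ⊛ oneS} (shift-y 0 oneS)) ⟩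
      1-y ⊛ shift 2 oneS  ∎
    S-homU (suc l) = begin
      S (suc l) ⊛ homU (3 ℕ.+ l)
        ≈⟨ continuant-step seriesRing {y} {R⁺ (2 ℕ.+ l)} {S (suc l)} {X ⊛ S l} {homU (1 ℕ.+ l)} {homU (2 ℕ.+ l)} {homU (3 ℕ.+ l)}
             (homU-suc² (suc l)) (R⁺-homU (suc l)) (S-suc l) ⟩
      (X ⊛ S l) ⊛ homU (2 ℕ.+ l)
        ≈⟨ ⊛-assoc X (S l) (homU (2 ℕ.+ l)) ⟩
      X ⊛ (S l ⊛ homU (2 ℕ.+ l))
        ≈⟨ ⊛-congˡ X {S l ⊛ homU (2 ℕ.+ l)} {1-y ⊛ shift (2 ℕ.+ l) oneS} (S-homU l) ⟩
      X ⊛ (1-y ⊛ shift (2 ℕ.+ l) oneS)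
        ≈⟨ solve 3 (λ x c s → x :* (c :* s) := c :* (x :* s)) (λ _ → refl) X 1-y (shift (2 ℕ.+ l) oneS) ⟩
      1-y ⊛ (X ⊛ shift (2 ℕ.+ l) oneS)
        ≈⟨ ⊛-congˡ 1-y {X ⊛ shift (2 ℕ.+ l) oneS} {shift (3 ℕ.+ l) oneS}
             (≈-sym {shift (3 ℕ.+ l) oneS} {X ⊛ shift (2 ℕ.+ l) oneS} (shift-suc (2 ℕ.+ l) oneS)) ⟩
      1-y ⊛ shift (3 ℕ.+ l) oneS ∎

    S-closed : ∀ l → S l ≈ 1-y ⊛ invUj (2 ℕ.+ l)
    S-closed l = begin
      S l
        ≈⟨ divide-right seriesRing {S l} {1-y ⊛ shift (2 ℕ.+ l) oneS} {homU (2 ℕ.+ l)} {q}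
             (inv1-inverse (homU (2 ℕ.+ l)) (homU-constant (2 ℕ.+ l))) (S-homU l) ⟩
      (1-y ⊛ shift (2 ℕ.+ l) oneS) ⊛ q
        ≈⟨ ⊛-assoc 1-y (shift (2 ℕ.+ l) oneS) q ⟩
      1-y ⊛ (shift (2 ℕ.+ l) oneS ⊛ q)
        ≈⟨ ⊛-congˡ 1-y {shift (2 ℕ.+ l) oneS ⊛ q} {shift (2 ℕ.+ l) (oneS ⊛ q)} (shift-⊛ (2 ℕ.+ l) oneS q) ⟩
      1-y ⊛ shift (2 ℕ.+ l) (oneS ⊛ q)
        ≈⟨ ⊛-congˡ 1-y {shift (2 ℕ.+ l) (oneS ⊛ q)} {invUj (2 ℕ.+ l)} (shift-cong (2 ℕ.+ l) (⊛-identityˡ q)) ⟩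
      1-y ⊛ invUj (2 ℕ.+ l) ∎
      where
      q : Series
      q = inv1 (homU (2 ℕ.+ l))

    half-sum-closed : ∀ l → half ⊛ (S l ⊕ D l) ≈ 1-y ⊛ termSum l
    half-sum-closed zero = begin
      half ⊛ (S 0 ⊕ D 0)     ≈⟨ ⊛-congˡ half {S 0 ⊕ D 0} {zeroS} SD-zero ⟩
      half ⊛ zeroS           ≈⟨ zeroʳ half ⟩
      zeroS                  ≈⟨ ≈-sym {1-y ⊛ zeroS} {zeroS} (zeroʳ 1-y) ⟩
      1-y ⊛ zeroS            ∎
    half-sum-closed (suc l) = begin
      half ⊛ (S (suc l) ⊕ D (suc l))
        ≈⟨ half-sum-step seriesRing {half} {X} {y} {R⁺ k} {R⁻ k} {b} {S l} {D l} {S (suc l)} {D (suc l)}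
             (R⁻-inverse (suc l)) (S-suc l) (D-suc l) ⟩
      b ⊛ ((X ⊛ (half ⊛ (S l ⊕ D l))) ⊕ ((y ⊛ (half ⊛ (R⁺ k ⊕ R⁻ k))) ⊛ S (suc l)))
        ≈⟨ ⊛-congˡ b {(X ⊛ (half ⊛ (S l ⊕ D l))) ⊕ ((y ⊛ (half ⊛ (R⁺ k ⊕ R⁻ k))) ⊛ S (suc l))}
                     {(X ⊛ (1-y ⊛ termSum l)) ⊕ ((y ⊛ a) ⊛ (1-y ⊛ invUj (suc k)))}
             (⊕-cong {X ⊛ (half ⊛ (S l ⊕ D l))} {X ⊛ (1-y ⊛ termSum l)}
                     {(y ⊛ (half ⊛ (R⁺ k ⊕ R⁻ k))) ⊛ S (suc l)} {(y ⊛ a) ⊛ (1-y ⊛ invUj (suc k))}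
               (⊛-congˡ X {half ⊛ (S l ⊕ D l)} {1-y ⊛ termSum l} (half-sum-closed l))
               (⊛-cong {y ⊛ (half ⊛ (R⁺ k ⊕ R⁻ k))} {y ⊛ a} {S (suc l)} {1-y ⊛ invUj (suc k)}
                 (⊛-congˡ y {half ⊛ (R⁺ k ⊕ R⁻ k)} {a} even-part) (S-closed (suc l)))) ⟩
      b ⊛ ((X ⊛ (1-y ⊛ termSum l)) ⊕ ((y ⊛ a) ⊛ (1-y ⊛ invUj (suc k))))
        ≈⟨ solve 6 (λ b x c t ya u → b :* ((x :* (c :* t)) :+ (ya :* (c :* u))) := c :* (b :* ((x :* t) :+ (ya :* u)))) (λ _ → refl)
             b X 1-y (termSum l) (y ⊛ a) (invUj (suc k)) ⟩
      1-y ⊛ (b ⊛ ((X ⊛ termSum l) ⊕ ((y ⊛ a) ⊛ invUj (suc k))))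
        ≈⟨ ⊛-congˡ 1-y {b ⊛ ((X ⊛ termSum l) ⊕ ((y ⊛ a) ⊛ invUj (suc k)))} {termSum (suc l)}
             (≈-sym {termSum (suc l)} {b ⊛ ((X ⊛ termSum l) ⊕ ((y ⊛ a) ⊛ invUj (suc k)))} (termSum-suc l)) ⟩
      1-y ⊛ termSum (suc l) ∎
      where
      k = 2 ℕ.+ l
      a b : Series
      a = sqX (Re k)
      b = R⁻ (suc k)
      even-part : half ⊛ (R⁺ k ⊕ R⁻ k) ≈ a
      even-part n = ≡.trans (half-⊛ (R⁺ k ⊕ R⁻ k) n)
        (≡.trans (cong (½ *_) (≡.sym (sqX-⊕ (R k) (negX (R k)) n))) (≡.sym (sqX-scale ½ (R k ⊕ negX (R k)) n)))

    half-sum-rhs : ∀ l n → ½ * (S l n + D l n) ≡ rhs313 (2 ℕ.+ l) n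
    half-sum-rhs l n = ≡.trans (≡.sym (half-⊛ (S l ⊕ D l) n)) (half-sum-closed l n)

-- Binary trees as 132-avoiding permutations, and the mirror-symmetric ones among them.

module Trees where
  open Parity using (sgn; sgn-+; sgn-square)
  open import Data.Bool using (Bool; true; false; T; _∧_)
  open import Data.Bool.Properties using (T-∧)
  open import Data.Empty using (⊥-elim)
  open import Data.Nat
  open import Data.Nat.Properties
  open import Data.Nat.Solver using (module +-*-Solver)
  open import Data.Product using (_×_; _,_; proj₁; proj₂; ∃; ∃₂)
  open import Data.Rational as ℚ using (ℚ; 1ℚ)
  import Data.Rational.Properties as ℚ
  open import Data.Sum using (_⊎_; inj₁; inj₂)
  open import Function.Bundles using (Equivalence)
  open import Relation.Binary.PropositionalEquality
  open +-*-Solver using (solve; _:=_; _:+_; _:*_; con)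

  -- node a b stands for the skew sum (a ⊕ 1) ⊖ b, so trees are the 132-avoiding permutations.
  data Tree : Set where
    leaf : Tree
    node : Tree → Tree → Tree

  size : Tree → ℕ
  size leaf       = 0
  size (node a b) = suc (size a + size b)

  -- occ l counts the occurrences of 2134⋯k with k = l + 2; occ 0 counts inversions.
  occ : ℕ → Tree → ℕ
  occ l       leaf       = 0
  occ zero    (node a b) = occ zero a + occ zero b + suc (size a) * size b
  occ (suc l) (node a b) = occ (suc l) a + occ l a + occ (suc l) b

  -- The skew sum d ⊖ e: `e` is appended at the end of the right spine of `d`.
  graft : Tree → Tree → Tree
  graft leaf       e = e
  graft (node a b) e = node a (graft b e)

  -- Inverting a permutation reverses the blocks of a skew sum and keeps the order in a direct sum,
  -- so (a ⊕ 1) ⊖ b has the inverse b⁻¹ ⊖ (a⁻¹ ⊕ 1).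
  mirror : Tree → Tree
  mirror leaf       = leaf
  mirror (node a b) = graft (mirror b) (node (mirror a) leaf)

  size-graft : ∀ d e → size (graft d e) ≡ size d + size e
  size-graft leaf       e = refl
  size-graft (node a b) e rewrite size-graft b e = cong suc (sym (+-assoc (size a) (size b) (size e)))

  occ-graft-suc : ∀ l d e → occ (suc l) (graft d e) ≡ occ (suc l) d + occ (suc l) e
  occ-graft-suc l leaf       e = refl
  occ-graft-suc l (node a b) e rewrite occ-graft-suc l b e = sym (+-assoc (occ (suc l) a + occ l a) _ _)

  occ-graft-zero : ∀ d e → occ 0 (graft d e) ≡ occ 0 d + occ 0 e + size d * size e
  occ-graft-zero leaf       e = sym (+-identityʳ (occ 0 e))
  occ-graft-zero (node a b) e rewrite occ-graft-zero b e | size-graft b e =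
    solve 6 (λ x y z a b e → x :+ (y :+ z :+ b :* e) :+ (con 1 :+ a) :* (b :+ e)
                := (x :+ y :+ (con 1 :+ a) :* b) :+ z :+ (con 1 :+ (a :+ b)) :* e) refl
      (occ 0 a) (occ 0 b) (occ 0 e) (size a) (size b) (size e)

  size-mirror : ∀ t → size (mirror t) ≡ size t
  size-mirror leaf = refl
  size-mirror (node a b) rewrite size-graft (mirror b) (node (mirror a) leaf) | size-mirror a | size-mirror b =
    solve 2 (λ a b → b :+ (con 1 :+ (a :+ con 0)) := con 1 :+ (a :+ b)) refl (size a) (size b)

  -- Each 2134⋯k is its own inverse, so inverting a permutation preserves its number of occurrences.
  -- On trees this shows in the symmetry of the counts under exchanging the blocks of a skew sum.
  occ-mirror : ∀ l t → occ l (mirror t) ≡ occ l t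
  occ-mirror l leaf = refl
  occ-mirror zero (node a b) rewrite occ-graft-zero (mirror b) (node (mirror a) leaf)
    | size-mirror a | size-mirror b | occ-mirror 0 a | occ-mirror 0 b =
    solve 4 (λ x y a b → y :+ (x :+ con 0 :+ (con 1 :+ a) :* con 0) :+ b :* (con 1 :+ (a :+ con 0))
                := x :+ y :+ (con 1 :+ a) :* b) refl (occ 0 a) (occ 0 b) (size a) (size b)
  occ-mirror (suc l) (node a b) rewrite occ-graft-suc l (mirror b) (node (mirror a) leaf)
    | occ-mirror (suc l) a | occ-mirror l a | occ-mirror (suc l) b =
    solve 3 (λ x y z → z :+ (x :+ y :+ con 0) := x :+ y :+ z) refl (occ (suc l) a) (occ l a) (occ (suc l) b)

  graft-leaf : ∀ d → graft d leaf ≡ d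
  graft-leaf leaf = refl
  graft-leaf (node a b) = cong (node a) (graft-leaf b)

  graft-assoc : ∀ c d e → graft (graft c d) e ≡ graft c (graft d e)
  graft-assoc leaf       d e = refl
  graft-assoc (node a b) d e = cong (node a) (graft-assoc b d e)

  mirror-graft : ∀ d e → mirror (graft d e) ≡ graft (mirror e) (mirror d)
  mirror-graft leaf       e = sym (graft-leaf (mirror e))
  mirror-graft (node a b) e rewrite mirror-graft b e = graft-assoc (mirror e) (mirror b) (node (mirror a) leaf)

  mirror-involutive : ∀ t → mirror (mirror t) ≡ t
  mirror-involutive leaf = refl
  mirror-involutive (node a b) rewrite mirror-graft (mirror b) (node (mirror a) leaf)
    | mirror-involutive a | mirror-involutive b = refl

  node-injective : ∀ {a b c d} → node a b ≡ node c d → a ≡ c × b ≡ d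
  node-injective refl = refl , refl

  graft-node≢leaf : ∀ d {a} → graft d (node a leaf) ≢ leaf
  graft-node≢leaf leaf       ()
  graft-node≢leaf (node _ _) ()

  graft-node-injective : ∀ c d {a b} → graft c (node a leaf) ≡ graft d (node b leaf) → c ≡ d × a ≡ b
  graft-node-injective leaf leaf refl = refl , refl
  graft-node-injective leaf (node _ d) eq = ⊥-elim (graft-node≢leaf d (sym (proj₂ (node-injective eq))))
  graft-node-injective (node _ c) leaf eq = ⊥-elim (graft-node≢leaf c (proj₂ (node-injective eq)))
  graft-node-injective (node _ c) (node _ d) eq with node-injective eq
  ... | refl , eq′ with graft-node-injective c d eq′
  ...   | refl , refl = refl , refl

  -- Gives access to the last tree of the forest, so that a symmetric forest can be peeled from both
  -- ends.
  unsnoc : ∀ t → t ≡ leaf ⊎ ∃₂ λ d c → t ≡ graft d (node c leaf)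
  unsnoc leaf = inj₁ refl
  unsnoc (node a b) with unsnoc b
  ... | inj₁ refl           = inj₂ (leaf , a , refl)
  ... | inj₂ (d , c , refl) = inj₂ (node a d , c , refl)

  -- The cases are the possible numbers of trees along the spine: none, one (itself symmetric below
  -- its root), or at least two. In the last case the final tree is determined by the first and is
  -- not stored.
  data Palindrome : Set where
    ε    : Palindrome
    fix  : Palindrome → Palindrome
    wrap : Tree → Palindrome → Palindrome

  toTree : Palindrome → Tree
  toTree ε          = leaf
  toTree (fix s)    = node (toTree s) leaf
  toTree (wrap a s) = node a (graft (toTree s) (node (mirror a) leaf))

  sizeP : Palindrome → ℕ
  sizeP ε          = 0
  sizeP (fix s)    = suc (sizeP s)
  sizeP (wrap a s) = suc (suc (size a + size a + sizeP s))

  size-toTree : ∀ s → size (toTree s) ≡ sizeP s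
  size-toTree ε = refl
  size-toTree (fix s) rewrite size-toTree s = cong suc (+-identityʳ _)
  size-toTree (wrap a s) rewrite size-graft (toTree s) (node (mirror a) leaf) | size-mirror a | size-toTree s =
    solve 2 (λ a s → con 1 :+ (a :+ (s :+ (con 1 :+ (a :+ con 0)))) := con 2 :+ (a :+ a :+ s)) refl (size a) (sizeP s)

  mirror-toTree : ∀ s → mirror (toTree s) ≡ toTree s
  mirror-toTree ε = refl
  mirror-toTree (fix s) rewrite mirror-toTree s = refl
  mirror-toTree (wrap a s) rewrite mirror-graft (toTree s) (node (mirror a) leaf) | mirror-involutive a | mirror-toTree s = refl

  toTree-injective : ∀ {s s′} → toTree s ≡ toTree s′ → s ≡ s′
  toTree-injective {ε}        {ε}          eq = refl
  toTree-injective {fix s}    {fix s′}     eq = cong fix (toTree-injective (proj₁ (node-injective eq)))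
  toTree-injective {fix s}    {wrap a s′}  eq = ⊥-elim (graft-node≢leaf (toTree s′) (sym (proj₂ (node-injective eq))))
  toTree-injective {wrap a s} {fix s′}     eq = ⊥-elim (graft-node≢leaf (toTree s) (proj₂ (node-injective eq)))
  toTree-injective {wrap a s} {wrap a′ s′} eq with node-injective eq
  ... | refl , eq′ = cong (wrap a) (toTree-injective (proj₁ (graft-node-injective (toTree s) (toTree s′) eq′)))

  -- With two or more trees, comparing both ends of the mirror equation makes the first tree the
  -- mirror image of the last and leaves a symmetric middle part `d`. As `d` comes from `unsnoc` and
  -- is no subterm, the recursion runs on the bound `n`.
  palindrome-tree : ∀ n t → size t ≤ n → mirror t ≡ t → ∃ λ s → toTree s ≡ t
  palindrome-tree n leaf _ _ = ε , refl
  palindrome-tree (suc n) (node a b) (s≤s le) eq with unsnoc b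
  ... | inj₁ refl with palindrome-tree n a (≤-trans (m≤m+n (size a) 0) le) (proj₁ (node-injective eq))
  ...   | s , refl = fix s , refl
  palindrome-tree (suc n) (node a b) (s≤s le) eq | inj₂ (d , c , refl)
    rewrite mirror-graft d (node c leaf) with node-injective eq
  ...   | refl , eq″ with graft-node-injective (mirror d) d eq″
  ...     | eq‴ , _ with palindrome-tree n d (≤-trans (≤-trans (m≤m+n (size d) _)
                              (≤-trans (≤-reflexive (sym (size-graft d (node c leaf)))) (m≤n+m _ (size (mirror c))))) le) eq‴
  ...       | s , refl = wrap (mirror c) s , cong (λ u → node (mirror c) (graft (toTree s) (node u leaf))) (mirror-involutive c)

  T-ext : ∀ {b c} → (T b → T c) → (T c → T b) → b ≡ c
  T-ext {true}  {true}  f g = refl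
  T-ext {true}  {false} f g = ⊥-elim (f _)
  T-ext {false} {true}  f g = ⊥-elim (g _)
  T-ext {false} {false} f g = refl

  T-∧-intro : ∀ {b c} → T b → T c → T (b ∧ c)
  T-∧-intro p q = Equivalence.from T-∧ (p , q)

  T-∧-elim : ∀ {b c} → T (b ∧ c) → T b × T c
  T-∧-elim = Equivalence.to T-∧

  avoids hits : ℕ → Tree → Bool
  avoids l t = occ l t ≡ᵇ 0
  -- For l ≥ 1 the second condition follows from the first; it makes the recurrence start at l = 0.
  hits l t = (occ l t ≡ᵇ 1) ∧ (occ (suc l) t ≡ᵇ 0)

  -- Dropping the largest letter of the longer pattern leaves the shorter one.
  occ≡0-suc : ∀ l t → occ l t ≡ 0 → occ (suc l) t ≡ 0
  occ≡0-suc l leaf _ = refl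
  occ≡0-suc zero (node a b) eq
    with m+n≡0⇒m≡0 (occ 0 a) (m+n≡0⇒m≡0 (occ 0 a + occ 0 b) eq) | m+n≡0⇒n≡0 (occ 0 a) (m+n≡0⇒m≡0 (occ 0 a + occ 0 b) eq)
  ... | a≡0 | b≡0 rewrite a≡0 | occ≡0-suc 0 a a≡0 | occ≡0-suc 0 b b≡0 = refl
  occ≡0-suc (suc l) (node a b) eq
    with m+n≡0⇒m≡0 (occ (suc l) a) (m+n≡0⇒m≡0 (occ (suc l) a + occ l a) eq) | m+n≡0⇒n≡0 (occ (suc l) a + occ l a) eq
  ... | a≡0 | b≡0 rewrite a≡0 | occ≡0-suc (suc l) a a≡0 | occ≡0-suc (suc l) b b≡0 = refl

  occ-pos-pred : ∀ l t → occ (suc l) t > 0 → occ l t > 0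
  occ-pos-pred l t pos with occ l t in eq
  ... | suc _ = s≤s z≤n
  ... | zero rewrite occ≡0-suc l t eq = pos

  +-pos⇒⊎-pos : ∀ m {n} → m + n > 0 → m > 0 ⊎ n > 0
  +-pos⇒⊎-pos zero    pos = inj₂ pos
  +-pos⇒⊎-pos (suc m) pos = inj₁ (s≤s z≤n)

  -- Dropping either of the last two letters of 2134⋯k (k ≥ 4) leaves a shorter pattern of the same shape.
  occ-pos-pred² : ∀ l t → occ (suc (suc l)) t > 0 → occ (suc l) t ≥ 2
  occ-pos-pred² l (node a b) pos with +-pos⇒⊎-pos (occ (suc (suc l)) a + occ (suc l) a) pos
  ... | inj₂ b-pos = ≤-trans (occ-pos-pred² l b b-pos) (m≤n+m _ _)
  ... | inj₁ a-pos with +-pos⇒⊎-pos (occ (suc (suc l)) a) a-pos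
  ...   | inj₁ pos₂ = ≤-trans (occ-pos-pred² l a pos₂) (≤-trans (m≤m+n _ _) (m≤m+n _ _))
  ...   | inj₂ pos₁ = ≤-trans (+-mono-≤ pos₁ (occ-pos-pred l a pos₁)) (m≤m+n _ _)

  -- By `occ-pos-pred²` an occurrence of the longer pattern comes with two of the shorter one, so
  -- both sides are then false.
  hits-suc : ∀ l t → hits (suc l) t ≡ (occ (suc l) t ≡ᵇ 1)
  hits-suc l t with occ (suc (suc l)) t in eq
  hits-suc l t | zero with occ (suc l) t ≡ᵇ 1
  ... | true  = refl
  ... | false = refl
  hits-suc l t | suc m with occ (suc l) t | occ-pos-pred² l t (subst (_> 0) (sym eq) (s≤s z≤n))
  ... | suc zero    | s≤s ()
  ... | suc (suc _) | _ = refl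

  isLeaf : Tree → Bool
  isLeaf leaf       = true
  isLeaf (node _ _) = false

  isε : Palindrome → Bool
  isε ε = true
  isε _ = false

  avoids-zero-node : ∀ a b → avoids 0 (node a b) ≡ avoids 0 a ∧ isLeaf b
  avoids-zero-node a leaf rewrite +-identityʳ (occ 0 a) | *-zeroʳ (size a) | +-identityʳ (occ 0 a) with occ 0 a
  ... | zero  = refl
  ... | suc _ = refl
  avoids-zero-node a (node b c) with occ 0 a
  ... | suc _ = refl
  ... | zero with occ 0 (node b c)
  ...   | zero  = refl
  ...   | suc _ = refl

  -- Avoiding the shorter pattern makes `a` avoid the longer one as well. The drop of the level from
  -- `suc l` to `l` on the left subtree is the recursion of R.
  avoids-suc-node : ∀ l a b → avoids (suc l) (node a b) ≡ avoids l a ∧ avoids (suc l) b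
  avoids-suc-node l a b with occ l a in eq
  ... | zero rewrite occ≡0-suc l a eq = refl
  ... | suc m rewrite +-suc (occ (suc l) a) m = refl

  occ-fix : ∀ l s → occ (suc l) (toTree (fix s)) ≡ occ (suc l) (toTree s) + occ l (toTree s)
  occ-fix l s = +-identityʳ _

  occ-wrap : ∀ l a s → occ (suc l) (toTree (wrap a s)) ≡
             2 * (occ (suc l) a + occ l a) + occ (suc l) (toTree s)
  occ-wrap l a s rewrite occ-graft-suc l (toTree s) (node (mirror a) leaf) | occ-mirror (suc l) a | occ-mirror l a =
    solve 3 (λ x y z → x :+ y :+ (z :+ (x :+ y :+ con 0)) := con 2 :* (x :+ y) :+ z) refl
      (occ (suc l) a) (occ l a) (occ (suc l) (toTree s))

  -- The doubled part collects the inversions inside `a` and its mirror image and those between the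
  -- centre and the two outer blocks. The square counts the pairs between the outer blocks, all of
  -- which are inverted.
  inversions-wrap : ∀ a s → occ 0 (toTree (wrap a s)) ≡
    2 * (occ 0 a + sizeP s * suc (size a)) + (suc (size a) * suc (size a) + occ 0 (toTree s))
  inversions-wrap a s rewrite occ-graft-zero (toTree s) (node (mirror a) leaf) | size-graft (toTree s) (node (mirror a) leaf)
    | occ-mirror 0 a | size-mirror a | size-toTree s =
    solve 4 (λ x y a s →
        x :+ (y :+ (x :+ con 0 :+ (con 1 :+ a) :* con 0) :+ s :* (con 1 :+ (a :+ con 0)))
          :+ (con 1 :+ a) :* (s :+ (con 1 :+ (a :+ con 0)))
        := con 2 :* (x :+ s :* (con 1 :+ a)) :+ ((con 1 :+ a) :* (con 1 :+ a) :+ y)) refl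
      (occ 0 a) (occ 0 (toTree s)) (size a) (sizeP s)

  -- Both sides force `occ (suc l)` to vanish on `s`, the left one through the second condition of
  -- `hits`. Then `occ (suc (suc l))` vanishes too, and what remains is the condition on `occ l`.
  hits-suc-fix : ∀ l s → hits (suc l) (toTree (fix s)) ≡ hits l (toTree s)
  hits-suc-fix l s rewrite occ-fix l s | occ-fix (suc l) s with occ (suc l) (toTree s) in eq
  ... | zero rewrite occ≡0-suc (suc l) (toTree s) eq = refl
  ... | suc m rewrite +-suc (occ (suc (suc l)) (toTree s)) m
    with (suc m + occ l (toTree s) ≡ᵇ 1) | (occ l (toTree s) ≡ᵇ 1)
  ...   | true  | true  = refl
  ...   | true  | false = refl
  ...   | false | true  = refl
  ...   | false | false = refl

  hits-suc-wrap : ∀ l a s → hits (suc l) (toTree (wrap a s)) ≡ avoids l a ∧ hits (suc l) (toTree s)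
  hits-suc-wrap l a s rewrite occ-wrap l a s | occ-wrap (suc l) a s with occ l a in eq
  ... | zero rewrite occ≡0-suc l a eq | occ≡0-suc (suc l) a (occ≡0-suc l a eq) = refl
  ... | suc m rewrite +-suc (occ (suc l) a) m | +-suc (occ (suc l) a + m) (occ (suc l) a + m + 0) = refl

  -- A new maximum at the end keeps the inversions and completes each of them to a 213, so the two
  -- conditions of `hits` exclude each other.
  hits-zero-fix : ∀ s → hits 0 (toTree (fix s)) ≡ false
  hits-zero-fix s rewrite occ-fix 0 s | +-identityʳ (occ 0 (toTree s)) | *-zeroʳ (size (toTree s)) | +-identityʳ (occ 0 (toTree s))
    with occ 0 (toTree s)
  ... | zero        = refl
  ... | suc (suc _) = refl
  ... | suc zero rewrite +-comm (occ 1 (toTree s)) 1 = refl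

  ≥2⇒≢ᵇ1 : ∀ {n} → n ≥ 2 → (n ≡ᵇ 1) ≡ false
  ≥2⇒≢ᵇ1 (s≤s (s≤s _)) = refl

  wrap-inversions≥2 : ∀ a s → size a + sizeP s > 0 → occ 0 (toTree (wrap a s)) ≥ 2
  wrap-inversions≥2 a s pos rewrite inversions-wrap a s with size a
  -- A nonempty `a` makes the square at least 4; if `a` is empty, `s` is not, and the doubled part
  -- is at least 2.
  ... | suc k = ≤-trans (≤-trans (s≤s (s≤s z≤n)) (m≤m+n _ (occ 0 (toTree s)))) (m≤n+m _ (2 * (occ 0 a + sizeP s * suc (suc k))))
  ... | zero  = ≤-trans (*-monoʳ-≤ 2 (≤-trans (≤-trans pos (≤-reflexive (sym (*-identityʳ _)))) (m≤n+m _ (occ 0 a)))) (m≤m+n _ _)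

  -- Every other wrapping has at least two inversions; the survivor `wrap leaf ε` is the permutation
  -- 21.
  hits-zero-wrap : ∀ a s → hits 0 (toTree (wrap a s)) ≡ isLeaf a ∧ isε s
  hits-zero-wrap leaf       ε          = refl
  hits-zero-wrap leaf       (fix s)    = cong (_∧ avoids 1 (toTree (wrap leaf (fix s)))) (≥2⇒≢ᵇ1 (wrap-inversions≥2 leaf (fix s) (s≤s z≤n)))
  hits-zero-wrap leaf       (wrap b s) = cong (_∧ avoids 1 (toTree (wrap leaf (wrap b s)))) (≥2⇒≢ᵇ1 (wrap-inversions≥2 leaf (wrap b s) (s≤s z≤n)))
  hits-zero-wrap (node a b) s          = cong (_∧ avoids 1 (toTree (wrap (node a b) s))) (≥2⇒≢ᵇ1 (wrap-inversions≥2 (node a b) s (s≤s z≤n)))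

  sgn-double : ∀ n → sgn (2 * n) ≡ 1ℚ
  sgn-double n rewrite +-identityʳ n = trans (sgn-+ n n) (sgn-square n)

  sgn-square-index : ∀ n → sgn (n * n) ≡ sgn n
  sgn-square-index zero = refl
  sgn-square-index (suc n) = begin
    sgn (suc n * suc n)                     ≡⟨ cong sgn (solve 1 (λ n → (con 1 :+ n) :* (con 1 :+ n) := con 1 :+ (con 2 :* n :+ n :* n)) refl n) ⟩
    ℚ.- sgn (2 * n + n * n)                 ≡⟨ cong ℚ.-_ (sgn-+ (2 * n) (n * n)) ⟩
    ℚ.- (sgn (2 * n) ℚ.* sgn (n * n))       ≡⟨ cong₂ (λ u v → ℚ.- (u ℚ.* v)) (sgn-double n) (sgn-square-index n) ⟩
    ℚ.- (1ℚ ℚ.* sgn n)                      ≡⟨ cong ℚ.-_ (ℚ.*-identityˡ (sgn n)) ⟩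
    ℚ.- sgn n                               ∎
    where open ≡-Reasoning

  sgnP : Palindrome → ℚ
  sgnP s = sgn (occ 0 (toTree s))

  sgnP-fix : ∀ s → sgnP (fix s) ≡ sgnP s
  sgnP-fix s rewrite *-zeroʳ (size (toTree s)) | +-identityʳ (occ 0 (toTree s) + 0) | +-identityʳ (occ 0 (toTree s)) = refl

  sgnP-wrap : ∀ a s → sgnP (wrap a s) ≡ (ℚ.- sgn (size a)) ℚ.* sgnP s
  sgnP-wrap a s = begin
    sgn (occ 0 (toTree (wrap a s)))
      ≡⟨ cong sgn (inversions-wrap a s) ⟩
    sgn (2 * m + (suc (size a) * suc (size a) + occ 0 (toTree s)))
      ≡⟨ sgn-+ (2 * m) _ ⟩
    sgn (2 * m) ℚ.* sgn (suc (size a) * suc (size a) + occ 0 (toTree s))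
      ≡⟨ cong₂ ℚ._*_ (sgn-double m) (sgn-+ (suc (size a) * suc (size a)) _) ⟩
    1ℚ ℚ.* (sgn (suc (size a) * suc (size a)) ℚ.* sgnP s)
      ≡⟨ ℚ.*-identityˡ _ ⟩
    sgn (suc (size a) * suc (size a)) ℚ.* sgnP s
      ≡⟨ cong (ℚ._* sgnP s) (sgn-square-index (suc (size a))) ⟩
    (ℚ.- sgn (size a)) ℚ.* sgnP s ∎
    where
    open ≡-Reasoning
    m : ℕ
    m = occ 0 a + sizeP s * suc (size a)

-- Duplicate-free lists of trees and palindromes by size.

module Enumeration where
  open Trees
  open import Data.Bool using (true; false; if_then_else_)
  open import Data.Empty using (⊥)
  open import Data.List using (List; []; _∷_; _++_; map; concat; concatMap; cartesianProductWith; upTo)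
  open import Data.List.Properties using (map-cong-local)
  open import Data.List.Membership.Propositional using (_∈_; find; lose)
  open import Data.List.Membership.Propositional.Properties
  open import Data.List.Relation.Unary.All as All using (All; []; _∷_)
  import Data.List.Relation.Unary.All.Properties as All
  open import Data.List.Relation.Unary.AllPairs using ([]; _∷_)
  open import Data.List.Relation.Unary.Any using (here)
  open import Data.List.Relation.Unary.Unique.Propositional using (Unique)
  import Data.List.Relation.Unary.Unique.Propositional.Properties as Unique
  open import Data.Nat as ℕ using (ℕ; zero; suc; _∸_; _≤_; _<_; s≤s)
  import Data.Nat.Properties as ℕ
  open import Data.Nat.DivMod using (+-distrib-/-∣ˡ)
  open import Data.Nat.Divisibility using (∣-refl)
  open import Data.Product using (_×_; _,_; ∃)
  open import Data.Sum using (inj₁; inj₂)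
  open import Function using (_∘_)
  open import Relation.Binary.PropositionalEquality

  double-/2 : ∀ n → (n ℕ.+ n) ℕ./ 2 ≡ n
  double-/2 zero = refl
  double-/2 (suc n) rewrite ℕ.+-suc n n | +-distrib-/-∣ˡ {2} (n ℕ.+ n) {2} ∣-refl = cong suc (double-/2 n)

  double-even : ∀ n → isEven (n ℕ.+ n) ≡ true
  double-even zero = refl
  double-even (suc n) rewrite ℕ.+-suc n n = double-even n

  even-/2 : ∀ n → isEven n ≡ true → n ℕ./ 2 ℕ.+ n ℕ./ 2 ≡ n
  even-/2 zero _ = refl
  even-/2 (suc (suc n)) even rewrite +-distrib-/-∣ˡ {2} n {2} ∣-refl | ℕ.+-suc (n ℕ./ 2) (n ℕ./ 2) =
    cong (suc ∘ suc) (even-/2 n even)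

  concatMap-∈ : ∀ {A B : Set} xs (f : B → List A) {a} → a ∈ concatMap f xs → ∃ λ x → x ∈ xs × a ∈ f x
  concatMap-∈ xs f a∈ = find (∈-concatMap⁻ f {xs} a∈)

  -- In the uses the index is read off from an element: the size of a left subtree, the joint size
  -- of the outer blocks, or the first entry of a vector.
  concatMap-unique : ∀ {A B : Set} (f : B → List A) {xs} → Unique xs → (∀ x → Unique (f x)) →
                     (∀ {x x′ a} → a ∈ f x → a ∈ f x′ → x ≡ x′) → Unique (concatMap f xs)
  concatMap-unique f {[]}     []            uf same = []
  concatMap-unique f {_ ∷ xs} (x∉ ∷ unique) uf same = Unique.++⁺ (uf _) (concatMap-unique f unique uf same)
    λ { (p , q) → let _ , x′∈ , p′ = concatMap-∈ xs f q in All.lookup x∉ x′∈ (same p p′) }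

  map-upTo-cong : ∀ {A : Set} {f g : ℕ → A} n → (∀ {i} → i < n → f i ≡ g i) → map f (upTo n) ≡ map g (upTo n)
  map-upTo-cong n eq = map-cong-local (All.applyUpTo⁺₁ (λ i → i) n eq)

  -- The first argument is fuel that makes the recursion structural; by `treesWithin-stable` any
  -- amount not below the size gives the same list.
  treesWithin : ℕ → ℕ → List Tree
  treesWithin f       zero    = leaf ∷ []
  treesWithin zero    (suc n) = []
  treesWithin (suc f) (suc n) =
    concatMap (λ i → cartesianProductWith node (treesWithin f i) (treesWithin f (n ∸ i))) (upTo (suc n))

  trees : ℕ → List Tree
  trees n = treesWithin n n

  treesWithin-stable : ∀ f f′ n → n ≤ f → n ≤ f′ → treesWithin f n ≡ treesWithin f′ n
  treesWithin-stable f f′ zero _ _ = refl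
  treesWithin-stable (suc f) (suc f′) (suc n) (s≤s n≤f) (s≤s n≤f′) =
    cong concat (map-upTo-cong (suc n) λ { {i} (s≤s i≤n) →
      cong₂ (cartesianProductWith node)
        (treesWithin-stable f f′ i (ℕ.≤-trans i≤n n≤f) (ℕ.≤-trans i≤n n≤f′))
        (treesWithin-stable f f′ (n ∸ i) (ℕ.≤-trans (ℕ.m∸n≤m n i) n≤f) (ℕ.≤-trans (ℕ.m∸n≤m n i) n≤f′)) })

  trees-suc : ∀ n → trees (suc n) ≡ concatMap (λ i → cartesianProductWith node (trees i) (trees (n ∸ i))) (upTo (suc n))
  trees-suc n = cong concat (map-upTo-cong (suc n) λ { {i} (s≤s i≤n) →
    cong₂ (cartesianProductWith node) (treesWithin-stable n i i i≤n ℕ.≤-refl)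
      (treesWithin-stable n (n ∸ i) (n ∸ i) (ℕ.m∸n≤m n i) ℕ.≤-refl) })

  ∈-treesWithin⁻ : ∀ f n {t} → t ∈ treesWithin f n → size t ≡ n
  ∈-treesWithin⁻ f zero (here refl) = refl
  ∈-treesWithin⁻ (suc f) (suc n) t∈ with concatMap-∈ (upTo (suc n)) (λ i → cartesianProductWith node (treesWithin f i) (treesWithin f (n ∸ i))) t∈
  ... | i , i∈ , p with ∈-cartesianProductWith⁻ node (treesWithin f i) (treesWithin f (n ∸ i)) p
  ...   | a , b , a∈ , b∈ , refl rewrite ∈-treesWithin⁻ f i a∈ | ∈-treesWithin⁻ f (n ∸ i) b∈ =
    cong suc (ℕ.m+[n∸m]≡n (ℕ.≤-pred (∈-upTo⁻ i∈)))

  ∈-treesWithin⁺ : ∀ f t → size t ≤ f → t ∈ treesWithin f (size t)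
  ∈-treesWithin⁺ f leaf _ = here refl
  ∈-treesWithin⁺ (suc f) (node a b) (s≤s le) = ∈-concatMap⁺ (λ i → cartesianProductWith node (treesWithin f i) (treesWithin f (size a ℕ.+ size b ∸ i))) {upTo (suc (size a ℕ.+ size b))}
    (lose (∈-upTo⁺ (s≤s (ℕ.m≤m+n (size a) (size b))))
      (∈-cartesianProductWith⁺ node (∈-treesWithin⁺ f a (ℕ.≤-trans (ℕ.m≤m+n _ _) le))
        (subst (λ m → b ∈ treesWithin f m) (sym (ℕ.m+n∸m≡n (size a) (size b))) (∈-treesWithin⁺ f b (ℕ.≤-trans (ℕ.m≤n+m _ _) le)))))

  treesWithin-unique : ∀ f n → Unique (treesWithin f n)
  treesWithin-unique f       zero    = [] ∷ []
  treesWithin-unique zero    (suc n) = []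
  treesWithin-unique (suc f) (suc n) = concatMap-unique (λ i → cartesianProductWith node (treesWithin f i) (treesWithin f (n ∸ i))) {upTo (suc n)} (Unique.upTo⁺ (suc n))
    (λ i → Unique.cartesianProductWith⁺ node node-injective (treesWithin-unique f i) (treesWithin-unique f (n ∸ i)))
    (λ {i} {j} p q → trans (sym (key i p)) (key j q))
    where
    leftSize : Tree → ℕ
    leftSize leaf       = 0
    leftSize (node a b) = size a
    key : ∀ i {t} → t ∈ cartesianProductWith node (treesWithin f i) (treesWithin f (n ∸ i)) → leftSize t ≡ i
    key i p with ∈-cartesianProductWith⁻ node (treesWithin f i) (treesWithin f (n ∸ i)) p
    ... | a , b , a∈ , _ , refl = ∈-treesWithin⁻ f i a∈

  -- Trees indexed by twice their size, because a wrapping contains `a` together with its mirror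
  -- image; on generating functions this is x ↦ x².
  doubledTrees : ℕ → List Tree
  doubledTrees n = if isEven n then trees (n ℕ./ 2) else []

  ∈-doubledTrees⁻ : ∀ n {t} → t ∈ doubledTrees n → size t ℕ.+ size t ≡ n
  ∈-doubledTrees⁻ n t∈ with isEven n in even
  ... | true rewrite ∈-treesWithin⁻ (n ℕ./ 2) (n ℕ./ 2) t∈ = even-/2 n even

  ∈-doubledTrees⁺ : ∀ t → t ∈ doubledTrees (size t ℕ.+ size t)
  ∈-doubledTrees⁺ t rewrite double-even (size t) | double-/2 (size t) = ∈-treesWithin⁺ (size t) t ℕ.≤-refl

  doubledTrees-unique : ∀ n → Unique (doubledTrees n)
  doubledTrees-unique n with isEven n
  ... | true  = treesWithin-unique (n ℕ./ 2) (n ℕ./ 2)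
  ... | false = []

  mutual
    palindromesWithin : ℕ → ℕ → List Palindrome
    palindromesWithin f       zero    = ε ∷ []
    palindromesWithin zero    (suc n) = []
    palindromesWithin (suc f) (suc n) = map fix (palindromesWithin f n) ++ wrapsWithin f n

    -- The second argument is the total size minus one, so `n` in the last clause is what remains
    -- beside the two outer roots. In `wraps` below the argument is the total size minus two.
    wrapsWithin : ℕ → ℕ → List Palindrome
    wrapsWithin f zero    = []
    wrapsWithin f (suc n) =
      concatMap (λ i → cartesianProductWith wrap (doubledTrees i) (palindromesWithin f (n ∸ i))) (upTo (suc n))

  palindromes : ℕ → List Palindrome
  palindromes n = palindromesWithin n n

  mutual
    palindromesWithin-stable : ∀ f f′ n → n ≤ f → n ≤ f′ → palindromesWithin f n ≡ palindromesWithin f′ n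
    palindromesWithin-stable f f′ zero _ _ = refl
    palindromesWithin-stable (suc f) (suc f′) (suc n) (s≤s n≤f) (s≤s n≤f′) =
      cong₂ (λ u v → map fix u ++ v) (palindromesWithin-stable f f′ n n≤f n≤f′) (wrapsWithin-stable f f′ n n≤f n≤f′)

    wrapsWithin-stable : ∀ f f′ n → n ≤ f → n ≤ f′ → wrapsWithin f n ≡ wrapsWithin f′ n
    wrapsWithin-stable f f′ zero _ _ = refl
    wrapsWithin-stable f f′ (suc n) n<f n<f′ = cong concat (map-upTo-cong (suc n) λ {i} _ →
      cong (cartesianProductWith wrap (doubledTrees i)) (palindromesWithin-stable f f′ (n ∸ i)
        (ℕ.≤-trans (ℕ.m∸n≤m n i) (ℕ.<⇒≤ n<f)) (ℕ.≤-trans (ℕ.m∸n≤m n i) (ℕ.<⇒≤ n<f′))))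

  wraps : ℕ → List Palindrome
  wraps n = concatMap (λ i → cartesianProductWith wrap (doubledTrees i) (palindromes (n ∸ i))) (upTo (suc n))

  palindromes-suc² : ∀ n → palindromes (suc (suc n)) ≡ map fix (palindromes (suc n)) ++ wraps n
  palindromes-suc² n = cong (map fix (palindromes (suc n)) ++_) (cong concat (map-upTo-cong (suc n) λ {i} _ →
    cong (cartesianProductWith wrap (doubledTrees i)) (palindromesWithin-stable (suc n) (n ∸ i) (n ∸ i)
        (ℕ.m≤n⇒m≤1+n (ℕ.m∸n≤m n i)) ℕ.≤-refl)))

  ∈-palindromesWithin⁻ : ∀ f n {s} → s ∈ palindromesWithin f n → sizeP s ≡ n
  ∈-palindromesWithin⁻ f zero (here refl) = refl
  ∈-palindromesWithin⁻ (suc f) (suc n) s∈ with ∈-++⁻ (map fix (palindromesWithin f n)) s∈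
  ... | inj₁ p with ∈-map⁻ fix p
  ...   | s , s∈′ , refl = cong suc (∈-palindromesWithin⁻ f n s∈′)
  ∈-palindromesWithin⁻ (suc f) (suc (suc n)) s∈ | inj₂ p
    with concatMap-∈ (upTo (suc n)) (λ i → cartesianProductWith wrap (doubledTrees i) (palindromesWithin f (n ∸ i))) p
  ... | i , i∈ , q with ∈-cartesianProductWith⁻ wrap (doubledTrees i) (palindromesWithin f (n ∸ i)) q
  ...   | a , s , a∈ , s∈′ , refl rewrite ∈-doubledTrees⁻ i a∈ | ∈-palindromesWithin⁻ f (n ∸ i) s∈′ =
    cong (suc ∘ suc) (ℕ.m+[n∸m]≡n (ℕ.≤-pred (∈-upTo⁻ i∈)))

  ∈-palindromesWithin⁺ : ∀ f s → sizeP s ≤ f → s ∈ palindromesWithin f (sizeP s)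
  ∈-palindromesWithin⁺ f ε _ = here refl
  ∈-palindromesWithin⁺ (suc f) (fix s) (s≤s le) = ∈-++⁺ˡ (∈-map⁺ fix (∈-palindromesWithin⁺ f s le))
  ∈-palindromesWithin⁺ (suc f) (wrap a s) (s≤s le) = ∈-++⁺ʳ (map fix (palindromesWithin f (suc n)))
    (∈-concatMap⁺ (λ i → cartesianProductWith wrap (doubledTrees i) (palindromesWithin f (n ∸ i))) {upTo (suc n)}
      (lose (∈-upTo⁺ (s≤s (ℕ.m≤m+n (size a ℕ.+ size a) (sizeP s))))
        (∈-cartesianProductWith⁺ wrap (∈-doubledTrees⁺ a)
          (subst (λ m → s ∈ palindromesWithin f m) (sym (ℕ.m+n∸m≡n (size a ℕ.+ size a) (sizeP s)))
            (∈-palindromesWithin⁺ f s (ℕ.≤-trans (ℕ.m≤n+m _ _) (ℕ.<⇒≤ le)))))))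
    where
    n : ℕ
    n = size a ℕ.+ size a ℕ.+ sizeP s

  fix-injective : ∀ {s s′} → fix s ≡ fix s′ → s ≡ s′
  fix-injective refl = refl

  wrap-injective : ∀ {a b s s′} → wrap a s ≡ wrap b s′ → a ≡ b × s ≡ s′
  wrap-injective refl = refl , refl

  mutual
    palindromesWithin-unique : ∀ f n → Unique (palindromesWithin f n)
    palindromesWithin-unique f       zero    = [] ∷ []
    palindromesWithin-unique zero    (suc n) = []
    palindromesWithin-unique (suc f) (suc n) = Unique.++⁺ (Unique.map⁺ fix-injective (palindromesWithin-unique f n))
      (wrapsWithin-unique f n) (λ { (p , q) → fix≢wrap (∈-map⁻ fix p) n q })
      where
      fix≢wrap : ∀ {s} {xs : List Palindrome} → (∃ λ s′ → s′ ∈ xs × s ≡ fix s′) → ∀ n → s ∈ wrapsWithin f n → ⊥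
      fix≢wrap (_ , _ , refl) (suc n) q with concatMap-∈ (upTo (suc n)) (λ i → cartesianProductWith wrap (doubledTrees i) (palindromesWithin f (n ∸ i))) q
      ... | i , _ , r with ∈-cartesianProductWith⁻ wrap (doubledTrees i) (palindromesWithin f (n ∸ i)) r
      ...   | _ , _ , _ , _ , ()

    wrapsWithin-unique : ∀ f n → Unique (wrapsWithin f n)
    wrapsWithin-unique f zero    = []
    wrapsWithin-unique f (suc n) = concatMap-unique (λ i → cartesianProductWith wrap (doubledTrees i) (palindromesWithin f (n ∸ i))) {upTo (suc n)} (Unique.upTo⁺ (suc n))
      (λ i → Unique.cartesianProductWith⁺ wrap wrap-injective (doubledTrees-unique i) (palindromesWithin-unique f (n ∸ i)))
      (λ {i} {j} p q → trans (sym (key i p)) (key j q))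
      where
      outerSize : Palindrome → ℕ
      outerSize (wrap a s) = size a ℕ.+ size a
      outerSize _          = 0
      key : ∀ i {s} → s ∈ cartesianProductWith wrap (doubledTrees i) (palindromesWithin f (n ∸ i)) → outerSize s ≡ i
      key i p with ∈-cartesianProductWith⁻ wrap (doubledTrees i) (palindromesWithin f (n ∸ i)) p
      ... | a , _ , a∈ , _ , refl = ∈-doubledTrees⁻ i a∈

-- Weighted generating functions of trees and palindromes.

module GeneratingFunctions where
  open PowerSeries
  open RingIdentities
  open Trees
  open Parity
  open ChebyshevSeries
  open Enumeration
  open Solution using (half-sum-rhs)
  open import Algebra.Bundles using (CommutativeRing)
  open CommutativeRing seriesRing using (*-identityʳ; zeroʳ; ring)
  open import Data.Bool using (Bool; true; false; _∧_; if_then_else_)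
  open import Data.List using (List; []; _∷_; _++_; map; concatMap; cartesianProductWith; upTo)
  open import Data.List.Properties using (map-∘; map-cong; map-cong-local)
  import Data.List.Relation.Unary.All as All
  open import Data.Nat as ℕ using (ℕ; zero; suc; _∸_; _≡ᵇ_)
  open import Data.Rational using (ℚ; 0ℚ; 1ℚ; ½; _+_; _*_; -_; _-_)
  open import Data.Rational.Properties hiding (*-identityʳ)
  open import Data.Rational.Solver using (module +-*-Solver)
  open import Function using (_∘_)
  open import Relation.Binary.PropositionalEquality
  open +-*-Solver using (solve; _:=_; _:+_; _:*_; :-_; con)

  wsum : ∀ {A : Set} → (A → ℚ) → List A → ℚ
  wsum g xs = sumℚ (map g xs)

  module _ {A : Set} where
    wsum-++ : ∀ (g : A → ℚ) xs ys → wsum g (xs ++ ys) ≡ wsum g xs + wsum g ys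
    wsum-++ g []       ys = sym (+-identityˡ _)
    wsum-++ g (x ∷ xs) ys = trans (cong (g x +_) (wsum-++ g xs ys)) (sym (+-assoc (g x) _ _))

    wsum-map : ∀ {B : Set} (g : A → ℚ) (f : B → A) xs → wsum g (map f xs) ≡ wsum (g ∘ f) xs
    wsum-map g f xs = cong sumℚ (sym (map-∘ xs))

    wsum-cong : ∀ {g h : A → ℚ} → (∀ x → g x ≡ h x) → ∀ xs → wsum g xs ≡ wsum h xs
    wsum-cong eq xs = cong sumℚ (map-cong eq xs)

    wsum-scale : ∀ c (g : A → ℚ) xs → wsum (λ x → c * g x) xs ≡ c * wsum g xs
    wsum-scale c g []       = sym (*-zeroʳ c)
    wsum-scale c g (x ∷ xs) = trans (cong (c * g x +_) (wsum-scale c g xs)) (sym (*-distribˡ-+ c (g x) (wsum g xs)))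

    wsum-+ : ∀ (g h : A → ℚ) xs → wsum (λ x → g x + h x) xs ≡ wsum g xs + wsum h xs
    wsum-+ g h []       = refl
    wsum-+ g h (x ∷ xs) = trans (cong (g x + h x +_) (wsum-+ g h xs))
      (solve 4 (λ p q r s → p :+ q :+ (r :+ s) := p :+ r :+ (q :+ s)) refl (g x) (h x) (wsum g xs) (wsum h xs))

    wsum-concatMap : ∀ {B : Set} (g : A → ℚ) (f : B → List A) xs → wsum g (concatMap f xs) ≡ sumℚ (map (λ x → wsum g (f x)) xs)
    wsum-concatMap g f []       = refl
    wsum-concatMap g f (x ∷ xs) = trans (wsum-++ g (f x) (concatMap f xs)) (cong (wsum g (f x) +_) (wsum-concatMap g f xs))

  wsum-cartesianProductWith : ∀ {A B C : Set} (g : A → ℚ) (f : B → C → A) (g₁ : B → ℚ) (g₂ : C → ℚ) →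
    (∀ b c → g (f b c) ≡ g₁ b * g₂ c) → ∀ xs ys → wsum g (cartesianProductWith f xs ys) ≡ wsum g₁ xs * wsum g₂ ys
  wsum-cartesianProductWith g f g₁ g₂ eq []       ys = sym (*-zeroˡ (wsum g₂ ys))
  wsum-cartesianProductWith g f g₁ g₂ eq (x ∷ xs) ys = begin
    wsum g (map (f x) ys ++ cartesianProductWith f xs ys)
      ≡⟨ wsum-++ g (map (f x) ys) _ ⟩
    wsum g (map (f x) ys) + wsum g (cartesianProductWith f xs ys)
      ≡⟨ cong₂ _+_ (trans (wsum-map g (f x) ys) (trans (wsum-cong (eq x) ys) (wsum-scale (g₁ x) g₂ ys)))
                   (wsum-cartesianProductWith g f g₁ g₂ eq xs ys) ⟩
    g₁ x * wsum g₂ ys + wsum g₁ xs * wsum g₂ ys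
      ≡⟨ sym (*-distribʳ-+ (wsum g₂ ys) (g₁ x) (wsum g₁ xs)) ⟩
    (g₁ x + wsum g₁ xs) * wsum g₂ ys ∎
    where open ≡-Reasoning

  treeSeries : (Tree → ℚ) → Series
  treeSeries g n = wsum g (trees n)

  palindromeSeries : (Palindrome → ℚ) → Series
  palindromeSeries g n = wsum g (palindromes n)

  -- The sizes of the two subtrees add up, so a weight that factors at the root gives a convolution;
  -- `X` accounts for the root.
  treeSeries-node : ∀ g g₁ g₂ → (∀ a b → g (node a b) ≡ g₁ a * g₂ b) →
                    treeSeries g ≈ scale (g leaf) oneS ⊕ (X ⊛ (treeSeries g₁ ⊛ treeSeries g₂))
  treeSeries-node g g₁ g₂ eq zero = cong₂ _+_ (sym (ℚ.*-identityʳ (g leaf))) (sym (X⊛-zero (treeSeries g₁ ⊛ treeSeries g₂)))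
    where import Data.Rational.Properties as ℚ
  treeSeries-node g g₁ g₂ eq (suc n) = begin
    wsum g (trees (suc n))
      ≡⟨ cong (wsum g) (trees-suc n) ⟩
    wsum g (concatMap (λ i → cartesianProductWith node (trees i) (trees (n ∸ i))) (upTo (suc n)))
      ≡⟨ wsum-concatMap g (λ i → cartesianProductWith node (trees i) (trees (n ∸ i))) (upTo (suc n)) ⟩
    sumℚ (map (λ i → wsum g (cartesianProductWith node (trees i) (trees (n ∸ i)))) (upTo (suc n)))
      ≡⟨ cong sumℚ (map-cong (λ i → wsum-cartesianProductWith g node g₁ g₂ eq (trees i) (trees (n ∸ i))) (upTo (suc n))) ⟩
    (treeSeries g₁ ⊛ treeSeries g₂) n
      ≡⟨ sym (trans (cong₂ _+_ (*-zeroʳ (g leaf)) (X⊛-suc (treeSeries g₁ ⊛ treeSeries g₂) n)) (+-identityˡ _)) ⟩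
    g leaf * 0ℚ + (X ⊛ (treeSeries g₁ ⊛ treeSeries g₂)) (suc n) ∎
    where open ≡-Reasoning

  wsum-doubledTrees : ∀ g n → wsum g (doubledTrees n) ≡ sqX (treeSeries g) n
  wsum-doubledTrees g n with isEven n
  ... | true  = refl
  ... | false = refl

  -- The factor `y` accounts for the two outer roots of a wrapping, and `sqX` for the two copies of
  -- `a`.
  palindromeSeries-fix-wrap : ∀ g g₁ g₂ → (∀ a s → g (wrap a s) ≡ g₁ a * g₂ s) →
    palindromeSeries g ≈ (scale (g ε) oneS ⊕ (X ⊛ palindromeSeries (g ∘ fix))) ⊕ (y ⊛ (sqX (treeSeries g₁) ⊛ palindromeSeries g₂))
  palindromeSeries-fix-wrap g g₁ g₂ eq = λ
    { zero → sym (trans (cong₂ _+_ (cong₂ _+_ (ℚ.*-identityʳ (g ε)) (X⊛-zero F)) (trans (⊛-assoc X X W 0) (X⊛-zero (X ⊛ W)))) (+-identityʳ (g ε + 0ℚ)))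
    -- Wrappings start at size 2, so their part of the list is empty here.
    ; (suc zero) → begin
        wsum g (map fix (palindromes 0) ++ [])
          ≡⟨ solve 1 (λ p → p := con 0ℚ :+ p :+ con 0ℚ) refl _ ⟩
        0ℚ + F 0 + 0ℚ
          ≡⟨ sym (cong₂ _+_ (cong₂ _+_ (*-zeroʳ (g ε)) (X⊛-suc F 0)) (trans (⊛-assoc X X W 1) (trans (X⊛-suc (X ⊛ W) 0) (X⊛-zero W)))) ⟩
        rhs 1 ∎
    ; (suc (suc n)) → begin
        wsum g (palindromes (suc (suc n)))
          ≡⟨ cong (wsum g) (palindromes-suc² n) ⟩
        wsum g (map fix (palindromes (suc n)) ++ wraps n)
          ≡⟨ wsum-++ g (map fix (palindromes (suc n))) (wraps n) ⟩
        wsum g (map fix (palindromes (suc n))) + wsum g (wraps n)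
          ≡⟨ cong₂ _+_ (wsum-map g fix (palindromes (suc n))) (wsum-concatMap g (branch n) (upTo (suc n))) ⟩
        F (suc n) + sumℚ (map (λ i → wsum g (branch n i)) (upTo (suc n)))
          ≡⟨ cong (λ l → F (suc n) + sumℚ l) (map-cong (λ i → trans
               (wsum-cartesianProductWith g wrap g₁ g₂ eq (doubledTrees i) (palindromes (n ∸ i)))
               (cong (_* palindromeSeries g₂ (n ∸ i)) (wsum-doubledTrees g₁ i))) (upTo (suc n))) ⟩
        F (suc n) + W n
          ≡⟨ cong (_+ W n) (sym (+-identityˡ (F (suc n)))) ⟩
        0ℚ + F (suc n) + W n
          ≡⟨ sym (cong₂ _+_ (cong₂ _+_ (*-zeroʳ (g ε)) (X⊛-suc F (suc n)))
               (trans (⊛-assoc X X W (suc (suc n))) (trans (X⊛-suc (X ⊛ W) (suc n)) (X⊛-suc W n)))) ⟩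
        rhs (suc (suc n)) ∎
    }
    where
    open ≡-Reasoning
    import Data.Rational.Properties as ℚ
    F W rhs : Series
    F = palindromeSeries (g ∘ fix)
    W = sqX (treeSeries g₁) ⊛ palindromeSeries g₂
    rhs = (scale (g ε) oneS ⊕ (X ⊛ F)) ⊕ (y ⊛ W)
    branch : ℕ → ℕ → List Palindrome
    branch n i = cartesianProductWith wrap (doubledTrees i) (palindromes (n ∸ i))

  ind : Bool → ℚ
  ind b = if b then 1ℚ else 0ℚ

  ind-∧ : ∀ b c → ind (b ∧ c) ≡ ind b * ind c
  ind-∧ true  c = sym (*-identityˡ (ind c))
  ind-∧ false c = sym (*-zeroˡ (ind c))

  -- The equation says that b (1 - c) = 1, and 1 - c has constant term 1, so the solution is unique.
  -- This is how a counting series is recognised as R.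
  fixpoint-inverse : ∀ c b → b ≈ oneS ⊕ (c ⊛ b) → c 0 ≡ 0ℚ → b ≈ inv1 (oneS ⊖ c)
  fixpoint-inverse c b eq c₀≡0 n = trans
    (divide-right seriesRing {b} {oneS} {oneS ⊖ c} {inv1 (oneS ⊖ c)} (inv1-inverse (oneS ⊖ c) (cong (λ u → 1ℚ - u) c₀≡0)) product n)
    (⊛-identityˡ (inv1 (oneS ⊖ c)) n)
    where
    open import Algebra.Properties.Ring ring using (-‿distribʳ-*)
    open CommutativeRing seriesRing using (distribˡ)
    product : b ⊛ (oneS ⊖ c) ≈ oneS
    product n = begin
      (b ⊛ (oneS ⊖ c)) n                ≡⟨ distribˡ b oneS (⊝ c) n ⟩
      (b ⊛ oneS) n + (b ⊛ (⊝ c)) n      ≡⟨ cong₂ _+_ (*-identityʳ b n) (sym (-‿distribʳ-* b c n)) ⟩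
      b n - (b ⊛ c) n                   ≡⟨ cong₂ _-_ (eq n) (⊛-comm b c n) ⟩
      oneS n + (c ⊛ b) n - (c ⊛ b) n    ≡⟨ solve 2 (λ p q → p :+ q :+ (:- q) := p) refl (oneS n) ((c ⊛ b) n) ⟩
      oneS n                            ∎
      where open ≡-Reasoning

  treeSeries-isLeaf : treeSeries (ind ∘ isLeaf) ≈ oneS
  treeSeries-isLeaf n = begin
    treeSeries (ind ∘ isLeaf) n
      -- The indicator is 0 on every node, which is written as the product of two zero weights.
      ≡⟨ treeSeries-node (ind ∘ isLeaf) (λ _ → 0ℚ) (λ _ → 0ℚ) (λ _ _ → refl) n ⟩
    1ℚ * oneS n + (X ⊛ (zeros ⊛ zeros)) n
      ≡⟨ cong₂ _+_ (*-identityˡ (oneS n)) (trans (⊛-congˡ X {zeros ⊛ zeros} {zeroS} product n) (zeroʳ X n)) ⟩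
    oneS n + 0ℚ
      ≡⟨ +-identityʳ (oneS n) ⟩
    oneS n ∎
    where
    open ≡-Reasoning
    zeros : Series
    zeros = treeSeries (λ _ → 0ℚ)
    zeros≈0 : zeros ≈ zeroS
    zeros≈0 n = trans (wsum-scale 0ℚ (λ _ → 0ℚ) (trees n)) (*-zeroˡ (wsum (λ _ → 0ℚ) (trees n)))
    product : zeros ⊛ zeros ≈ zeroS
    product n = trans (⊛-congˡ zeros {zeros} {zeroS} zeros≈0 n) (zeroʳ zeros n)

  -- Splitting at the root gives A = 1 + x R A, where R counts the avoiders one level lower. At
  -- level 0 the right subtree must be empty, and its series 1 is `R 1`.
  avoiders-R : ∀ l → treeSeries (ind ∘ avoids l) ≈ R (suc (suc l))
  avoiders-R l = fixpoint-inverse (X ⊛ R (suc l)) A (recurrence l) (X⊛-zero (R (suc l)))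
    where
    open ≡-Reasoning
    A : Series
    A = treeSeries (ind ∘ avoids l)
    finish : ∀ l (b : Series) → treeSeries (ind ∘ avoids l) ≈ scale 1ℚ oneS ⊕ (X ⊛ b) →
             b ≈ R (suc l) ⊛ treeSeries (ind ∘ avoids l) →
             treeSeries (ind ∘ avoids l) ≈ oneS ⊕ ((X ⊛ R (suc l)) ⊛ treeSeries (ind ∘ avoids l))
    finish l b eq eq′ n = trans (eq n) (cong₂ _+_ (*-identityˡ (oneS n))
      (trans (⊛-congˡ X {b} {R (suc l) ⊛ T} eq′ n) (sym (⊛-assoc X (R (suc l)) T n))))
      where
      T : Series
      T = treeSeries (ind ∘ avoids l)
    recurrence : ∀ l → treeSeries (ind ∘ avoids l) ≈ oneS ⊕ ((X ⊛ R (suc l)) ⊛ treeSeries (ind ∘ avoids l))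
    recurrence zero = finish 0 (T ⊛ L)
      (treeSeries-node (ind ∘ avoids 0) (ind ∘ avoids 0) (ind ∘ isLeaf)
        (λ a b → trans (cong ind (avoids-zero-node a b)) (ind-∧ (avoids 0 a) (isLeaf b))))
      (λ n → trans (⊛-comm T L n) (⊛-congʳ {L} {oneS} T treeSeries-isLeaf n))
      where
      T L : Series
      T = treeSeries (ind ∘ avoids 0)
      L = treeSeries (ind ∘ isLeaf)
    recurrence (suc l) = finish (suc l) (treeSeries (ind ∘ avoids l) ⊛ T)
      (treeSeries-node (ind ∘ avoids (suc l)) (ind ∘ avoids l) (ind ∘ avoids (suc l))
        (λ a b → trans (cong ind (avoids-suc-node l a b)) (ind-∧ (avoids l a) (avoids (suc l) b))))
      (⊛-congʳ {treeSeries (ind ∘ avoids l)} {R (suc (suc l))} T (avoiders-R l))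
      where
      T : Series
      T = treeSeries (ind ∘ avoids (suc l))

  hitSeries signedHitSeries : ℕ → Series
  hitSeries       l = palindromeSeries (λ s → ind (hits l (toTree s)))
  signedHitSeries l = palindromeSeries (λ s → sgnP s * ind (hits l (toTree s)))

  palindromeSeries-recurrence : ∀ g g₁ g₂ {F A} → (∀ a s → g (wrap a s) ≡ g₁ a * g₂ s) → g ε ≡ 0ℚ →
    palindromeSeries (g ∘ fix) ≈ F → sqX (treeSeries g₁) ≈ A →
    palindromeSeries g ≈ (X ⊛ F) ⊕ ((y ⊛ A) ⊛ palindromeSeries g₂)
  palindromeSeries-recurrence g g₁ g₂ {F} {A} eq gε≡0 F≈ A≈ n = begin
    P n
      ≡⟨ palindromeSeries-fix-wrap g g₁ g₂ eq n ⟩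
    g ε * oneS n + (X ⊛ F′) n + (y ⊛ (A′ ⊛ P₂)) n
      ≡⟨ cong₂ _+_ (cong₂ _+_ (trans (cong (_* oneS n) gε≡0) (*-zeroˡ (oneS n))) (⊛-congˡ X {F′} {F} F≈ n))
           (trans (sym (⊛-assoc y A′ P₂ n)) (⊛-congʳ {y ⊛ A′} {y ⊛ A} P₂ (⊛-congˡ y {A′} {A} A≈) n)) ⟩
    0ℚ + (X ⊛ F) n + ((y ⊛ A) ⊛ P₂) n
      ≡⟨ cong (_+ ((y ⊛ A) ⊛ P₂) n) (+-identityˡ ((X ⊛ F) n)) ⟩
    (X ⊛ F) n + ((y ⊛ A) ⊛ P₂) n ∎
    where
    open ≡-Reasoning
    P P₂ F′ A′ : Series
    P  = palindromeSeries g
    P₂ = palindromeSeries g₂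
    F′ = palindromeSeries (g ∘ fix)
    A′ = sqX (treeSeries g₁)

  palindromeSeries-zero : ∀ g → (∀ s → g s ≡ 0ℚ) → palindromeSeries g ≈ zeroS
  palindromeSeries-zero g eq n = trans (wsum-cong (λ s → trans (eq s) (sym (*-zeroˡ 0ℚ))) (palindromes n))
    (trans (wsum-scale 0ℚ (λ _ → 0ℚ) (palindromes n)) (*-zeroˡ (wsum (λ _ → 0ℚ) (palindromes n))))

  palindromeSeries-isε : palindromeSeries (ind ∘ isε) ≈ oneS
  palindromeSeries-isε n = begin
    palindromeSeries (ind ∘ isε) n
      ≡⟨ palindromeSeries-fix-wrap (ind ∘ isε) (λ _ → 0ℚ) (λ _ → 0ℚ) (λ _ _ → refl) n ⟩
    1ℚ * oneS n + (X ⊛ Z) n + (y ⊛ (T ⊛ Z)) n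
      ≡⟨ cong₂ _+_ (cong₂ _+_ (*-identityˡ (oneS n)) (trans (⊛-congˡ X {Z} {zeroS} Z≈0 n) (zeroʳ X n)))
           (trans (⊛-congˡ y {T ⊛ Z} {zeroS} (λ m → trans (⊛-congˡ T {Z} {zeroS} Z≈0 m) (zeroʳ T m)) n) (zeroʳ y n)) ⟩
    oneS n + 0ℚ + 0ℚ
      ≡⟨ solve 1 (λ p → p :+ con 0ℚ :+ con 0ℚ := p) refl (oneS n) ⟩
    oneS n ∎
    where
    open ≡-Reasoning
    Z T : Series
    Z = palindromeSeries (λ _ → 0ℚ)
    T = sqX (treeSeries (λ _ → 0ℚ))
    Z≈0 : Z ≈ zeroS
    Z≈0 = palindromeSeries-zero (λ _ → 0ℚ) (λ _ → refl)

  hitSeries-zero : hitSeries 0 ≈ y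
  hitSeries-zero n = begin
    hitSeries 0 n
      ≡⟨ palindromeSeries-recurrence (λ s → ind (hits 0 (toTree s))) (ind ∘ isLeaf) (ind ∘ isε) {zeroS} {oneS}
           (λ a s → trans (cong ind (hits-zero-wrap a s)) (ind-∧ (isLeaf a) (isε s))) refl
           (palindromeSeries-zero (λ s → ind (hits 0 (toTree (fix s)))) (λ s → cong ind (hits-zero-fix s)))
           (λ m → trans (sqX-cong {treeSeries (ind ∘ isLeaf)} {oneS} treeSeries-isLeaf m) (sqX-one m)) n ⟩
    (X ⊛ zeroS) n + ((y ⊛ oneS) ⊛ E) n
      ≡⟨ cong₂ _+_ (zeroʳ X n) (⊛-cong {y ⊛ oneS} {y} {E} {oneS} (*-identityʳ y) palindromeSeries-isε n) ⟩
    0ℚ + (y ⊛ oneS) n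
      ≡⟨ trans (+-identityˡ _) (*-identityʳ y n) ⟩
    y n ∎
    where
    open ≡-Reasoning
    E : Series
    E = palindromeSeries (ind ∘ isε)

  hitSeries-suc : ∀ l → hitSeries (suc l) ≈ (X ⊛ hitSeries l) ⊕ ((y ⊛ R⁺ (suc (suc l))) ⊛ hitSeries (suc l))
  hitSeries-suc l = palindromeSeries-recurrence g (ind ∘ avoids l) g
    (λ a s → trans (cong ind (hits-suc-wrap l a s)) (ind-∧ (avoids l a) (hits (suc l) (toTree s)))) refl
    (λ n → wsum-cong (λ s → cong ind (hits-suc-fix l s)) (palindromes n))
    (sqX-cong {treeSeries (ind ∘ avoids l)} {R (suc (suc l))} (avoiders-R l))
    where
    g : Palindrome → ℚ
    g s = ind (hits (suc l) (toTree s))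

  -- The sign is constant on trees of one size, so it amounts to x ↦ -x. The additional minus is the
  -- 1 in the exponent |a| + 1.
  treeSeries-sgn : ∀ g → treeSeries (λ a → (- sgn (size a)) * g a) ≈ ⊝ negX (treeSeries g)
  treeSeries-sgn g n = begin
    wsum (λ a → (- sgn (size a)) * g a) (trees n)
      ≡⟨ cong sumℚ (map-cong-local (All.tabulate (λ {a} a∈ → cong (λ m → (- sgn m) * g a) (∈-treesWithin⁻ n n a∈)))) ⟩
    wsum (λ a → (- sgn n) * g a) (trees n)
      ≡⟨ wsum-scale (- sgn n) g (trees n) ⟩
    (- sgn n) * treeSeries g n
      ≡⟨ sym (neg-distribˡ-* (sgn n) (treeSeries g n)) ⟩
    - (sgn n * treeSeries g n)
      ≡⟨ cong -_ (sym (negX-sgn (treeSeries g) n)) ⟩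
    - negX (treeSeries g) n ∎
    where open ≡-Reasoning

  sqX-⊝ : ∀ a → sqX (⊝ a) ≈ ⊝ sqX a
  sqX-⊝ a n with isEven n
  ... | true  = refl
  ... | false = refl

  -- The sign turns the wrapping term into -y R(-y) D. Moved to the other side, it produces the
  -- factor 1 + y R(-y), which `R⁻-inverse` cancels.
  signedHitSeries-suc : ∀ l → signedHitSeries (suc l) ⊕ ((y ⊛ R⁻ (suc (suc l))) ⊛ signedHitSeries (suc l)) ≈ X ⊛ signedHitSeries l
  signedHitSeries-suc l n = begin
    D n + ((y ⊛ B) ⊛ D) n
      ≡⟨ cong (_+ ((y ⊛ B) ⊛ D) n) (recurrence n) ⟩
    (X ⊛ signedHitSeries l) n + ((y ⊛ (⊝ B)) ⊛ D) n + ((y ⊛ B) ⊛ D) n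
      ≡⟨ cong (λ u → (X ⊛ signedHitSeries l) n + u + ((y ⊛ B) ⊛ D) n)
           (trans (⊛-congʳ {y ⊛ (⊝ B)} {⊝ (y ⊛ B)} D (λ m → sym (-‿distribʳ-* y B m)) n) (sym (-‿distribˡ-* (y ⊛ B) D n))) ⟩
    (X ⊛ signedHitSeries l) n + (- ((y ⊛ B) ⊛ D) n) + ((y ⊛ B) ⊛ D) n
      ≡⟨ solve 2 (λ p q → p :+ (:- q) :+ q := p) refl ((X ⊛ signedHitSeries l) n) (((y ⊛ B) ⊛ D) n) ⟩
    (X ⊛ signedHitSeries l) n ∎
    where
    open ≡-Reasoning
    open import Algebra.Properties.Ring ring using (-‿distribʳ-*; -‿distribˡ-*)
    B D : Series
    B = R⁻ (suc (suc l))
    D = signedHitSeries (suc l)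
    A : Series
    A = treeSeries (ind ∘ avoids l)
    g : Palindrome → ℚ
    g s = sgnP s * ind (hits (suc l) (toTree s))
    g₁ : Tree → ℚ
    g₁ a = (- sgn (size a)) * ind (avoids l a)
    g-wrap : ∀ a s → g (wrap a s) ≡ g₁ a * g s
    g-wrap a s = trans (cong₂ _*_ (sgnP-wrap a s) (trans (cong ind (hits-suc-wrap l a s)) (ind-∧ (avoids l a) (hits (suc l) (toTree s)))))
      (solve 4 (λ p q r t → p :* q :* (r :* t) := p :* r :* (q :* t)) refl
        (- sgn (size a)) (sgnP s) (ind (avoids l a)) (ind (hits (suc l) (toTree s))))
    weights : sqX (treeSeries g₁) ≈ ⊝ B
    weights n = trans (sqX-cong {treeSeries g₁} {⊝ negX A} (treeSeries-sgn (ind ∘ avoids l)) n)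
      (trans (sqX-⊝ (negX A) n) (cong -_ (sqX-cong {negX A} {negX (R (suc (suc l)))}
        (negX-cong {A} {R (suc (suc l))} (avoiders-R l)) n)))
    recurrence : D ≈ (X ⊛ signedHitSeries l) ⊕ ((y ⊛ (⊝ B)) ⊛ D)
    recurrence = palindromeSeries-recurrence g g₁ g g-wrap refl
      (λ n → wsum-cong (λ s → cong₂ _*_ (sgnP-fix s) (cong ind (hits-suc-fix l s))) (palindromes n)) weights

  -- One inversion means sign -1, so the plain and the signed indicator cancel.
  signed-hit-zero : ∀ s → ind (hits 0 (toTree s)) + sgnP s * ind (hits 0 (toTree s)) ≡ 0ℚ
  signed-hit-zero s with occ 0 (toTree s)
  ... | zero        = refl
  ... | suc (suc n) = trans (+-identityˡ _) (*-zeroʳ (- (- sgn n)))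
  ... | suc zero    = solve 1 (λ p → p :+ con (- 1ℚ) :* p := con 0ℚ) refl (ind (occ 1 (toTree s) ≡ᵇ 0))

  hitSeries-signed-zero : hitSeries 0 ⊕ signedHitSeries 0 ≈ zeroS
  hitSeries-signed-zero n = trans
    (sym (wsum-+ (λ s → ind (hits 0 (toTree s))) (λ s → sgnP s * ind (hits 0 (toTree s))) (palindromes n)))
    (palindromeSeries-zero (λ s → ind (hits 0 (toTree s)) + sgnP s * ind (hits 0 (toTree s))) signed-hit-zero n)

  evenHit : ℕ → Tree → Bool
  evenHit l t = isEven (occ 0 t) ∧ (occ l t ≡ᵇ 1)

  even-indicator : ∀ n b → ind (isEven n ∧ b) ≡ ½ * (ind b + sgn n * ind b)
  even-indicator zero          true  = refl
  even-indicator zero          false = refl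
  even-indicator (suc zero)    true  = refl
  even-indicator (suc zero)    false = refl
  even-indicator (suc (suc n)) b     = trans (even-indicator n b)
    (solve 2 (λ s p → con ½ :* (p :+ s :* p) := con ½ :* (p :+ (:- (:- s)) :* p)) refl (sgn n) (ind b))

  -- For l = 0 the condition on 213 in `hits` has no counterpart on the left, but both sides vanish
  -- because a single inversion is odd. For larger l, `hits-suc` removes that second condition.
  evenHit-half : ∀ l s → ind (evenHit l (toTree s)) ≡
                 ½ * (ind (hits l (toTree s)) + sgnP s * ind (hits l (toTree s)))
  evenHit-half zero s = trans (odd (occ 0 (toTree s))) (sym (cong (½ *_) (signed-hit-zero s)))
    where
    odd : ∀ n → ind (isEven n ∧ (n ≡ᵇ 1)) ≡ 0ℚ
    odd zero          = refl
    odd (suc zero)    = refl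
    odd (suc (suc n)) with isEven n
    ... | true  = refl
    ... | false = refl
  evenHit-half (suc l) s rewrite hits-suc l (toTree s) = even-indicator (occ 0 (toTree s)) (occ (suc l) (toTree s) ≡ᵇ 1)

  palindrome-count : ∀ l n → wsum (λ s → ind (evenHit l (toTree s))) (palindromes n) ≡ rhs313 (suc (suc l)) n
  palindrome-count l n = begin
    wsum (λ s → ind (evenHit l (toTree s))) (palindromes n)
      ≡⟨ wsum-cong (evenHit-half l) (palindromes n) ⟩
    wsum (λ s → ½ * (h s + sgnP s * h s)) (palindromes n)
      ≡⟨ wsum-scale ½ (λ s → h s + sgnP s * h s) (palindromes n) ⟩
    ½ * wsum (λ s → h s + sgnP s * h s) (palindromes n)
      ≡⟨ cong (½ *_) (wsum-+ h (λ s → sgnP s * h s) (palindromes n)) ⟩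
    ½ * (hitSeries l n + signedHitSeries l n)
      ≡⟨ half-sum-rhs hitSeries signedHitSeries hitSeries-zero hitSeries-signed-zero hitSeries-suc signedHitSeries-suc l n ⟩
    rhs313 (suc (suc l)) n ∎
    where
    open ≡-Reasoning
    h : Palindrome → ℚ
    h s = ind (hits l (toTree s))

-- One-line notation of trees: pattern counts, avoidance of 132, and inverses.

module Words where
  open Trees
  open import Data.Bool using (true; false; if_then_else_; T)
  open import Data.Empty using (⊥-elim)
  open import Data.List using (List; []; _∷_; _++_; _∷ʳ_; map; length)
  open import Data.List.Properties using (length-++; length-map; ++-assoc; map-++; map-∘; map-cong; map-id; map-injective; ∷-injective)
  open import Data.List.Relation.Unary.All as All using (All; []; _∷_)
  import Data.List.Relation.Unary.All.Properties as All
  open import Data.Nat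
  open import Data.Nat.Properties
  open import Data.Nat.Solver using (module +-*-Solver)
  open import Data.Product using (_×_; _,_; ∃)
  open import Data.Sum using (_⊎_; inj₁; inj₂)
  open import Data.Unit using (⊤)
  open import Relation.Binary.PropositionalEquality
  open import Relation.Nullary using (¬_)
  open +-*-Solver using (solve; _:=_; _:+_; _:*_; con)

  word : Tree → List ℕ
  word leaf       = []
  word (node a b) = map (size b +_) (word a) ++ (size a + size b) ∷ word b

  length-word : ∀ t → length (word t) ≡ size t
  length-word leaf = refl
  length-word (node a b) rewrite length-++ (map (size b +_) (word a)) {(size a + size b) ∷ word b}
    | length-map (size b +_) (word a) | length-word a | length-word b = +-suc (size a) (size b)

  length-map-word : ∀ (f : ℕ → ℕ) t → length (map f (word t)) ≡ size t
  length-map-word f t = trans (length-map f (word t)) (length-word t)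

  infix 4 _≫_
  _≫_ : List ℕ → List ℕ → Set
  u ≫ v = All (λ x → All (_< x) v) u

  word-bound : ∀ t → All (_< size t) (word t)
  word-bound leaf = []
  word-bound (node a b) = All.++⁺
    (All.map⁺ (All.map (λ {x} x<a → m<n⇒m<1+n (subst (size b + x <_) (+-comm (size b) (size a)) (+-monoʳ-< (size b) x<a))) (word-bound a)))
    (≤-refl ∷ All.map (λ x<b → m≤n⇒m≤1+n (≤-trans x<b (m≤n+m _ _))) (word-bound b))

  shifted-bound : ∀ a b → All (_< size a + size b) (map (size b +_) (word a))
  shifted-bound a b = All.map⁺ (All.map (λ {x} x<a → subst (size b + x <_) (+-comm (size b) (size a)) (+-monoʳ-< (size b) x<a)) (word-bound a))

  peak-≫ : ∀ a b → map (size b +_) (word a) ∷ʳ (size a + size b) ≫ word b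
  peak-≫ a b = All.∷ʳ⁺ (All.map⁺ (All.universal (λ x → All.map (λ y<b → ≤-trans y<b (m≤m+n _ _)) (word-bound b)) (word a)))
    (All.map (λ y<b → ≤-trans y<b (m≤n+m _ _)) (word-bound b))

  <ᵇ-true : ∀ {m n} → m < n → (m <ᵇ n) ≡ true
  <ᵇ-true {m} {n} m<n with m <ᵇ n | <⇒<ᵇ m<n
  ... | true | _ = refl

  <ᵇ-false : ∀ {m n} → n ≤ m → (m <ᵇ n) ≡ false
  <ᵇ-false {m} {n} n≤m with m <ᵇ n in eq
  ... | false = refl
  ... | true  = ⊥-elim (<⇒≱ (<ᵇ⇒< m n (subst T (sym eq) _)) n≤m)

  <ᵇ-+ : ∀ c m n → (c + m <ᵇ c + n) ≡ (m <ᵇ n)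
  <ᵇ-+ zero    m n = refl
  <ᵇ-+ (suc c) m n = <ᵇ-+ c m n

  -- increasingAbove l a w counts the increasing subsequences of w of length l with all entries above a;
  -- a pattern 2134⋯k is a descent pair followed by such a subsequence above its larger entry.
  increasingAbove : ℕ → ℕ → List ℕ → ℕ
  increasingAbove zero    a w       = 1
  increasingAbove (suc l) a []      = 0
  increasingAbove (suc l) a (x ∷ w) = (if a <ᵇ x then increasingAbove l x w else 0) + increasingAbove (suc l) a w

  occAfter : ℕ → ℕ → List ℕ → ℕ
  occAfter l a []      = 0
  occAfter l a (x ∷ w) = (if x <ᵇ a then increasingAbove l a w else 0) + occAfter l a w

  occW : ℕ → List ℕ → ℕ
  occW l []      = 0
  occW l (x ∷ w) = occAfter l x w + occW l w

  if-+ : ∀ b m n → (if b then m + n else 0) ≡ (if b then m else 0) + (if b then n else 0)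
  if-+ true  m n = refl
  if-+ false m n = refl

  increasingAbove-none : ∀ l a v → All (_< a) v → increasingAbove (suc l) a v ≡ 0
  increasingAbove-none l a []      []        = refl
  increasingAbove-none l a (x ∷ v) (x<a ∷ p) rewrite <ᵇ-false {a} {x} (<⇒≤ x<a) = increasingAbove-none l a v p

  increasingAbove-++ : ∀ l a u v → All (_< a) v → u ≫ v → increasingAbove l a (u ++ v) ≡ increasingAbove l a u
  increasingAbove-++ zero    a u       v p q       = refl
  increasingAbove-++ (suc l) a []      v p q       = increasingAbove-none l a v p
  increasingAbove-++ (suc l) a (x ∷ u) v p (r ∷ q)
    rewrite increasingAbove-++ l x u v r q | increasingAbove-++ (suc l) a u v p q = refl

  increasingAbove-∷ʳ : ∀ l a u z → a < z → All (_< z) u →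
    increasingAbove (suc l) a (u ∷ʳ z) ≡ increasingAbove (suc l) a u + increasingAbove l a u
  increasingAbove-∷ʳ zero    a []      z a<z [] rewrite <ᵇ-true a<z = refl
  increasingAbove-∷ʳ (suc l) a []      z a<z [] rewrite <ᵇ-true a<z = refl
  increasingAbove-∷ʳ zero    a (x ∷ u) z a<z (x<z ∷ p) rewrite increasingAbove-∷ʳ zero a u z a<z p =
    sym (+-assoc (if a <ᵇ x then 1 else 0) _ 1)
  increasingAbove-∷ʳ (suc l) a (x ∷ u) z a<z (x<z ∷ p)
    rewrite increasingAbove-∷ʳ (suc l) a u z a<z p | increasingAbove-∷ʳ l x u z x<z p
      | if-+ (a <ᵇ x) (increasingAbove (suc l) x u) (increasingAbove l x u) =
    solve 4 (λ p q r s → p :+ q :+ (r :+ s) := p :+ r :+ (q :+ s)) refl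
      (if a <ᵇ x then increasingAbove (suc l) x u else 0) (if a <ᵇ x then increasingAbove l x u else 0)
      (increasingAbove (suc (suc l)) a u) (increasingAbove (suc l) a u)

  increasingAbove-shift : ∀ c l a u → increasingAbove l (c + a) (map (c +_) u) ≡ increasingAbove l a u
  increasingAbove-shift c zero    a u       = refl
  increasingAbove-shift c (suc l) a []      = refl
  increasingAbove-shift c (suc l) a (x ∷ u)
    rewrite <ᵇ-+ c a x | increasingAbove-shift c l x u | increasingAbove-shift c (suc l) a u = refl

  occAfter-none : ∀ l a v → All (_< a) v → occAfter (suc l) a v ≡ 0
  occAfter-none l a []      []        = refl
  occAfter-none l a (x ∷ v) (x<a ∷ p) rewrite <ᵇ-true x<a | increasingAbove-none l a v p = occAfter-none l a v p

  occAfter-++-suc : ∀ l a u v → All (_< a) v → u ≫ v → occAfter (suc l) a (u ++ v) ≡ occAfter (suc l) a u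
  occAfter-++-suc l a []      v p q       = occAfter-none l a v p
  occAfter-++-suc l a (x ∷ u) v p (_ ∷ q)
    rewrite increasingAbove-++ (suc l) a u v p q | occAfter-++-suc l a u v p q = refl

  occAfter-++-zero : ∀ a u v → All (_< a) v → occAfter 0 a (u ++ v) ≡ occAfter 0 a u + length v
  occAfter-++-zero a []      []      []        = refl
  occAfter-++-zero a []      (x ∷ v) (x<a ∷ p) rewrite <ᵇ-true x<a = cong suc (occAfter-++-zero a [] v p)
  occAfter-++-zero a (x ∷ u) v       p         rewrite occAfter-++-zero a u v p =
    sym (+-assoc (if x <ᵇ a then 1 else 0) (occAfter 0 a u) (length v))

  occAfter-∷ʳ-suc : ∀ l a u z → a < z → All (_< z) u →
    occAfter (suc l) a (u ∷ʳ z) ≡ occAfter (suc l) a u + occAfter l a u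
  occAfter-∷ʳ-suc l a []      z a<z [] rewrite <ᵇ-false {z} {a} (<⇒≤ a<z) = refl
  occAfter-∷ʳ-suc l a (x ∷ u) z a<z (_ ∷ p)
    rewrite occAfter-∷ʳ-suc l a u z a<z p | increasingAbove-∷ʳ l a u z a<z p
      | if-+ (x <ᵇ a) (increasingAbove (suc l) a u) (increasingAbove l a u) =
    solve 4 (λ p q r s → p :+ q :+ (r :+ s) := p :+ r :+ (q :+ s)) refl
      (if x <ᵇ a then increasingAbove (suc l) a u else 0) (if x <ᵇ a then increasingAbove l a u else 0)
      (occAfter (suc l) a u) (occAfter l a u)

  occAfter-∷ʳ-zero : ∀ a u z → a < z → occAfter 0 a (u ∷ʳ z) ≡ occAfter 0 a u
  occAfter-∷ʳ-zero a []      z a<z rewrite <ᵇ-false {z} {a} (<⇒≤ a<z) = refl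
  occAfter-∷ʳ-zero a (x ∷ u) z a<z rewrite occAfter-∷ʳ-zero a u z a<z = refl

  occAfter-shift : ∀ c l a u → occAfter l (c + a) (map (c +_) u) ≡ occAfter l a u
  occAfter-shift c l a []      = refl
  occAfter-shift c l a (x ∷ u) rewrite <ᵇ-+ c x a | increasingAbove-shift c l a u | occAfter-shift c l a u = refl

  occW-shift : ∀ c l u → occW l (map (c +_) u) ≡ occW l u
  occW-shift c l []      = refl
  occW-shift c l (x ∷ u) = cong₂ _+_ (occAfter-shift c l x u) (occW-shift c l u)

  -- From length 3 on, the last letter of the pattern exceeds the first. An occurrence that starts
  -- in `u` and reaches the lower block `v` would have to end in `v`, below its first letter.
  occW-++-suc : ∀ l u v → u ≫ v → occW (suc l) (u ++ v) ≡ occW (suc l) u + occW (suc l) v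
  occW-++-suc l []      v []      = refl
  occW-++-suc l (x ∷ u) v (p ∷ q) rewrite occAfter-++-suc l x u v p q | occW-++-suc l u v q = sym (+-assoc (occAfter (suc l) x u) _ _)

  occW-++-zero : ∀ u v → u ≫ v → occW 0 (u ++ v) ≡ occW 0 u + occW 0 v + length u * length v
  occW-++-zero []      v []      = sym (+-identityʳ _)
  occW-++-zero (x ∷ u) v (p ∷ q) rewrite occAfter-++-zero x u v p | occW-++-zero u v q =
    solve 5 (λ p v q r s → (p :+ v) :+ (q :+ r :+ s) := p :+ q :+ r :+ (v :+ s)) refl
      (occAfter 0 x u) (length v) (occW 0 u) (occW 0 v) (length u * length v)

  -- A maximum at the end is either left out or plays the largest letter, whose removal leaves the
  -- shorter pattern.
  occW-∷ʳ-suc : ∀ l u z → All (_< z) u → occW (suc l) (u ∷ʳ z) ≡ occW (suc l) u + occW l u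
  occW-∷ʳ-suc l []      z []        = refl
  occW-∷ʳ-suc l (x ∷ u) z (x<z ∷ p) rewrite occAfter-∷ʳ-suc l x u z x<z p | occW-∷ʳ-suc l u z p =
    solve 4 (λ p q r s → p :+ q :+ (r :+ s) := p :+ r :+ (q :+ s)) refl
      (occAfter (suc l) x u) (occAfter l x u) (occW (suc l) u) (occW l u)

  occW-∷ʳ-zero : ∀ u z → All (_< z) u → occW 0 (u ∷ʳ z) ≡ occW 0 u
  occW-∷ʳ-zero []      z []        = refl
  occW-∷ʳ-zero (x ∷ u) z (x<z ∷ p) = cong₂ _+_ (occAfter-∷ʳ-zero x u z x<z) (occW-∷ʳ-zero u z p)

  word-node : ∀ a b → word (node a b) ≡ (map (size b +_) (word a) ∷ʳ (size a + size b)) ++ word b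
  word-node a b = sym (++-assoc (map (size b +_) (word a)) _ (word b))

  -- The word is cut right after its maximum, so that the laws for a lower block, a final maximum
  -- and a shift apply one after the other; together they are the clauses of `occ`.
  occW-word : ∀ l t → occW l (word t) ≡ occ l t
  occW-word l leaf = refl
  occW-word zero (node a b)
    rewrite word-node a b | occW-++-zero (map (size b +_) (word a) ∷ʳ (size a + size b)) (word b) (peak-≫ a b)
      | occW-∷ʳ-zero (map (size b +_) (word a)) (size a + size b) (shifted-bound a b)
      | occW-shift (size b) 0 (word a) | length-++ (map (size b +_) (word a)) {(size a + size b) ∷ []}
      | length-map (size b +_) (word a) | length-word a | length-word b | occW-word 0 a | occW-word 0 b
      | +-comm (size a) 1 = refl
  occW-word (suc l) (node a b)
    rewrite word-node a b | occW-++-suc l (map (size b +_) (word a) ∷ʳ (size a + size b)) (word b) (peak-≫ a b)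
      | occW-∷ʳ-suc l (map (size b +_) (word a)) (size a + size b) (shifted-bound a b)
      | occW-shift (size b) (suc l) (word a) | occW-shift (size b) l (word a)
      | occW-word (suc l) a | occW-word l a | occW-word (suc l) b = refl

  -- In a forbidden 132 the number `a` plays the 1, `y` the 3 and `z` the 2.
  No32Above : ℕ → List ℕ → Set
  No32Above a []      = ⊤
  No32Above a (y ∷ w) = (a < y → All (λ z → a < z → ¬ z < y) w) × No32Above a w

  Avoids132 : List ℕ → Set
  Avoids132 []      = ⊤
  Avoids132 (x ∷ w) = No32Above x w × Avoids132 w

  no32-++ : ∀ a u v → No32Above a u → All (_< a) v → No32Above a (u ++ v)
  no32-++ a []      []      _       []        = _
  no32-++ a []      (y ∷ v) _       (y<a ∷ p) = (λ a<y → ⊥-elim (<-asym a<y y<a)) , no32-++ a [] v _ p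
  no32-++ a (y ∷ u) v       (q , r) p         =
    (λ a<y → All.++⁺ (q a<y) (All.map (λ z<a a<z → ⊥-elim (<-asym z<a a<z)) p)) , no32-++ a u v r p

  no32-∷ʳ : ∀ a u z → No32Above a u → All (_< z) u → No32Above a (u ∷ʳ z)
  no32-∷ʳ a []      z _       []        = (λ _ → []) , _
  no32-∷ʳ a (y ∷ u) z (q , r) (y<z ∷ p) = (λ a<y → All.∷ʳ⁺ (q a<y) (λ _ → <-asym y<z)) , no32-∷ʳ a u z r p

  no32-shift : ∀ c a u → No32Above a u → No32Above (c + a) (map (c +_) u)
  no32-shift c a []      _       = _
  no32-shift c a (y ∷ u) (q , r) =
    (λ a<y → All.map⁺ (All.map (λ f a<z z<y → f (+-cancelˡ-< c _ _ a<z) (+-cancelˡ-< c _ _ z<y)) (q (+-cancelˡ-< c _ _ a<y))))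
    , no32-shift c a u r

  avoids132-++ : ∀ u v → Avoids132 u → Avoids132 v → u ≫ v → Avoids132 (u ++ v)
  avoids132-++ []      v _       q []      = q
  avoids132-++ (x ∷ u) v (p , r) q (b ∷ s) = no32-++ x u v p b , avoids132-++ u v r q s

  avoids132-∷ʳ : ∀ u z → Avoids132 u → All (_< z) u → Avoids132 (u ∷ʳ z)
  avoids132-∷ʳ []      z _       []      = _ , _
  avoids132-∷ʳ (x ∷ u) z (p , r) (_ ∷ b) = no32-∷ʳ x u z p b , avoids132-∷ʳ u z r b

  avoids132-shift : ∀ c u → Avoids132 u → Avoids132 (map (c +_) u)
  avoids132-shift c []      _       = _
  avoids132-shift c (x ∷ u) (p , r) = no32-shift c x u p , avoids132-shift c u r

  word-avoids132 : ∀ t → Avoids132 (word t)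
  word-avoids132 leaf = _
  word-avoids132 (node a b) rewrite word-node a b = avoids132-++ (map (size b +_) (word a) ∷ʳ (size a + size b)) (word b)
    (avoids132-∷ʳ (map (size b +_) (word a)) (size a + size b) (avoids132-shift (size b) (word a) (word-avoids132 a)) (shifted-bound a b))
    (word-avoids132 b) (peak-≫ a b)

  -- Entries as a relation between position and value, so that passing to the inverse permutation is
  -- an exchange of the two.
  data _[_]=_ : List ℕ → ℕ → ℕ → Set where
    here  : ∀ {x w} → (x ∷ w) [ 0 ]= x
    there : ∀ {x w i y} → w [ i ]= y → (x ∷ w) [ suc i ]= y

  ++-[]=ˡ : ∀ {u v i x} → u [ i ]= x → (u ++ v) [ i ]= x
  ++-[]=ˡ here      = here
  ++-[]=ˡ (there p) = there (++-[]=ˡ p)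

  ++-[]=ʳ : ∀ u {v i x} → v [ i ]= x → (u ++ v) [ length u + i ]= x
  ++-[]=ʳ []      p = p
  ++-[]=ʳ (_ ∷ u) p = there (++-[]=ʳ u p)

  ++-[]=⁻ : ∀ u {v i x} → (u ++ v) [ i ]= x → u [ i ]= x ⊎ ∃ λ j → i ≡ length u + j × v [ j ]= x
  ++-[]=⁻ []      p         = inj₂ (_ , refl , p)
  ++-[]=⁻ (_ ∷ u) here      = inj₁ here
  ++-[]=⁻ (_ ∷ u) (there p) with ++-[]=⁻ u p
  ... | inj₁ q              = inj₁ (there q)
  ... | inj₂ (j , refl , q) = inj₂ (j , refl , q)

  map-[]=⁺ : ∀ f {u i x} → u [ i ]= x → map f u [ i ]= f x
  map-[]=⁺ f here      = here
  map-[]=⁺ f (there p) = there (map-[]=⁺ f p)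

  map-[]=⁻ : ∀ f u {i y} → map f u [ i ]= y → ∃ λ x → y ≡ f x × u [ i ]= x
  map-[]=⁻ f (x ∷ u) here      = x , refl , here
  map-[]=⁻ f (x ∷ u) (there p) with map-[]=⁻ f u p
  ... | z , refl , q = z , refl , there q

  []=-extensional : ∀ w w′ → length w ≡ length w′ → (∀ {i x} → w [ i ]= x → w′ [ i ]= x) → w ≡ w′
  []=-extensional []      []        _  _ = refl
  []=-extensional (x ∷ w) (x′ ∷ w′) eq f with f here
  ... | here = cong (x ∷_) ([]=-extensional w w′ (suc-injective eq) (λ p → drop (f (there p))))
    where
    drop : ∀ {y w i z} → (y ∷ w) [ suc i ]= z → w [ i ]= z
    drop (there p) = p

  word-graft : ∀ d e → word (graft d e) ≡ map (size e +_) (word d) ++ word e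
  word-graft leaf       e = refl
  word-graft (node a b) e rewrite size-graft b e | word-graft b e
    | map-++ (size e +_) (map (size b +_) (word a)) ((size a + size b) ∷ word b)
    | ++-assoc (map (size e +_) (map (size b +_) (word a))) ((size e + (size a + size b)) ∷ map (size e +_) (word b)) (word e)
    = cong₂ (λ u z → u ++ z ∷ map (size e +_) (word b) ++ word e)
        (trans (map-cong (λ x → solve 3 (λ b e x → b :+ e :+ x := e :+ (b :+ x)) refl (size b) (size e) x) (word a)) (map-∘ (word a)))
        (solve 3 (λ a b e → a :+ (b :+ e) := e :+ (a :+ b)) refl (size a) (size b) (size e))

  word-mirror-node : ∀ a b → word (mirror (node a b)) ≡ map (suc (size a) +_) (word (mirror b)) ++ (word (mirror a) ∷ʳ size a)
  word-mirror-node a b rewrite word-graft (mirror b) (node (mirror a) leaf) | size-mirror a | +-identityʳ (size a) =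
    cong (λ u → map (suc (size a) +_) (word (mirror b)) ++ (u ∷ʳ size a)) (trans (map-cong (λ _ → refl) (word (mirror a))) (map-id (word (mirror a))))

  -- The entry lies in the raised block of `a`, at the maximum, or in the block of `b`. In the
  -- inverse the block of `b` comes first, and the position `size a` of the maximum becomes the last
  -- value.
  word-mirror : ∀ t {i x} → word t [ i ]= x → word (mirror t) [ x ]= i
  word-mirror (node a b) {i} {x} p rewrite word-mirror-node a b with ++-[]=⁻ (map (size b +_) (word a)) p
  ... | inj₁ q with map-[]=⁻ (size b +_) (word a) q
  ...   | z , refl , r = subst (λ m → (map (suc (size a) +_) (word (mirror b)) ++ (word (mirror a) ∷ʳ size a)) [ m + z ]= i)
                           (length-shifted-mirror) (++-[]=ʳ (map (suc (size a) +_) (word (mirror b))) (++-[]=ˡ (word-mirror a r)))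
    where
    length-shifted-mirror : length (map (suc (size a) +_) (word (mirror b))) ≡ size b
    length-shifted-mirror = trans (length-map-word (suc (size a) +_) (mirror b)) (size-mirror b)
  word-mirror (node a b) {i} {x} p | inj₂ (zero , refl , here) =
    subst₂ (λ m k → (map (suc (size a) +_) (word (mirror b)) ++ (word (mirror a) ∷ʳ size a)) [ m ]= k)
      position value (++-[]=ʳ (map (suc (size a) +_) (word (mirror b))) (++-[]=ʳ (word (mirror a)) {size a ∷ []} here))
    where
    position : length (map (suc (size a) +_) (word (mirror b))) + (length (word (mirror a)) + 0) ≡ size a + size b
    position = trans (cong₂ _+_ (trans (length-map-word (suc (size a) +_) (mirror b)) (size-mirror b))
      (trans (+-identityʳ _) (trans (length-word (mirror a)) (size-mirror a)))) (+-comm (size b) (size a))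
    value : size a ≡ length (map (size b +_) (word a)) + 0
    value = sym (trans (+-identityʳ _) (length-map-word (size b +_) a))
  word-mirror (node a b) {i} {x} p | inj₂ (suc j , refl , there q) =
    subst (λ k → (map (suc (size a) +_) (word (mirror b)) ++ (word (mirror a) ∷ʳ size a)) [ x ]= k) value
      (++-[]=ˡ (map-[]=⁺ (suc (size a) +_) (word-mirror b q)))
    where
    value : suc (size a) + j ≡ length (map (size b +_) (word a)) + suc j
    value = trans (sym (+-suc (size a) j)) (cong (_+ suc j) (sym (length-map-word (size b +_) a)))

  -- `z` occurs in neither left part, so both cuts are at its first occurrence.
  split-at-max : ∀ {z} u u′ {v v′} → All (_< z) u → All (_< z) u′ → u ++ z ∷ v ≡ u′ ++ z ∷ v′ → u ≡ u′ × v ≡ v′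
  split-at-max []      []       _         _         refl = refl , refl
  split-at-max []      (_ ∷ _)  _         (z<z ∷ _) refl = ⊥-elim (<-irrefl refl z<z)
  split-at-max (_ ∷ _) []       (z<z ∷ _) _         refl = ⊥-elim (<-irrefl refl z<z)
  split-at-max (x ∷ u) (x′ ∷ u′) (_ ∷ p) (_ ∷ p′) eq with ∷-injective eq
  ... | refl , eq′ with split-at-max u u′ p p′ eq′
  ...   | refl , refl = refl , refl

  -- The length determines the maximum, and cutting there separates the subwords. `b` is recovered
  -- first because its size is the shift applied to the word of `a`.
  word-injective : ∀ t t′ → word t ≡ word t′ → t ≡ t′
  word-injective leaf       leaf         _  = refl
  word-injective leaf       (node a b)   eq with trans (cong length eq) (length-word (node a b))
  ... | ()
  word-injective (node a b) leaf         eq with trans (cong length (sym eq)) (length-word (node a b))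
  ... | ()
  word-injective (node a b) (node a′ b′) eq
    with split-at-max (map (size b +_) (word a)) (map (size b′ +_) (word a′)) (shifted-bound a b)
           (subst (λ z → All (_< z) (map (size b′ +_) (word a′))) (sym same-max) (shifted-bound a′ b′))
           (trans eq (cong (λ z → map (size b′ +_) (word a′) ++ z ∷ word b′) (sym same-max)))
    where
    same-max : size a + size b ≡ size a′ + size b′
    same-max = suc-injective (trans (sym (length-word (node a b))) (trans (cong length eq) (length-word (node a′ b′))))
  ... | eqᵃ , eqᵇ with word-injective b b′ eqᵇ
  ...   | refl with word-injective a a′ (map-injective (λ {x} {y} → +-cancelˡ-≡ (size b) x y) eqᵃ)
  ...     | refl = refl

  word-involution : ∀ t → (∀ {i x} → word t [ i ]= x → word t [ x ]= i) → mirror t ≡ t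
  word-involution t inv = sym (word-injective t (mirror t) ([]=-extensional (word t) (word (mirror t))
    (trans (length-word t) (sym (trans (length-word (mirror t)) (size-mirror t))))
    (λ p → word-mirror t (inv p))))

-- Every 132-avoiding permutation comes from a tree.

module Completeness where
  open Trees
  open Words
  open import Data.Empty using (⊥-elim)
  open import Data.List using (List; []; _∷_; _++_; map; length; applyUpTo)
  open import Data.List.Properties using (length-++; map-++; map-∘; map-cong; length-applyUpTo)
  open import Data.List.Membership.Propositional using (_∈_)
  open import Data.List.Membership.Propositional.Properties using (∈-++⁺ˡ; ∈-++⁺ʳ; ∈-++⁻; ∈-∃++; ∈-applyUpTo⁺)
  open import Data.List.Membership.DecPropositional using () renaming (_∈?_ to member?)
  open import Data.List.Relation.Unary.All as All using (All; []; _∷_)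
  import Data.List.Relation.Unary.All.Properties as All
  open import Data.List.Relation.Unary.AllPairs using ([]; _∷_)
  open import Data.List.Relation.Unary.Any using (here; there)
  open import Data.List.Relation.Unary.Unique.Propositional using (Unique)
  open import Data.Nat
  open import Data.Nat.Properties
  open import Data.Product using (_×_; _,_; proj₁; proj₂; ∃)
  open import Data.Sum using (inj₁; inj₂)
  open import Relation.Binary.PropositionalEquality
  open import Relation.Nullary using (¬_; yes; no)

  unique-length-≤ : ∀ {A : Set} {xs : List A} (ys : List A) → Unique xs → (∀ {x} → x ∈ xs → x ∈ ys) → length xs ≤ length ys
  unique-length-≤ {xs = []}     ys []        sub = z≤n
  unique-length-≤ {xs = x ∷ xs} ys (x∉ ∷ uq) sub with ∈-∃++ (sub (here refl))
  ... | us , vs , refl = ≤-trans (s≤s (unique-length-≤ (us ++ vs) uq sub′))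
          (≤-reflexive (trans (cong suc (length-++ us)) (trans (sym (+-suc (length us) (length vs))) (sym (length-++ us)))))
    where
    sub′ : ∀ {y} → y ∈ xs → y ∈ us ++ vs
    sub′ y∈ with ∈-++⁻ us (sub (there y∈))
    ... | inj₁ p           = ∈-++⁺ˡ p
    ... | inj₂ (there p)   = ∈-++⁺ʳ us p
    ... | inj₂ (here refl) = ⊥-elim (All.lookup x∉ y∈ refl)

  Within : ℕ → ℕ → List ℕ → Set
  Within s e w = All (λ x → s ≤ x × x < e) w

  pigeonhole : ∀ {w} s m → Unique w → Within s (s + m) w → length w ≤ m
  pigeonhole {w} s m uq within = ≤-trans (unique-length-≤ (applyUpTo (s +_) m) uq member) (≤-reflexive (length-applyUpTo (s +_) m))
    where
    member : ∀ {x} → x ∈ w → x ∈ applyUpTo (s +_) m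
    member {x} x∈ with All.lookup within x∈
    ... | s≤x , x<s+m = subst (_∈ applyUpTo (s +_) m) (m+[n∸m]≡n s≤x)
      (∈-applyUpTo⁺ (s +_) (+-cancelˡ-< s (x ∸ s) m (subst (_< s + m) (sym (m+[n∸m]≡n s≤x)) x<s+m)))

  unique-++⁻ : ∀ {A : Set} (u : List A) {v} → Unique (u ++ v) → Unique u × Unique v × All (λ x → All (x ≢_) v) u
  unique-++⁻ []      uq        = [] , uq , []
  unique-++⁻ (x ∷ u) (x∉ ∷ uq) with unique-++⁻ u uq
  ... | uqᵤ , uqᵥ , apart = (All.++⁻ˡ u x∉ ∷ uqᵤ) , uqᵥ , (All.++⁻ʳ u x∉ ∷ apart)

  no32-++⁻ˡ : ∀ a u {v} → No32Above a (u ++ v) → No32Above a u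
  no32-++⁻ˡ a []      _       = _
  no32-++⁻ˡ a (y ∷ u) (p , q) = (λ a<y → All.++⁻ˡ u (p a<y)) , no32-++⁻ˡ a u q

  avoids132-++⁻ˡ : ∀ u {v} → Avoids132 (u ++ v) → Avoids132 u
  avoids132-++⁻ˡ []      _       = _
  avoids132-++⁻ˡ (x ∷ u) (p , q) = no32-++⁻ˡ x u p , avoids132-++⁻ˡ u q

  avoids132-++⁻ʳ : ∀ u {v} → Avoids132 (u ++ v) → Avoids132 v
  avoids132-++⁻ʳ []      av      = av
  avoids132-++⁻ʳ (x ∷ u) (_ , q) = avoids132-++⁻ʳ u q

  no32-peak : ∀ a u {z v} → No32Above a (u ++ z ∷ v) → a < z → All (λ y → a < y → ¬ y < z) v
  no32-peak a []      (p , _) a<z = p a<z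
  no32-peak a (_ ∷ u) (_ , q) a<z = no32-peak a u q a<z

  -- An entry to the left of the maximum z cannot be exceeded by one to its right, as with z they would form 132.
  peak-splits : ∀ u {z v} → Avoids132 (u ++ z ∷ v) → All (_< z) u → All (_< z) v → All (λ x → All (x ≢_) v) u → u ≫ v
  peak-splits []      _       _           v<z _             = []
  peak-splits (x ∷ u) (p , q) (x<z ∷ u<z) v<z (x≢ ∷ apart) =
    All.tabulate (λ {y} y∈ → ≤∧≢⇒< (≮⇒≥ (λ x<y → All.lookup (no32-peak x u p x<z) y∈ x<y (All.lookup v<z y∈))) (λ y≡x → All.lookup x≢ y∈ (sym y≡x)))
    ∷ peak-splits u q u<z v<z apart

  -- The word is cut at its maximum. By `peak-splits` the left part lies above the right one, and
  -- counting values shows that each fills an interval. The offset `s` allows for the raised left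
  -- part; `f` bounds the length, since the parts are not subterms.
  tree-of-word : ∀ f s w → length w ≤ f → Unique w → Within s (s + length w) w → Avoids132 w →
                 ∃ λ t → w ≡ map (s +_) (word t)
  tree-of-word f       s []         _         _  _      _  = leaf , refl
  tree-of-word (suc f) s w@(_ ∷ w₀) (s≤s n≤f) uq within av with member? _≟_ (s + length w₀) w
  -- Without the value s + n, the n + 1 distinct entries would lie among only n values.
  ... | no max∉ = ⊥-elim (<-irrefl refl (pigeonhole s n uq (All.tabulate below)))
    where
    n : ℕ
    n = length w₀
    below : ∀ {x} → x ∈ w → s ≤ x × x < s + n
    below {x} x∈ with All.lookup within x∈
    ... | s≤x , x<s+1+n = s≤x , ≤∧≢⇒< (≤-pred (subst (x <_) (+-suc s n) x<s+1+n)) (λ { refl → max∉ x∈ })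
  ... | yes max∈ with ∈-∃++ max∈
  ...   | u , v , w≡ = build
    where
    n : ℕ
    n = length w₀
    uq′ : Unique (u ++ (s + n) ∷ v)
    uq′ = subst Unique w≡ uq
    av′ : Avoids132 (u ++ (s + n) ∷ v)
    av′ = subst Avoids132 w≡ av
    within′ : Within s (s + suc n) (u ++ (s + n) ∷ v)
    within′ = subst (Within s (s + suc n)) w≡ within
    uqᵤ : Unique u
    uqᵤ = proj₁ (unique-++⁻ u uq′)
    uq-zv : Unique ((s + n) ∷ v)
    uq-zv = proj₁ (proj₂ (unique-++⁻ u uq′))
    uqᵥ : Unique v
    uqᵥ with uq-zv
    ... | _ ∷ q = q
    apart : All (λ x → All (x ≢_) ((s + n) ∷ v)) u
    apart = proj₂ (proj₂ (unique-++⁻ u uq′))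
    lower : ∀ {x} → s ≤ x × x < s + suc n → x ≢ s + n → s ≤ x × x < s + n
    lower {x} (s≤x , x<) x≢ = s≤x , ≤∧≢⇒< (≤-pred (subst (x <_) (+-suc s n) x<)) x≢
    withinᵤ : Within s (s + n) u
    withinᵤ = All.zipWith (λ { (b , ≢z ∷ _) → lower b ≢z }) (All.++⁻ˡ u within′ , apart)
    withinᵥ : Within s (s + n) v
    withinᵥ with uq-zv | All.++⁻ʳ u within′
    ... | z∉ ∷ _ | _ ∷ bs = All.zipWith (λ { (b , ≢z) → lower b (λ eq → ≢z (sym eq)) }) (bs , z∉)
    u≫v : u ≫ v
    u≫v = peak-splits u av′ (All.map proj₂ withinᵤ) (All.map proj₂ withinᵥ) (All.map (λ { (_ ∷ r) → r }) apart)
    lengths : length u + length v ≡ n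
    lengths = suc-injective (trans (sym (+-suc (length u) (length v)))
      (trans (sym (length-++ u)) (cong length (sym w≡))))
    -- A larger `y` in `v` would leave fewer than |u| values between `y` and the maximum for the
    -- entries of `u`, all of which exceed `y`.
    v-low : ∀ {y} → y ∈ v → y < s + length v
    v-low {y} y∈ with y <? s + length v
    ... | yes y< = y<
    ... | no y≮ = ⊥-elim (<⇒≱ too-few (pigeonhole (suc y) (s + n ∸ suc y) uqᵤ
        (All.zipWith (λ { {x} (u>v , (_ , x<)) → All.lookup u>v y∈ , subst (x <_) (sym (m+[n∸m]≡n y<max)) x< }) (u≫v , withinᵤ))))
      where
      y<max : y < s + n
      y<max = proj₂ (All.lookup withinᵥ y∈)
      too-few : s + n ∸ suc y < length u
      too-few = +-cancelˡ-< (suc y) _ _ (subst (_< suc y + length u) (sym (m+[n∸m]≡n y<max))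
        (s≤s (≤-trans (≤-reflexive (trans (cong (s +_) (trans (sym lengths) (+-comm (length u) (length v)))) (sym (+-assoc s _ _))))
          (+-monoˡ-≤ (length u) (≮⇒≥ y≮)))))
    -- A smaller `x` in `u` would leave fewer than |v| values from `s` up to `x` for the entries of
    -- `v`, all of which lie below `x`.
    u-high : ∀ {x} → x ∈ u → s + length v ≤ x
    u-high {x} x∈ with s + length v ≤? x
    ... | yes ≤x = ≤x
    ... | no ≰x = ⊥-elim (<⇒≱ (≰⇒> ≰x) (≤-trans (+-monoʳ-≤ s (pigeonhole s (x ∸ s) uqᵥ
        (All.zipWith (λ { {y} (y<x , (s≤y , _)) → s≤y , subst (y <_) (sym (m+[n∸m]≡n s≤x)) y<x }) (All.lookup u≫v x∈ , withinᵥ))))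
        (≤-reflexive (m+[n∸m]≡n s≤x))))
      where
      s≤x : s ≤ x
      s≤x = proj₁ (All.lookup withinᵤ x∈)
    build : ∃ λ t → w ≡ map (s +_) (word t)
    build with tree-of-word f (s + length v) u (≤-trans (m+n≤o⇒m≤o (length u) (≤-reflexive lengths)) n≤f) uqᵤ
                 (All.tabulate (λ {x} x∈ → u-high x∈ , subst (x <_) (trans (cong (s +_) (trans (sym lengths) (+-comm (length u) (length v)))) (sym (+-assoc s _ _))) (proj₂ (All.lookup withinᵤ x∈))))
                 (avoids132-++⁻ˡ u av′)
             | tree-of-word f s v (≤-trans (m+n≤o⇒n≤o (length u) (≤-reflexive lengths)) n≤f) uqᵥ
                 (All.tabulate (λ y∈ → proj₁ (All.lookup withinᵥ y∈) , v-low y∈))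
                 (proj₂ (avoids132-++⁻ʳ u av′))
    ... | a , u≡ | b , v≡ = node a b , (begin
      w
        ≡⟨ w≡ ⟩
      u ++ (s + n) ∷ v
        ≡⟨ cong₂ (λ p q → p ++ (s + n) ∷ q) shifted-u v≡ ⟩
      map (s +_) (map (size b +_) (word a)) ++ (s + n) ∷ map (s +_) (word b)
        ≡⟨ cong (λ m → map (s +_) (map (size b +_) (word a)) ++ (s + m) ∷ map (s +_) (word b))
             (trans (sym lengths) (cong₂ _+_ size-u size-v)) ⟩
      map (s +_) (map (size b +_) (word a)) ++ (s + (size a + size b)) ∷ map (s +_) (word b)
        ≡⟨ sym (map-++ (s +_) (map (size b +_) (word a)) ((size a + size b) ∷ word b)) ⟩
      map (s +_) (word (node a b)) ∎)
      where
      open ≡-Reasoning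
      size-u : length u ≡ size a
      size-u = trans (cong length u≡) (length-map-word (s + length v +_) a)
      size-v : length v ≡ size b
      size-v = trans (cong length v≡) (length-map-word (s +_) b)
      shifted-u : u ≡ map (s +_) (map (size b +_) (word a))
      shifted-u = trans u≡ (trans (map-cong (λ x → trans (+-assoc s (length v) x) (cong (λ m → s + (m + x)) size-v)) (word a)) (map-∘ (word a)))

-- From occurrences counted over index vectors to recursive counts over words.

module Patterns where
  open Trees using (T-ext; T-∧-intro; T-∧-elim)
  open Words
  open import Data.Bool using (Bool; true; false; T; _∧_; not; if_then_else_)
  open import Data.Empty using (⊥-elim)
  open import Data.Fin as Fin using (Fin; zero; suc; toℕ)
  open import Data.Fin.Properties using (toℕ-injective)
  open import Data.List as List using (List; []; _∷_; _++_; map; concatMap; allFin; filterᵇ; length)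
  open import Data.Nat.ListAction using (sum)
  open import Data.List.Properties using (map-∘; map-cong; map-tabulate)
  open import Data.List.Relation.Unary.All as All using (All; []; _∷_)
  open import Data.Nat as ℕ using (ℕ; zero; suc; _+_; _<_; _≤_; _<ᵇ_; z≤n; s≤s)
  open import Data.Nat.Properties
  open import Data.Product using (_×_; _,_; proj₁; proj₂)
  open import Data.Unit using (tt)
  open import Data.Vec as Vec using (Vec; []; _∷_; lookup; toList)
  open import Data.Vec.Properties using (lookup-map)
  open import Function using (_∘_)
  open import Relation.Binary.Definitions using (tri<; tri≈; tri>)
  open import Relation.Binary.PropositionalEquality
  open import Relation.Nullary using (¬_)

  count : ∀ {A : Set} → (A → Bool) → List A → ℕ
  count p xs = length (filterᵇ p xs)

  count-∷ : ∀ {A : Set} (p : A → Bool) x xs → count p (x ∷ xs) ≡ (if p x then 1 else 0) + count p xs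
  count-∷ p x xs with p x
  ... | true  = refl
  ... | false = refl

  count-cong : ∀ {A : Set} {p q : A → Bool} → (∀ x → p x ≡ q x) → ∀ xs → count p xs ≡ count q xs
  count-cong eq [] = refl
  count-cong {p = p} {q} eq (x ∷ xs) rewrite count-∷ p x xs | count-∷ q x xs | eq x | count-cong eq xs = refl

  count-++ : ∀ {A : Set} (p : A → Bool) xs ys → count p (xs ++ ys) ≡ count p xs + count p ys
  count-++ p []       ys = refl
  count-++ p (x ∷ xs) ys rewrite count-∷ p x (xs ++ ys) | count-∷ p x xs | count-++ p xs ys =
    sym (+-assoc (if p x then 1 else 0) (count p xs) (count p ys))

  count-map : ∀ {A B : Set} (p : B → Bool) (f : A → B) xs → count p (map f xs) ≡ count (p ∘ f) xs
  count-map p f [] = refl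
  count-map p f (x ∷ xs) rewrite count-∷ p (f x) (map f xs) | count-∷ (p ∘ f) x xs | count-map p f xs = refl

  count-none : ∀ {A : Set} (p : A → Bool) → (∀ x → p x ≡ false) → ∀ xs → count p xs ≡ 0
  count-none p eq []       = refl
  count-none p eq (x ∷ xs) rewrite count-∷ p x xs | eq x = count-none p eq xs

  count-concatMap : ∀ {A B : Set} (p : B → Bool) (f : A → List B) xs → count p (concatMap f xs) ≡ sum (map (count p ∘ f) xs)
  count-concatMap p f []       = refl
  count-concatMap p f (x ∷ xs) = trans (count-++ p (f x) (concatMap f xs)) (cong (count p (f x) +_) (count-concatMap p f xs))

  allFin-suc : ∀ n → allFin (suc n) ≡ zero ∷ map suc (allFin n)
  allFin-suc n = cong (zero ∷_) (sym (map-tabulate (λ i → i) suc))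

  sum-allFin-suc : ∀ {n} (g : Fin (suc n) → ℕ) → sum (map g (allFin (suc n))) ≡ g zero + sum (map (g ∘ suc) (allFin n))
  sum-allFin-suc {n} g = trans (cong (sum ∘ map g) (allFin-suc n)) (cong (λ l → g zero + sum l) (sym (map-∘ (allFin n))))

  count-allFin-suc : ∀ {n} (p : Fin (suc n) → Bool) →
                     count p (allFin (suc n)) ≡ (if p zero then 1 else 0) + count (p ∘ suc) (allFin n)
  count-allFin-suc {n} p = trans (cong (count p) (allFin-suc n)) (trans (count-∷ p zero (map suc (allFin n)))
    (cong ((if p zero then 1 else 0) +_) (count-map p suc (allFin n))))

  all-allFin⁻ : ∀ {n} (p : Fin n → Bool) → T (all p (allFin n)) → ∀ i → T (p i)
  all-allFin⁻ {suc n} p h zero    = proj₁ (T-∧-elim h)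
  all-allFin⁻ {suc n} p h (suc i) = all-allFin⁻ (p ∘ suc) (subst T (all-map (allFin n)) (subst (λ l → T (all p l)) (sym (map-tabulate (λ i → i) suc)) (proj₂ (T-∧-elim {p zero} h)))) i
    where
    all-map : ∀ xs → all p (map suc xs) ≡ all (p ∘ suc) xs
    all-map []       = refl
    all-map (x ∷ xs) = cong (p (suc x) ∧_) (all-map xs)

  all-allFin⁺ : ∀ {n} (p : Fin n → Bool) → (∀ i → T (p i)) → T (all p (allFin n))
  all-allFin⁺ {n} p h = go (allFin n)
    where
    go : ∀ xs → T (all p xs)
    go []       = tt
    go (x ∷ xs) = T-∧-intro (h x) (go xs)

  -- The Boolean connectives local to the definitions below have no accessible name;
  -- each mutual block recovers the matrix of one nested quantifier by unification.
  mutual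
    increasingAt : ∀ {m n} → Vec (Fin n) m → Fin m → Fin m → Bool
    increasingAt = _

    increasing-unfold : ∀ {m n} (f : Vec (Fin n) m) →
      increasing f ≡ all (λ a → all (λ b → increasingAt f a b) (allFin m)) (allFin m)
    increasing-unfold f = refl

  Increasing : ∀ {m n} → Vec (Fin n) m → Set
  Increasing {m} f = ∀ (a b : Fin m) → toℕ a < toℕ b → toℕ (lookup f a) < toℕ (lookup f b)

  increasing⁻ : ∀ {m n} (f : Vec (Fin n) m) → T (increasing f) → Increasing f
  increasing⁻ f h a b a<b = go (all-allFin⁻ _ (all-allFin⁻ _ h a) b)
    where
    go : T (increasingAt f a b) → toℕ (lookup f a) < toℕ (lookup f b)
    go t with toℕ a <ᵇ toℕ b | <⇒<ᵇ a<b
    ... | true | _ = <ᵇ⇒< _ _ t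

  increasing⁺ : ∀ {m n} (f : Vec (Fin n) m) → Increasing f → T (increasing f)
  increasing⁺ f inc = all-allFin⁺ _ (λ a → all-allFin⁺ _ (λ b → go a b))
    where
    go : ∀ a b → T (increasingAt f a b)
    go a b with toℕ a <ᵇ toℕ b in eq
    ... | true  = <⇒<ᵇ (inc a b (<ᵇ⇒< _ _ (subst T (sym eq) tt)))
    ... | false = tt

  infix 4 _⇔ᵇ_
  _⇔ᵇ_ : Bool → Bool → Bool
  true  ⇔ᵇ c = c
  false ⇔ᵇ c = not c

  mutual
    isomorphicAt : ∀ {n m} → (Fin m → ℕ) → Vec (Fin n) n → Vec (Fin n) m → Fin m → Fin m → Bool
    isomorphicAt = _

    occurrences-unfold : ∀ {n m} (τ : Fin m → ℕ) (π : Vec (Fin n) n) →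
      occurrences τ π ≡ count (λ f → increasing f ∧ all (λ a → all (λ b → isomorphicAt τ π f a b) (allFin m)) (allFin m)) (allVecs m n)
    occurrences-unfold τ π = refl

  isomorphicAt-spec : ∀ {n m} (τ : Fin m → ℕ) (π : Vec (Fin n) n) (f : Vec (Fin n) m) a b →
    isomorphicAt τ π f a b ≡ ((toℕ (lookup π (lookup f a)) <ᵇ toℕ (lookup π (lookup f b))) ⇔ᵇ (τ a <ᵇ τ b))
  isomorphicAt-spec τ π f a b with toℕ (lookup π (lookup f a)) <ᵇ toℕ (lookup π (lookup f b))
  ... | true  = refl
  ... | false = refl

  isomorphic : ∀ {m} → (Fin m → ℕ) → Vec ℕ m → Bool
  isomorphic {m} τ s = all (λ a → all (λ b → (lookup s a <ᵇ lookup s b) ⇔ᵇ (τ a <ᵇ τ b)) (allFin m)) (allFin m)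

  values : ∀ {m n} → Vec (Fin n) m → Vec ℕ m
  values = Vec.map toℕ

  all-cong : ∀ {A : Set} {p q : A → Bool} → (∀ x → p x ≡ q x) → ∀ xs → all p xs ≡ all q xs
  all-cong eq []       = refl
  all-cong eq (x ∷ xs) = cong₂ _∧_ (eq x) (all-cong eq xs)

  -- Occurrences with the pattern condition abstracted to a predicate on the chosen values, which
  -- can absorb a first letter that is already fixed.
  subsequences : ∀ {n} m → Vec ℕ n → (Vec ℕ m → Bool) → ℕ
  subsequences {n} m u P = count (λ f → increasing f ∧ P (Vec.map (lookup u) f)) (allVecs m n)

  occurrences-subsequences : ∀ {n m} (τ : Fin m → ℕ) (π : Vec (Fin n) n) →
    occurrences τ π ≡ subsequences m (values π) (isomorphic τ)
  occurrences-subsequences {n} {m} τ π = trans (occurrences-unfold τ π) (count-cong (λ f → cong (increasing f ∧_)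
    (all-cong (λ a → all-cong (λ b → trans (isomorphicAt-spec τ π f a b)
      (cong₂ (λ p q → (p <ᵇ q) ⇔ᵇ (τ a <ᵇ τ b)) (value f a) (value f b))) (allFin m)) (allFin m))) (allVecs m n))
    where
    value : ∀ f a → toℕ (lookup π (lookup f a)) ≡ lookup (Vec.map (lookup (values π)) f) a
    value f a = sym (trans (lookup-map a (lookup (values π)) f) (lookup-map (lookup f a) toℕ π))

  Positive : ∀ {m n} → Vec (Fin (suc n)) m → Set
  Positive f = ∀ b → lookup f b ≢ zero

  sum-cong : ∀ {A : Set} {g h : A → ℕ} → (∀ x → g x ≡ h x) → ∀ xs → sum (map g xs) ≡ sum (map h xs)
  sum-cong eq xs = cong sum (map-cong eq xs)

  -- Increasing vectors whose first index is chosen avoid index zero from then on; this lowers the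
  -- count to one index fewer.
  count-positive : ∀ {n} m (p : Vec (Fin (suc n)) m → Bool) → (∀ f → T (p f) → Positive f) →
                   count p (allVecs m (suc n)) ≡ count (p ∘ Vec.map suc) (allVecs m n)
  count-positive zero p pos rewrite count-∷ p [] [] | count-∷ (p ∘ Vec.map suc) [] [] = refl
  count-positive {n} (suc m) p pos = begin
    count p (allVecs (suc m) (suc n))
      ≡⟨ count-concatMap p (λ x → map (x ∷_) (allVecs m (suc n))) (allFin (suc n)) ⟩
    sum (map (λ x → count p (map (x ∷_) (allVecs m (suc n)))) (allFin (suc n)))
      ≡⟨ sum-allFin-suc (λ x → count p (map (x ∷_) (allVecs m (suc n)))) ⟩
    count p (map (zero ∷_) (allVecs m (suc n))) + sum (map (λ x → count p (map (suc x ∷_) (allVecs m (suc n)))) (allFin n))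
      ≡⟨ cong₂ _+_ (trans (count-map p (zero ∷_) (allVecs m (suc n))) (count-none (p ∘ (zero ∷_)) (λ f → ¬T⇒false (λ t → pos (zero ∷ f) t zero refl)) (allVecs m (suc n))))
                   (sum-cong branch (allFin n)) ⟩
    sum (map (λ x → count (p ∘ Vec.map suc) (map (x ∷_) (allVecs m n))) (allFin n))
      ≡⟨ sym (count-concatMap (p ∘ Vec.map suc) (λ x → map (x ∷_) (allVecs m n)) (allFin n)) ⟩
    count (p ∘ Vec.map suc) (allVecs (suc m) n) ∎
    where
    open ≡-Reasoning
    ¬T⇒false : ∀ {b} → ¬ T b → b ≡ false
    ¬T⇒false {true}  ¬t = ⊥-elim (¬t tt)
    ¬T⇒false {false} ¬t = refl
    branch : ∀ x → count p (map (suc x ∷_) (allVecs m (suc n))) ≡ count (p ∘ Vec.map suc) (map (x ∷_) (allVecs m n))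
    branch x = trans (count-map p (suc x ∷_) (allVecs m (suc n)))
      (trans (count-positive m (p ∘ (suc x ∷_)) (λ f t b → pos (suc x ∷ f) t (suc b)))
        (sym (count-map (p ∘ Vec.map suc) (x ∷_) (allVecs m n))))

  increasing-tail-positive : ∀ {m n} (x : Fin (suc n)) (f : Vec (Fin (suc n)) m) → T (increasing (x ∷ f)) → Positive f
  increasing-tail-positive x f t b eq = <⇒≱ (≤-trans (s≤s z≤n) (increasing⁻ (x ∷ f) t zero (suc b) (s≤s z≤n))) (≤-reflexive (cong toℕ eq))

  increasing-map-suc : ∀ {m n} (f : Vec (Fin n) m) → increasing (Vec.map suc f) ≡ increasing f
  increasing-map-suc f = T-ext
    (λ t → increasing⁺ f (λ a b a<b → ≤-pred (subst₂ _<_ (cong toℕ (lookup-map a suc f)) (cong toℕ (lookup-map b suc f)) (increasing⁻ (Vec.map suc f) t a b a<b))))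
    (λ t → increasing⁺ (Vec.map suc f) (λ a b a<b → subst₂ _<_ (sym (cong toℕ (lookup-map a suc f))) (sym (cong toℕ (lookup-map b suc f))) (s≤s (increasing⁻ f t a b a<b))))

  increasing-zero-∷ : ∀ {m n} (f : Vec (Fin n) m) → increasing (zero ∷ Vec.map suc f) ≡ increasing f
  increasing-zero-∷ f = trans (T-ext
    (λ t → increasing⁺ (Vec.map suc f) (λ a b a<b → increasing⁻ (zero ∷ Vec.map suc f) t (suc a) (suc b) (s≤s a<b)))
    (λ t → increasing⁺ (zero ∷ Vec.map suc f) λ
      { zero    (suc b) _         → subst (0 <_) (sym (cong toℕ (lookup-map b suc f))) (s≤s z≤n)
      ; (suc a) (suc b) (s≤s a<b) → increasing⁻ (Vec.map suc f) t a b a<b }))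
    (increasing-map-suc f)

  lookup-suc : ∀ {m n} x (u : Vec ℕ n) (f : Vec (Fin n) m) → Vec.map (lookup (x ∷ u)) (Vec.map suc f) ≡ Vec.map (lookup u) f
  lookup-suc x u []      = refl
  lookup-suc x u (i ∷ f) = cong (lookup u i ∷_) (lookup-suc x u f)

  -- A Pascal rule: either index zero is chosen and `x` is absorbed into `P`, or the first index is
  -- a successor.
  subsequences-∷ : ∀ {n} m x (u : Vec ℕ n) P →
    subsequences (suc m) (x ∷ u) P ≡ subsequences m u (P ∘ (x ∷_)) + subsequences (suc m) u P
  subsequences-∷ {n} m x u P = begin
    count G (allVecs (suc m) (suc n))
      ≡⟨ count-concatMap G (λ i → map (i ∷_) (allVecs m (suc n))) (allFin (suc n)) ⟩
    sum (map (λ i → count G (map (i ∷_) (allVecs m (suc n)))) (allFin (suc n)))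
      ≡⟨ sum-allFin-suc (λ i → count G (map (i ∷_) (allVecs m (suc n)))) ⟩
    count G (map (zero ∷_) (allVecs m (suc n))) + sum (map (λ i → count G (map (suc i ∷_) (allVecs m (suc n)))) (allFin n))
      ≡⟨ cong₂ _+_ (trans (lift zero) (count-cong (λ f → cong₂ (λ p s → p ∧ P (x ∷ s)) (increasing-zero-∷ f) (lookup-suc x u f)) (allVecs m n)))
                   (sum-cong (λ i → trans (lift (suc i)) (trans (count-cong (λ f → cong₂ (λ p s → p ∧ P s) (increasing-map-suc (i ∷ f)) (lookup-suc x u (i ∷ f))) (allVecs m n))
                     (sym (count-map (λ f → increasing f ∧ P (Vec.map (lookup u) f)) (i ∷_) (allVecs m n))))) (allFin n)) ⟩
    subsequences m u (P ∘ (x ∷_)) + sum (map (λ i → count H (map (i ∷_) (allVecs m n))) (allFin n))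
      ≡⟨ cong (subsequences m u (P ∘ (x ∷_)) +_) (sym (count-concatMap H (λ i → map (i ∷_) (allVecs m n)) (allFin n))) ⟩
    subsequences m u (P ∘ (x ∷_)) + subsequences (suc m) u P ∎
    where
    open ≡-Reasoning
    G : Vec (Fin (suc n)) (suc m) → Bool
    G f = increasing f ∧ P (Vec.map (lookup (x ∷ u)) f)
    H : Vec (Fin n) (suc m) → Bool
    H f = increasing f ∧ P (Vec.map (lookup u) f)
    -- Whatever the first index is, the later ones exceed it and are therefore successors.
    lift : ∀ i → count G (map (i ∷_) (allVecs m (suc n))) ≡ count (λ f → G (i ∷ Vec.map suc f)) (allVecs m n)
    lift i = trans (count-map G (i ∷_) (allVecs m (suc n)))
      (count-positive m (G ∘ (i ∷_)) (λ f t → increasing-tail-positive i f (proj₁ (T-∧-elim t))))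

  countSub : ∀ m → List ℕ → (Vec ℕ m → Bool) → ℕ
  countSub zero    w       P = if P [] then 1 else 0
  countSub (suc m) []      P = 0
  countSub (suc m) (x ∷ w) P = countSub m w (P ∘ (x ∷_)) + countSub (suc m) w P

  subsequences-countSub : ∀ {n} m (u : Vec ℕ n) P → subsequences m u P ≡ countSub m (toList u) P
  subsequences-countSub zero    u       P = trans (count-∷ (λ f → increasing f ∧ P (Vec.map (lookup u) f)) [] []) (+-identityʳ _)
  subsequences-countSub (suc m) []      P = refl
  subsequences-countSub (suc m) (x ∷ u) P = trans (subsequences-∷ m x u P)
    (cong₂ _+_ (subsequences-countSub m u (P ∘ (x ∷_))) (subsequences-countSub (suc m) u P))

  occurrences-countSub : ∀ {n m} (τ : Fin m → ℕ) (π : Vec (Fin n) n) →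
    occurrences τ π ≡ countSub m (toList (values π)) (isomorphic τ)
  occurrences-countSub {m = m} τ π = trans (occurrences-subsequences τ π) (subsequences-countSub m (values π) (isomorphic τ))

  countSub-cong : ∀ m w {P Q} → (∀ s → P s ≡ Q s) → countSub m w P ≡ countSub m w Q
  countSub-cong zero    w       eq = cong (if_then 1 else 0) (eq [])
  countSub-cong (suc m) []      eq = refl
  countSub-cong (suc m) (x ∷ w) eq = cong₂ _+_ (countSub-cong m w (λ s → eq (x ∷ s))) (countSub-cong (suc m) w eq)

  countSub-∧ : ∀ m w c {P} → countSub m w (λ s → c ∧ P s) ≡ (if c then countSub m w P else 0)
  countSub-∧ m       w       true  = refl
  countSub-∧ zero    w       false = refl
  countSub-∧ (suc m) []      false = refl
  countSub-∧ (suc m) (x ∷ w) false {P} = cong₂ _+_ (countSub-∧ m w false {P ∘ (x ∷_)}) (countSub-∧ (suc m) w false {P})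

  chainAbove : ∀ {m} → ℕ → Vec ℕ m → Bool
  chainAbove a []      = true
  chainAbove a (z ∷ s) = (a <ᵇ z) ∧ chainAbove z s

  countSub-chainAbove : ∀ m a w → countSub m w (chainAbove a) ≡ increasingAbove m a w
  countSub-chainAbove zero    a w       = refl
  countSub-chainAbove (suc m) a []      = refl
  countSub-chainAbove (suc m) a (x ∷ w) = cong₂ _+_
    (trans (countSub-∧ m w (a <ᵇ x)) (cong (if a <ᵇ x then_else 0) (countSub-chainAbove m x w)))
    (countSub-chainAbove (suc m) a w)

  countSub-occAfter : ∀ l x w {P : Vec ℕ (suc l) → Bool} → (∀ y z → P (y ∷ z) ≡ (y <ᵇ x) ∧ chainAbove x z) →
                      countSub (suc l) w P ≡ occAfter l x w
  countSub-occAfter l x []      eq = refl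
  countSub-occAfter l x (y ∷ w) eq = cong₂ _+_
    (trans (countSub-cong l w (eq y)) (trans (countSub-∧ l w (y <ᵇ x)) (cong (if y <ᵇ x then_else 0) (countSub-chainAbove l x w))))
    (countSub-occAfter l x w eq)

  chainAbove⁺ : ∀ {m} a (z : Vec ℕ m) → (∀ i → a < lookup z i) → (∀ i j → toℕ i < toℕ j → lookup z i < lookup z j) → T (chainAbove a z)
  chainAbove⁺ a []      above inc = tt
  chainAbove⁺ a (x ∷ z) above inc = T-∧-intro (<⇒<ᵇ (above zero))
    (chainAbove⁺ x z (λ i → inc zero (suc i) (s≤s z≤n)) (λ i j i<j → inc (suc i) (suc j) (s≤s i<j)))

  chainAbove⁻ : ∀ {m} a (z : Vec ℕ m) → T (chainAbove a z) → (∀ i → a < lookup z i) × (∀ i j → toℕ i < toℕ j → lookup z i < lookup z j)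
  chainAbove⁻ a []      t = (λ ()) , (λ ())
  chainAbove⁻ a (x ∷ z) t with T-∧-elim {a <ᵇ x} t
  ... | a<x , t′ with chainAbove⁻ x z t′
  ...   | above , inc = (λ { zero → <ᵇ⇒< _ _ a<x ; (suc i) → <-trans (<ᵇ⇒< _ _ a<x) (above i) })
                      , (λ { zero (suc j) _ → above j ; (suc i) (suc j) (s≤s i<j) → inc i j i<j })

  isomorphic⁻ : ∀ {m} (τ : Fin m → ℕ) s → T (isomorphic τ s) → ∀ a b → (lookup s a <ᵇ lookup s b) ≡ (τ a <ᵇ τ b)
  isomorphic⁻ τ s t a b = go (all-allFin⁻ _ (all-allFin⁻ _ t a) b)
    where
    go : ∀ {p q} → T (p ⇔ᵇ q) → p ≡ q
    go {true}  {true}  _ = refl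
    go {false} {false} _ = refl

  isomorphic⁺ : ∀ {m} (τ : Fin m → ℕ) s → (∀ a b → (lookup s a <ᵇ lookup s b) ≡ (τ a <ᵇ τ b)) → T (isomorphic τ s)
  isomorphic⁺ τ s eq = all-allFin⁺ _ (λ a → all-allFin⁺ _ (λ b → go (eq a b)))
    where
    go : ∀ {p q} → p ≡ q → T (p ⇔ᵇ q)
    go {true}  refl = tt
    go {false} refl = tt

  isomorphic-< : ∀ {m} (τ : Fin m → ℕ) s → T (isomorphic τ s) → ∀ a b → τ a < τ b → lookup s a < lookup s b
  isomorphic-< τ s t a b τa<τb = <ᵇ⇒< _ _ (subst T (sym (isomorphic⁻ τ s t a b)) (<⇒<ᵇ τa<τb))

  both-< : ∀ {p q r s} → p < q → r < s → (p <ᵇ q) ≡ (r <ᵇ s)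
  both-< p<q r<s = trans (<ᵇ-true p<q) (sym (<ᵇ-true r<s))

  both-≤ : ∀ {p q r s} → q ≤ p → s ≤ r → (p <ᵇ q) ≡ (r <ᵇ s)
  both-≤ q≤p s≤r = trans (<ᵇ-false q≤p) (sym (<ᵇ-false s≤r))

  -- Order isomorphism compares all pairs of letters; conversely, the descent and the chain of
  -- neighbours give all these comparisons by transitivity.
  isomorphic-2134 : ∀ {l} x y (z : Vec ℕ l) → isomorphic (p2134 (suc (suc l))) (x ∷ y ∷ z) ≡ (y <ᵇ x) ∧ chainAbove x z
  isomorphic-2134 {l} x y z = T-ext to from
    where
    τ : Fin (suc (suc l)) → ℕ
    τ = p2134 (suc (suc l))
    to : T (isomorphic τ (x ∷ y ∷ z)) → T ((y <ᵇ x) ∧ chainAbove x z)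
    to t = T-∧-intro (<⇒<ᵇ (less (suc zero) zero (s≤s z≤n)))
      (chainAbove⁺ x z (λ i → less zero (suc (suc i)) (s≤s (s≤s z≤n))) (λ i j i<j → less (suc (suc i)) (suc (suc j)) (s≤s (s≤s i<j))))
      where
      less : ∀ a b → τ a < τ b → lookup (x ∷ y ∷ z) a < lookup (x ∷ y ∷ z) b
      less = isomorphic-< τ (x ∷ y ∷ z) t
    from : T ((y <ᵇ x) ∧ chainAbove x z) → T (isomorphic τ (x ∷ y ∷ z))
    from t with T-∧-elim {y <ᵇ x} t
    ... | t₁ , t₂ with <ᵇ⇒< y x t₁ | chainAbove⁻ x z t₂
    ...   | y<x | above , inc = isomorphic⁺ τ (x ∷ y ∷ z) table
      where
      table : ∀ a b → (lookup (x ∷ y ∷ z) a <ᵇ lookup (x ∷ y ∷ z) b) ≡ (τ a <ᵇ τ b)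
      table zero          zero          = both-≤ {x} {x} {1} {1} ≤-refl ≤-refl
      table zero          (suc zero)    = both-≤ {x} {y} {1} {0} (<⇒≤ y<x) z≤n
      table zero          (suc (suc j)) = both-< {x} {lookup z j} {1} {2 + toℕ j} (above j) (s≤s (s≤s z≤n))
      table (suc zero)    zero          = both-< {y} {x} {0} {1} y<x (s≤s z≤n)
      table (suc zero)    (suc zero)    = both-≤ {y} {y} {0} {0} ≤-refl ≤-refl
      table (suc zero)    (suc (suc j)) = both-< {y} {lookup z j} {0} {2 + toℕ j} (<-trans y<x (above j)) (s≤s z≤n)
      table (suc (suc i)) zero          = both-≤ {lookup z i} {x} {2 + toℕ i} {1} (<⇒≤ (above i)) (s≤s z≤n)
      table (suc (suc i)) (suc zero)    = both-≤ {lookup z i} {y} {2 + toℕ i} {0} (<⇒≤ (<-trans y<x (above i))) z≤n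
      table (suc (suc i)) (suc (suc j)) with <-cmp (toℕ i) (toℕ j)
      ... | tri< i<j _ _ = both-< (inc i j i<j) (s≤s (s≤s i<j))
      ... | tri> _ _ j<i = both-≤ (<⇒≤ (inc j i j<i)) (s≤s (s≤s (<⇒≤ j<i)))
      ... | tri≈ _ i≡j _ with toℕ-injective i≡j
      ...   | refl = both-≤ {lookup z i} {lookup z i} {toℕ i} {toℕ i} ≤-refl ≤-refl

  countSub-2134 : ∀ l w → countSub (suc (suc l)) w (isomorphic (p2134 (suc (suc l)))) ≡ occW l w
  countSub-2134 l []      = refl
  countSub-2134 l (x ∷ w) = cong₂ _+_ (countSub-occAfter l x w (isomorphic-2134 x)) (countSub-2134 l w)

  occurrences-2134 : ∀ {n} l (π : Vec (Fin n) n) → occurrences (p2134 (suc (suc l))) π ≡ occW l (toList (values π))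
  occurrences-2134 l π = trans (occurrences-countSub (p2134 (suc (suc l))) π) (countSub-2134 l (toList (values π)))

  isomorphic-132 : ∀ x y z → isomorphic p132 (x ∷ y ∷ z ∷ []) ≡ (x <ᵇ z) ∧ (z <ᵇ y)
  isomorphic-132 x y z = T-ext to from
    where
    s : Vec ℕ 3
    s = x ∷ y ∷ z ∷ []
    to : T (isomorphic p132 s) → T ((x <ᵇ z) ∧ (z <ᵇ y))
    to t = T-∧-intro (<⇒<ᵇ (isomorphic-< p132 s t zero (suc (suc zero)) (s≤s z≤n)))
                     (<⇒<ᵇ (isomorphic-< p132 s t (suc (suc zero)) (suc zero) (s≤s (s≤s z≤n))))
    from : T ((x <ᵇ z) ∧ (z <ᵇ y)) → T (isomorphic p132 s)
    from t with T-∧-elim {x <ᵇ z} t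
    ... | t₁ , t₂ with <ᵇ⇒< x z t₁ | <ᵇ⇒< z y t₂
    ...   | x<z | z<y = isomorphic⁺ p132 s λ
      { zero             zero             → both-≤ {x} {x} {0} {0} ≤-refl ≤-refl
      ; zero             (suc zero)       → both-< {x} {y} {0} {2} (<-trans x<z z<y) (s≤s z≤n)
      ; zero             (suc (suc zero)) → both-< {x} {z} {0} {1} x<z (s≤s z≤n)
      ; (suc zero)       zero             → both-≤ {y} {x} {2} {0} (<⇒≤ (<-trans x<z z<y)) z≤n
      ; (suc zero)       (suc zero)       → both-≤ {y} {y} {2} {2} ≤-refl ≤-refl
      ; (suc zero)       (suc (suc zero)) → both-≤ {y} {z} {2} {1} (<⇒≤ z<y) (s≤s z≤n)
      ; (suc (suc zero)) zero             → both-≤ {z} {x} {1} {0} (<⇒≤ x<z) z≤n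
      ; (suc (suc zero)) (suc zero)       → both-< {z} {y} {1} {2} z<y (s≤s (s≤s z≤n))
      ; (suc (suc zero)) (suc (suc zero)) → both-≤ {z} {z} {1} {1} ≤-refl ≤-refl }

  -- A sum of natural numbers vanishes only if every summand does, so a zero count is a statement
  -- about all subsequences.
  no32⇔countSub : ∀ a w → (countSub 2 w (λ s → isomorphic p132 (a ∷ s)) ≡ 0 → No32Above a w)
                        × (No32Above a w → countSub 2 w (λ s → isomorphic p132 (a ∷ s)) ≡ 0)
  no32⇔countSub a []      = (λ _ → tt) , (λ _ → refl)
  no32⇔countSub a (y ∷ w) =
    (λ eq → (λ _ → to w (m+n≡0⇒m≡0 _ eq)) , proj₁ (no32⇔countSub a w) (m+n≡0⇒n≡0 (countSub 1 w _) eq))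
    , (λ { (p , q) → cong₂ _+_ (from w p) (proj₂ (no32⇔countSub a w) q) })
    where
    to : ∀ w → countSub 1 w (λ s → isomorphic p132 (a ∷ y ∷ s)) ≡ 0 → All (λ z → a < z → ¬ z < y) w
    to []      _  = []
    to (z ∷ w) eq = (λ a<z z<y → contra a<z z<y (m+n≡0⇒m≡0 (if isomorphic p132 (a ∷ y ∷ z ∷ []) then 1 else 0) eq))
                    ∷ to w (m+n≡0⇒n≡0 (if isomorphic p132 (a ∷ y ∷ z ∷ []) then 1 else 0) eq)
      where
      contra : a < z → z < y → (if isomorphic p132 (a ∷ y ∷ z ∷ []) then 1 else 0) ≢ 0
      contra a<z z<y rewrite isomorphic-132 a y z | <ᵇ-true a<z | <ᵇ-true z<y = λ ()
    from : ∀ w → (a < y → All (λ z → a < z → ¬ z < y) w) → countSub 1 w (λ s → isomorphic p132 (a ∷ y ∷ s)) ≡ 0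
    from []      _ = refl
    from (z ∷ w) p = cong₂ _+_ none (from w (λ a<y → All.tail (p a<y)))
      where
      none : (if isomorphic p132 (a ∷ y ∷ z ∷ []) then 1 else 0) ≡ 0
      none rewrite isomorphic-132 a y z with a <ᵇ z in eq₁ | z <ᵇ y in eq₂
      ... | false | _     = refl
      ... | true  | false = refl
      ... | true  | true  = ⊥-elim (All.head (p (<-trans a<z z<y)) a<z z<y)
        where
        a<z : a < z
        a<z = <ᵇ⇒< a z (subst T (sym eq₁) tt)
        z<y : z < y
        z<y = <ᵇ⇒< z y (subst T (sym eq₂) tt)

  avoids132⇔countSub : ∀ w → (countSub 3 w (isomorphic p132) ≡ 0 → Avoids132 w) × (Avoids132 w → countSub 3 w (isomorphic p132) ≡ 0)
  avoids132⇔countSub []      = (λ _ → tt) , (λ _ → refl)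
  avoids132⇔countSub (x ∷ w) =
    (λ eq → proj₁ (no32⇔countSub x w) (m+n≡0⇒m≡0 _ eq)
          , proj₁ (avoids132⇔countSub w) (m+n≡0⇒n≡0 (countSub 2 w (λ s → isomorphic p132 (x ∷ s))) eq))
    , (λ { (p , q) → cong₂ _+_ (proj₂ (no32⇔countSub x w) p) (proj₂ (avoids132⇔countSub w) q) })

-- Matching the counted involutions with palindromes.

module Counting where
  open Trees
  open Words
  open Completeness
  open Patterns
  open Enumeration
  open GeneratingFunctions using (wsum; ind; evenHit; palindrome-count)
  open import Data.Bool using (Bool; true; false; T; T?; _∧_; if_then_else_)
  open import Data.Empty using (⊥-elim)
  open import Data.Fin as Fin using (Fin; zero; suc; toℕ; fromℕ<)
  open import Data.Fin.Properties using (toℕ-injective; toℕ<n; toℕ-fromℕ<)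
  open import Data.Integer as ℤ using (+_)
  import Data.Integer.Properties as ℤ
  open import Data.List as List using (List; []; _∷_; map; concatMap; allFin; filterᵇ; length)
  open import Data.List.Properties using (length-map; map-id; map-cong)
  open import Data.List.Membership.Propositional using (_∈_; lose)
  open import Data.List.Membership.Propositional.Properties using (∈-map⁺; ∈-map⁻; ∈-filter⁺; ∈-filter⁻; ∈-concatMap⁺; ∈-allFin)
  open import Data.List.Relation.Unary.All as All using (All; []; _∷_)
  open import Data.List.Relation.Unary.AllPairs using ([]; _∷_)
  open import Data.List.Relation.Unary.Any using (here; there)
  open import Data.List.Relation.Unary.Unique.Propositional using (Unique)
  import Data.List.Relation.Unary.Unique.Propositional.Properties as Unique
  open import Data.Nat as ℕ using (ℕ; zero; suc; _+_; _<_; _<ᵇ_; _≡ᵇ_; z≤n; s≤s)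
  open import Data.Nat.ListAction using (sum)
  open import Data.Nat.Properties
  open import Data.Product using (_×_; _,_; proj₁; proj₂; ∃)
  open import Data.Rational as ℚ using (ℚ; 1ℚ)
  import Data.Rational.Properties as ℚ
  import Data.Rational.Unnormalised as ℚᵘ
  import Data.Rational.Unnormalised.Properties as ℚᵘ
  open import Data.Unit using (tt)
  open import Data.Vec as Vec using (Vec; []; _∷_; lookup; toList)
  open import Data.Vec.Properties using (lookup-map; ∷-injective)
  open import Function using (_∘_)
  open import Relation.Binary.PropositionalEquality

  wordOf : ∀ {m n} → Vec (Fin n) m → List ℕ
  wordOf π = toList (values π)

  -- `C` is arbitrary because `inversions` uses a local record of pairs; its predicate and
  -- constructor are then found by unification.
  count-concatMap-map : ∀ {A B C : Set} (p : C → Bool) (g : A → B → C) (ys : List B) xs →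
    count p (concatMap (λ x → map (g x) ys) xs) ≡ sum (map (λ x → count (λ y → p (g x y)) ys) xs)
  count-concatMap-map p g ys xs = trans (count-concatMap p (λ x → map (g x) ys) xs) (sum-cong (λ x → count-map p (g x) ys) xs)

  invertedAt : ∀ {m} → Vec ℕ m → Fin m → Fin m → Bool
  invertedAt u i j = (toℕ i <ᵇ toℕ j) ∧ (lookup u j <ᵇ lookup u i)

  count-below : ∀ {m} (u : Vec ℕ m) x → count (λ j → lookup u j <ᵇ x) (allFin m) ≡ occAfter 0 x (toList u)
  count-below []      x = refl
  count-below (z ∷ u) x = trans (count-allFin-suc (λ j → lookup (z ∷ u) j <ᵇ x)) (cong (λ c → (if z <ᵇ x then 1 else 0) + c) (count-below u x))

  -- Row zero counts the later entries below `x`. In the other rows column zero drops out, as no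
  -- index precedes zero.
  sum-inverted : ∀ {m} (u : Vec ℕ m) → sum (map (λ i → count (invertedAt u i) (allFin m)) (allFin m)) ≡ occW 0 (toList u)
  sum-inverted []              = refl
  sum-inverted {suc m} (x ∷ u) = trans (sum-allFin-suc (λ i → count (invertedAt (x ∷ u) i) (allFin (suc m))))
    (cong₂ _+_ (trans (count-allFin-suc (invertedAt (x ∷ u) zero)) (count-below u x))
      (trans (sum-cong (λ i → count-allFin-suc (invertedAt (x ∷ u) (suc i))) (allFin m)) (sum-inverted u)))

  inversions-occW : ∀ {n} (π : Vec (Fin n) n) → inversions π ≡ occW 0 (wordOf π)
  inversions-occW {n} π = trans (count-concatMap-map _ _ (allFin n) (allFin n))
    (trans (sum-cong (λ i → count-cong (λ j → cong₂ (λ p q → (toℕ i <ᵇ toℕ j) ∧ (p <ᵇ q)) (sym (lookup-map j toℕ π)) (sym (lookup-map i toℕ π))) (allFin n)) (allFin n))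
      (sum-inverted (values π)))

  mutual
    injectiveAt : ∀ {n} → Vec (Fin n) n → Fin n → Fin n → Bool
    injectiveAt = _

    isPerm-unfold : ∀ {n} (π : Vec (Fin n) n) → isPerm π ≡ all (λ i → all (λ j → injectiveAt π i j) (allFin n)) (allFin n)
    isPerm-unfold π = refl

  isPerm⁻ : ∀ {n} (π : Vec (Fin n) n) → T (isPerm π) → ∀ i j → lookup π i ≡ lookup π j → i ≡ j
  isPerm⁻ π t i j eq = go (all-allFin⁻ _ (all-allFin⁻ _ t i) j)
    where
    go : T (injectiveAt π i j) → i ≡ j
    go t with toℕ i ≡ᵇ toℕ j in i≡ᵇj
    ... | true = toℕ-injective (≡ᵇ⇒≡ _ _ (subst T (sym i≡ᵇj) tt))
    ... | false rewrite eq with toℕ (lookup π j) ≡ᵇ toℕ (lookup π j) | ≡⇒≡ᵇ (toℕ (lookup π j)) _ refl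
    ...   | true | _ = ⊥-elim t

  isPerm⁺ : ∀ {n} (π : Vec (Fin n) n) → (∀ i j → lookup π i ≡ lookup π j → i ≡ j) → T (isPerm π)
  isPerm⁺ π inj = all-allFin⁺ _ (λ i → all-allFin⁺ _ (λ j → go i j))
    where
    go : ∀ i j → T (injectiveAt π i j)
    go i j with toℕ i ≡ᵇ toℕ j in i≡ᵇj
    ... | true  = tt
    ... | false with toℕ (lookup π i) ≡ᵇ toℕ (lookup π j) in eq
    ...   | false = tt
    ...   | true  = subst T i≡ᵇj (≡⇒≡ᵇ _ _ (cong toℕ (inj i j (toℕ-injective (≡ᵇ⇒≡ _ _ (subst T (sym eq) tt))))))

  isInvolution⁻ : ∀ {n} (π : Vec (Fin n) n) → T (isInvolution π) → ∀ i → lookup π (lookup π i) ≡ i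
  isInvolution⁻ π t i = toℕ-injective (≡ᵇ⇒≡ _ _ (all-allFin⁻ _ t i))

  isInvolution⁺ : ∀ {n} (π : Vec (Fin n) n) → (∀ i → lookup π (lookup π i) ≡ i) → T (isInvolution π)
  isInvolution⁺ π inv = all-allFin⁺ _ (λ i → ≡⇒≡ᵇ _ _ (cong toℕ (inv i)))

  wordOf-[]=⁺ : ∀ {m n} (π : Vec (Fin n) m) i → wordOf π [ toℕ i ]= toℕ (lookup π i)
  wordOf-[]=⁺ (x ∷ π) zero    = here
  wordOf-[]=⁺ (x ∷ π) (suc i) = there (wordOf-[]=⁺ π i)

  wordOf-[]=⁻ : ∀ {m n} (π : Vec (Fin n) m) {k x} → wordOf π [ k ]= x → ∃ λ i → toℕ i ≡ k × toℕ (lookup π i) ≡ x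
  wordOf-[]=⁻ (y ∷ π) here      = zero , refl , refl
  wordOf-[]=⁻ (y ∷ π) (there p) with wordOf-[]=⁻ π p
  ... | i , refl , refl = suc i , refl , refl

  []=-functional : ∀ {w i x y} → w [ i ]= x → w [ i ]= y → x ≡ y
  []=-functional here      here      = refl
  []=-functional (there p) (there q) = []=-functional p q

  wordOf-∈ : ∀ {m n} (π : Vec (Fin n) m) {x} → x ∈ wordOf π → ∃ λ i → toℕ (lookup π i) ≡ x
  wordOf-∈ (y ∷ π) (here refl) = zero , refl
  wordOf-∈ (y ∷ π) (there x∈)  with wordOf-∈ π x∈
  ... | i , eq = suc i , eq

  wordOf-unique : ∀ {m n} (π : Vec (Fin n) m) → (∀ i j → lookup π i ≡ lookup π j → i ≡ j) → Unique (wordOf π)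
  wordOf-unique []      inj = []
  wordOf-unique (x ∷ π) inj = All.tabulate fresh ∷ wordOf-unique π (λ i j eq → suc-inj (inj (suc i) (suc j) eq))
    where
    suc-inj : ∀ {n} {i j : Fin n} → Fin.suc i ≡ suc j → i ≡ j
    suc-inj refl = refl
    fresh : ∀ {y} → y ∈ wordOf π → toℕ x ≢ y
    fresh y∈ x≡y with wordOf-∈ π y∈
    ... | i , eq with inj zero (suc i) (toℕ-injective (trans x≡y (sym eq)))
    ...   | ()

  wordOf-injective : ∀ {m n} {π ρ : Vec (Fin n) m} → wordOf π ≡ wordOf ρ → π ≡ ρ
  wordOf-injective {π = []}    {[]}    _  = refl
  wordOf-injective {π = x ∷ π} {y ∷ ρ} eq with List-∷-injective eq
    where open import Data.List.Properties using () renaming (∷-injective to List-∷-injective)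
  ... | x≡y , eq′ = cong₂ _∷_ (toℕ-injective x≡y) (wordOf-injective eq′)

  length-wordOf : ∀ {m n} (π : Vec (Fin n) m) → length (wordOf π) ≡ m
  length-wordOf []      = refl
  length-wordOf (x ∷ π) = cong suc (length-wordOf π)

  wordOf-within : ∀ {m n} (π : Vec (Fin n) m) → Within 0 n (wordOf π)
  wordOf-within []      = []
  wordOf-within (x ∷ π) = (z≤n , toℕ<n x) ∷ wordOf-within π

  wordOf-surjective : ∀ {n} w → All (_< n) w → ∃ λ (π : Vec (Fin n) (length w)) → wordOf π ≡ w
  wordOf-surjective []      []        = [] , refl
  wordOf-surjective (x ∷ w) (x<n ∷ p) with wordOf-surjective w p
  ... | π , eq = fromℕ< x<n ∷ π , cong₂ _∷_ (toℕ-fromℕ< x<n) eq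

  ∈-allVecs : ∀ {m n} (π : Vec (Fin n) m) → π ∈ allVecs m n
  ∈-allVecs []              = here refl
  ∈-allVecs {suc m} {n} (x ∷ π) = ∈-concatMap⁺ (λ x → map (x ∷_) (allVecs m n)) {allFin n} (lose (∈-allFin x) (∈-map⁺ (x ∷_) (∈-allVecs π)))

  allVecs-unique : ∀ m n → Unique (allVecs m n)
  allVecs-unique zero    n = [] ∷ []
  allVecs-unique (suc m) n = concatMap-unique (λ x → map (x ∷_) (allVecs m n)) {allFin n} (Unique.allFin⁺ n)
    (λ x → Unique.map⁺ (proj₂ ∘ ∷-injective) (allVecs-unique m n)) same-head
    where
    same-head : ∀ {x y} {π : Vec (Fin n) (suc m)} → π ∈ map (x ∷_) (allVecs m n) → π ∈ map (y ∷_) (allVecs m n) → x ≡ y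
    same-head {x} {y} p q with ∈-map⁻ (x ∷_) p | ∈-map⁻ (y ∷_) q
    ... | _ , _ , refl | _ , _ , refl = refl

  filterᵇ-unique : ∀ {A : Set} (p : A → Bool) {xs} → Unique xs → Unique (filterᵇ p xs)
  filterᵇ-unique p = Unique.filter⁺ (T? ∘ p)

  -- Equal cardinality without a map between the two lists: both are named injectively in `C`, and
  -- the sets of names coincide.
  length-by-names : ∀ {A B C : Set} (f : A → C) (g : B → C) {xs ys} → Unique (map f xs) → Unique (map g ys) →
    (∀ {x} → x ∈ xs → f x ∈ map g ys) → (∀ {y} → y ∈ ys → g y ∈ map f xs) → length xs ≡ length ys
  length-by-names f g {xs} {ys} uf ug to from = trans (sym (length-map f xs)) (trans
    (≤-antisym (unique-length-≤ (map g ys) uf (λ z∈ → let x , x∈ , eq = ∈-map⁻ f z∈ in subst (_∈ map g ys) (sym eq) (to x∈)))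
               (unique-length-≤ (map f xs) ug (λ z∈ → let y , y∈ , eq = ∈-map⁻ g z∈ in subst (_∈ map f xs) (sym eq) (from y∈))))
    (length-map g ys))

  -- The predicate inside `Ie`, given a name; `Ie` unfolds to it by computation.
  counted : ∀ l {n} → Vec (Fin n) n → Bool
  counted l π = isPerm π ∧ isInvolution π ∧ isEven (inversions π)
                ∧ (occurrences p132 π ≡ᵇ 0) ∧ (occurrences (p2134 (suc (suc l))) π ≡ᵇ 1)

  evenHit-wordOf : ∀ l {n} (π : Vec (Fin n) n) t → wordOf π ≡ word t →
    evenHit l t ≡ isEven (inversions π) ∧ (occurrences (p2134 (suc (suc l))) π ≡ᵇ 1)
  evenHit-wordOf l π t eq = cong₂ (λ p q → isEven p ∧ (q ≡ᵇ 1))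
    (sym (trans (inversions-occW π) (trans (cong (occW 0) eq) (occW-word 0 t))))
    (sym (trans (occurrences-2134 l π) (trans (cong (occW l) eq) (occW-word l t))))

  -- Avoidance of 132 provides a tree, being an involution makes that tree equal to its mirror
  -- image, and such trees are coded by palindromes.
  palindrome-of-counted : ∀ l {n} (π : Vec (Fin n) n) → T (counted l π) →
                          ∃ λ s → wordOf π ≡ word (toTree s) × sizeP s ≡ n × T (evenHit l (toTree s))
  palindrome-of-counted l {n} π t with T-∧-elim {isPerm π} t
  ... | perm , t₁ with T-∧-elim {isInvolution π} t₁
  ...   | involution , t₂ with T-∧-elim {isEven (inversions π)} t₂
  ...     | even , t₃ with T-∧-elim {occurrences p132 π ≡ᵇ 0} t₃
  ...       | avoiding , one
    with tree-of-word n 0 (wordOf π) (≤-reflexive (length-wordOf π)) (wordOf-unique π (isPerm⁻ π perm))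
           (subst (λ m → Within 0 m (wordOf π)) (sym (length-wordOf π)) (wordOf-within π))
           (proj₁ (avoids132⇔countSub (wordOf π)) (trans (sym (occurrences-countSub p132 π)) (≡ᵇ⇒≡ _ _ avoiding)))
  ...         | t , eq = finish (palindrome-tree (size t) t ≤-refl (word-involution t involutive))
    where
    w≡ : wordOf π ≡ word t
    w≡ = trans eq (trans (map-cong (λ _ → refl) (word t)) (map-id (word t)))
    involutive : ∀ {i x} → word t [ i ]= x → word t [ x ]= i
    involutive p with wordOf-[]=⁻ π (subst (_[ _ ]= _) (sym w≡) p)
    ... | i , refl , refl = subst (_[ toℕ (lookup π i) ]= toℕ i) w≡
      (subst (λ j → wordOf π [ toℕ (lookup π i) ]= toℕ j) (isInvolution⁻ π involution i) (wordOf-[]=⁺ π (lookup π i)))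
    finish : (∃ λ s → toTree s ≡ t) → ∃ λ s → wordOf π ≡ word (toTree s) × sizeP s ≡ n × T (evenHit l (toTree s))
    finish (s , refl) = s , w≡
      , trans (sym (size-toTree s)) (trans (sym (length-word (toTree s))) (trans (cong length (sym w≡)) (length-wordOf π)))
      , subst T (sym (evenHit-wordOf l π (toTree s) w≡)) (T-∧-intro even one)

  counted-of-palindrome : ∀ l s → T (evenHit l (toTree s)) →
                          ∃ λ (π : Vec (Fin (sizeP s)) (sizeP s)) → wordOf π ≡ word (toTree s) × T (counted l π)
  counted-of-palindrome l s hit = π , w≡ , T-∧-intro perm (T-∧-intro involution
      (subst T (sym (∧-rearrange (isEven (inversions π)) (occurrences p132 π ≡ᵇ 0) _)) (T-∧-intro avoiding
        (subst T (evenHit-wordOf l π t w≡) hit))))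
    where
    t : Tree
    t = toTree s
    vector : ∃ λ (π : Vec (Fin (sizeP s)) (sizeP s)) → wordOf π ≡ word t
    vector = subst (λ m → ∃ λ (π : Vec (Fin (sizeP s)) m) → wordOf π ≡ word t) (trans (length-word t) (size-toTree s))
      (wordOf-surjective (word t) (subst (λ m → All (_< m) (word t)) (size-toTree s) (word-bound t)))
    π : Vec (Fin (sizeP s)) (sizeP s)
    π = proj₁ vector
    w≡ : wordOf π ≡ word t
    w≡ = proj₂ vector
    -- The symmetric tree `t` has the same word as its mirror image, in which positions and values
    -- are exchanged.
    swap : ∀ i → wordOf π [ toℕ (lookup π i) ]= toℕ i
    swap i = subst (_[ toℕ (lookup π i) ]= toℕ i) (sym (trans w≡ (cong word (sym (mirror-toTree s)))))
      (word-mirror t (subst (_[ toℕ i ]= toℕ (lookup π i)) w≡ (wordOf-[]=⁺ π i)))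
    involutive : ∀ i → lookup π (lookup π i) ≡ i
    involutive i = toℕ-injective ([]=-functional (wordOf-[]=⁺ π (lookup π i)) (swap i))
    involution : T (isInvolution π)
    involution = isInvolution⁺ π involutive
    perm : T (isPerm π)
    perm = isPerm⁺ π (λ i j eq → trans (sym (involutive i)) (trans (cong (lookup π) eq) (involutive j)))
    avoiding : T (occurrences p132 π ≡ᵇ 0)
    avoiding = ≡⇒≡ᵇ _ _ (trans (occurrences-countSub p132 π)
      (proj₂ (avoids132⇔countSub (wordOf π)) (subst Avoids132 (sym w≡) (word-avoids132 t))))
    ∧-rearrange : ∀ b c d → (b ∧ c ∧ d) ≡ (c ∧ b ∧ d)
    ∧-rearrange true  c d = refl
    ∧-rearrange false true  d = refl
    ∧-rearrange false false d = refl

  -- One-line words serve as the common names of permutations and palindromes.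
  Ie-palindromes : ∀ l n → Ie (p2134 (suc (suc l))) 1 n ≡ count (evenHit l ∘ toTree) (palindromes n)
  Ie-palindromes l n = length-by-names wordOf (word ∘ toTree)
    (Unique.map⁺ wordOf-injective (filterᵇ-unique (counted l) (allVecs-unique n n)))
    (Unique.map⁺ (λ {s} {s′} eq → toTree-injective (word-injective (toTree s) (toTree s′) eq))
      (filterᵇ-unique (evenHit l ∘ toTree) (palindromesWithin-unique n n)))
    (λ π∈ → to (proj₂ (∈-filter⁻ (T? ∘ counted l) {xs = allVecs n n} π∈)))
    (λ s∈ → let s∈′ , hit = ∈-filter⁻ (T? ∘ evenHit l ∘ toTree) {xs = palindromes n} s∈ in from (∈-palindromesWithin⁻ n n s∈′) hit)
    where
    to : ∀ {π} → T (counted l π) → wordOf π ∈ map (word ∘ toTree) (filterᵇ (evenHit l ∘ toTree) (palindromes n))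
    to {π} t with palindrome-of-counted l π t
    ... | s , w≡ , refl , hit = subst (_∈ map (word ∘ toTree) (filterᵇ (evenHit l ∘ toTree) (palindromes n))) (sym w≡)
      (∈-map⁺ (word ∘ toTree) (∈-filter⁺ (T? ∘ evenHit l ∘ toTree) (∈-palindromesWithin⁺ n s ≤-refl) hit))
    from : ∀ {s} → sizeP s ≡ n → T (evenHit l (toTree s)) → word (toTree s) ∈ map wordOf (filterᵇ (counted l) (allVecs n n))
    from {s} refl hit with counted-of-palindrome l s hit
    ... | π , w≡ , t = subst (_∈ map wordOf (filterᵇ (counted l) (allVecs n n))) w≡
      (∈-map⁺ wordOf (∈-filter⁺ (T? ∘ counted l) (∈-allVecs π) t))

  -- The fraction is normalised by a gcd that does not compute for a variable `n`, so the comparison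
  -- takes place among unnormalised rationals.
  ℕtoℚ-suc : ∀ n → ℕtoℚ (suc n) ≡ 1ℚ ℚ.+ ℕtoℚ n
  ℕtoℚ-suc n = ℚ.toℚᵘ-injective (begin
    ℚ.toℚᵘ (ℕtoℚ (suc n))                          ≈⟨ ℚ.toℚᵘ-fromℚᵘ (ℚᵘ.mkℚᵘ (+ suc n) 0) ⟩
    ℚᵘ.mkℚᵘ (+ suc n) 0                            ≈⟨ ℚᵘ.*≡* (cong (λ z → (+ 1 ℤ.+ z) ℤ.* + 1) (sym (ℤ.*-identityʳ (+ n)))) ⟩
    ℚᵘ.1ℚᵘ ℚᵘ.+ ℚᵘ.mkℚᵘ (+ n) 0                    ≈⟨ ℚᵘ.+-congʳ ℚᵘ.1ℚᵘ (ℚᵘ.≃-sym (ℚ.toℚᵘ-fromℚᵘ (ℚᵘ.mkℚᵘ (+ n) 0))) ⟩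
    ℚ.toℚᵘ 1ℚ ℚᵘ.+ ℚ.toℚᵘ (ℕtoℚ n)                 ≈⟨ ℚᵘ.≃-sym (ℚ.toℚᵘ-homo-+ 1ℚ (ℕtoℚ n)) ⟩
    ℚ.toℚᵘ (1ℚ ℚ.+ ℕtoℚ n)                         ∎)
    where open import Relation.Binary.Reasoning.Setoid ℚᵘ.≃-setoid

  ℕtoℚ-count : ∀ {A : Set} (p : A → Bool) xs → ℕtoℚ (count p xs) ≡ wsum (ind ∘ p) xs
  ℕtoℚ-count p []       = refl
  ℕtoℚ-count p (x ∷ xs) with p x
  ... | true  = trans (ℕtoℚ-suc (count p xs)) (cong (1ℚ ℚ.+_) (ℕtoℚ-count p xs))
  ... | false = trans (ℕtoℚ-count p xs) (sym (ℚ.+-identityˡ _))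

open import Data.Nat using (suc; s≤s)
open import Relation.Binary.PropositionalEquality using (trans; cong)

theorem3p13 : (k : ℕ) → k ≥ 2 → (n : ℕ) → ℕtoℚ (Ie (p2134 k) 1 n) ≡ rhs313 k n
theorem3p13 (suc (suc l)) (s≤s (s≤s _)) n =
  trans (cong ℕtoℚ (Counting.Ie-palindromes l n))
    (trans (Counting.ℕtoℚ-count (λ s → GeneratingFunctions.evenHit l (Trees.toTree s)) (Enumeration.palindromes n))
      (GeneratingFunctions.palindrome-count l n))
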